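{- Let $t\ge2$, $r\ge1$, $N=t+2r$, $\zeta=e^{2\pi i/t}$, and let $\lambda$ be a partition with at most $N$ parts such that $n_i\ge1$ for every residue $i$ modulo $t$. Put $C=\min\mathcal{S}+\max\mathcal{S}$. Suppose that $$C-\mathcal{S}=\mathcal{S}\qquad\text{and}\qquad \Delta_i(k)=C\ \text{ for some } i\in\mathcal{E} \text{ and some } k \text{ with } 1\le k\le n_i-1.$$ Then $s_\lambda\bigl(1,\zeta,\dots,\zeta^{t-1},z_1,z_1^{ -1},\dots,z_r,z_r^{ -1}\bigr)\equiv0$ identically in $z_1,\dots,z_r$.
   Context: For $\lambda=(\lambda_1\ge\dots\ge\lambda_N\ge0)$ let $\beta_j=\lambda_j+N-j$ ($1\le j\le N$) and let $n_i$ be the number of $\beta_j\equiv i\pmod t$. Let $\mathcal{E}=\{i\in\mathbb{Z}/t:n_i\ge2\}$ and $\mathcal{S}=\{\beta_j:\beta_j\bmod t\in\mathcal{E}\}$ (the excess part of the beta set; nonempty since $N>t$). For $i\in\mathcal{E}$ list the values of $\mathcal{S}$ in class $i$ as $c_{i,1}>\dots>c_{i,n_i}$ and let $\Delta_i(k)=c_{i,k}+c_{i,k+1}$ for $1\le k\le n_i-1$. $C-\mathcal{S}=\{C-x:x\in\mathcal{S}\}$. $s_\lambda$ is the Schur polynomial in $N$ variables. -}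

module Defs where

open import Level using (Level; _⊔_)
open import Algebra.Bundles using (CommutativeRing; Semiring)
open import Algebra.Apartness.Bundles using (HeytingField; HeytingCommutativeRing)
open import Data.Nat using (ℕ; zero; suc; _+_; _*_; _∸_; _≤_; _<_; _≤?_; NonZero)
open import Data.Nat.DivMod using (_mod_)
open import Data.Fin using (Fin; toℕ; _≟_)
open import Data.Product using (_×_)
open import Data.Vec using (Vec; lookup) renaming ([] to []ᵛ; _∷_ to _∷ᵛ_; sum to sumᵛ)
open import Data.Vec.Functional using (Vector; concat; last; init)
  renaming ([] to []ᶠ; _∷_ to _∷ᶠ_; _++_ to _++ᶠ_)
open import Data.List using (List; []; _∷_; map; concatMap; cartesianProductWith; upTo; tabulate; filter; length; zipWith; drop; foldr)
open import Data.List.Membership.Propositional using (_∈_)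
open import Data.List.Relation.Unary.All using (All)
open import Data.List.Relation.Binary.BagAndSetEquality using (_∼[_]_; set)
import Algebra.Definitions.RawSemiring as RawSemiringDefs

-- Beta sets. The parameter `shape` is (λ₁ , … , λ_N); `lookup shape j`
-- is λ_{j+1} because Fin counts from 0.

module BetaSet (t : ℕ) .{{_ : NonZero t}} {N : ℕ} (shape : Vec ℕ N) where

  -- In decreasing order as soon as shape is weakly decreasing.
  β : List ℕ
  β = tabulate (λ j → lookup shape j + (N ∸ suc (toℕ j)))

  n : Fin t → ℕ
  n i = length (filter (λ b → b mod t ≟ i) β)

  𝓔 : Fin t → Set
  𝓔 i = 2 ≤ n i

  𝓢 : List ℕ
  𝓢 = filter (λ b → 2 ≤? n (b mod t)) β

  -- The sequence c_{i,1} > c_{i,2} > …; filtering keeps the order of β.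
  c : Fin t → List ℕ
  c i = filter (λ b → b mod t ≟ i) 𝓢

  -- Δ i lists Δ_i(1), Δ_i(2), …; for i in 𝓔 its length is n i ∸ 1.
  Δ : Fin t → List ℕ
  Δ i = zipWith _+_ (c i) (drop 1 (c i))

IsMinimum : List ℕ → ℕ → Set
IsMinimum xs m = m ∈ xs × All (m ≤_) xs

IsMaximum : List ℕ → ℕ → Set
IsMaximum xs m = m ∈ xs × All (_≤ m) xs

-- C − X = X as sets. This is meant for lists whose elements are all at most
-- C, so that truncated subtraction is subtraction.
SymmetricAbout : ℕ → List ℕ → Set
SymmetricAbout C xs = map (C ∸_) xs ∼[ set ] xs

-- Semistandard tableaux with entries in {1, …, n}, of a shape κ with at most
-- n parts. Such a tableau is the chain ∅ = κ⁽⁰⁾ ⊆ κ⁽¹⁾ ⊆ … ⊆ κ⁽ⁿ⁾ = κ in which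
-- κ⁽ᵏ⁾ is the shape formed by the entries ≤ k. Rows are weakly and columns
-- strictly increasing exactly when every κ⁽ᵏ⁾ has at most k parts and every
-- κ⁽ᵏ⁾/κ⁽ᵏ⁻¹⁾ is a horizontal strip.

data Chain : ℕ → Set where
  []  : Chain zero
  _∷_ : ∀ {n} → Vec ℕ (suc n) → Chain n → Chain (suc n)

-- The integers m with lo ≤ m ≤ hi.
interval : ℕ → ℕ → List ℕ
interval lo hi = map (lo +_) (upTo (suc hi ∸ lo))

-- The shapes μ with κ/μ a horizontal strip and at most n parts, that is,
-- κ₁ ≥ μ₁ ≥ κ₂ ≥ μ₂ ≥ … ≥ μₙ ≥ κₙ₊₁.
strips : ∀ {n} → Vec ℕ (suc n) → List (Vec ℕ n)
strips (a ∷ᵛ []ᵛ)    = []ᵛ ∷ []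
strips (a ∷ᵛ b ∷ᵛ κ) = cartesianProductWith _∷ᵛ_ (interval b a) (strips (b ∷ᵛ κ))

tableaux : ∀ {n} → Vec ℕ n → List (Chain n)
tableaux {zero}  κ = [] ∷ []
tableaux {suc n} κ = concatMap (λ μ → map (κ ∷_) (tableaux μ)) (strips κ)

size : ∀ {n} → Chain n → ℕ
size []      = 0
size (κ ∷ _) = sumᵛ κ

module Schur {a ℓ : Level} (R : CommutativeRing a ℓ) where
  open CommutativeRing R using (Carrier; 0#; 1#; semiring) renaming (_+_ to _+ᴿ_; _*_ to _*ᴿ_)
  open RawSemiringDefs (Semiring.rawSemiring semiring) using (_^_)

  -- x^T: the letter n+1 occurs |κ| − |μ| times, μ being the next shape in the
  -- chain.
  monomial : ∀ {n} → Chain n → Vector Carrier n → Carrier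
  monomial []      x = 1#
  monomial (κ ∷ T) x = (last x ^ (sumᵛ κ ∸ size T)) *ᴿ monomial T (init x)

  schur : ∀ {n} → Vec ℕ n → Vector Carrier n → Carrier
  schur κ x = foldr _+ᴿ_ 0# (map (λ T → monomial T x) (tableaux κ))

  -- (1, ζ, …, ζ^{t−1}, z₁, w₁, …, z_r, w_r)
  point : ∀ (t : ℕ) {r} → Carrier → Vector Carrier r → Vector Carrier r → Vector Carrier (t + r * 2)
  point t ζ z w = (λ (k : Fin t) → ζ ^ toℕ k) ++ᶠ concat (λ i → z i ∷ᶠ (w i ∷ᶠ []ᶠ))

module Field {a ℓ₁ ℓ₂ : Level} (K : HeytingField a ℓ₁ ℓ₂) where
  open HeytingField K public using (Carrier; _≈_; _#_; 0#; 1#) renaming (_*_ to _*ᴷ_)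

  ring : CommutativeRing a ℓ₁
  ring = HeytingCommutativeRing.commutativeRing (HeytingField.heytingCommutativeRing K)

  open Schur ring public
  open RawSemiringDefs (Semiring.rawSemiring (CommutativeRing.semiring ring)) using (_^_) renaming (_×_ to _·_)

  CharacteristicZero : Set ℓ₂
  CharacteristicZero = ∀ k → (suc k · 1#) # 0#

  IsPrimitiveRoot : ℕ → Carrier → Set (ℓ₁ ⊔ ℓ₂)
  IsPrimitiveRoot t ζ = ζ ^ t ≈ 1# × (∀ k → 0 < k → k < t → (ζ ^ k) # 1#)

{-# OPTIONS --safe #-}

-- By the bialternant formula, the Schur polynomial at a point times the
-- Vandermonde determinant of the point is the determinant of the powers x ^ b,
-- with a row for each coordinate x and a column for each b in the beta set. The
-- Schur polynomial is a Laurent polynomial in each z_j, so it is enough that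
-- this determinant vanishes when the z_j are distinct integers greater than 1,
-- where the Vandermonde determinant is invertible.
--
-- The rows of the t-th roots of unity resolve the residue classes modulo t, so
-- row operations clear the other rows outside the excess part. Now x ↦ x⁻¹
-- permutes the rows and, up to the factor x ^ C, the columns: it takes b to
-- C − b in the excess part, and the only column of a class i to the only column
-- of the class C − i outside it. A fixed column lies in a class i with 2 i ≡ C.
-- The class whose adjacent elements add up to C has no fixed column, and there
-- is at most one other such class, which exists only when t, and hence t + 2 r,
-- is even; so by parity no column is fixed. Hence t is even and the columns are
-- exchanged in t/2 + r pairs, while the rows are exchanged in t/2 − 1 + r pairs,
-- the rows of 1 and −1 being fixed. The determinant equals minus itself.
module Submission where

open import Algebra.Apartness.Bundles using (HeytingField)
open import Algebra.Bundles using (CommutativeRing; RawRing)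
open import Data.Fin using (Fin)
open import Data.List.Membership.Propositional using (_∈_)
open import Data.List.Relation.Unary.All using (All)
open import Data.Nat using (ℕ; NonZero)
open import Data.Vec using (Vec)
open import Data.Vec.Relation.Unary.Linked using (Linked)
open import Defs using (module BetaSet; module Field; module Schur; Chain; []; _∷_; SymmetricAbout; interval; size; strips; tableaux)
import Level

-- A Heyting field has no decidable equality, so every cancellation is of a certified unit. A
-- polynomial is shown to vanish through infinitely many roots whose pairwise differences are units,
-- and the Vandermonde determinant is a unit only if the samples are apart from one another, from
-- all the inverses and from the roots of unity. Integers greater than 1 achieve this: no product of
-- two of them and no positive power of one is 1, and differences of distinct integers are units in
-- characteristic zero.
--
-- Outside the excess part the reflection of columns is only a congruence modulo t. Powers of roots
-- of unity respect it and powers of the other points do not, which is why the other rows have to be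
-- cleared there.
--
-- The reflection also extracts a factor x ^ C from each row, and the product of these factors must
-- be 1. Inverse rows cancel and the row of 1 contributes 1. The row of -1 contributes (-1) ^ C,
-- which is 1 since C ≡ 2 i modulo the even number t, where i is the class of the adjacent pair.
-- That class has no fixed column because two neighbours with sum C enclose C / 2.

-- A ring solver with integer coefficients.

module IntegerSolver {a ℓ} (R : CommutativeRing a ℓ) where
  open import Algebra.Solver.Ring.AlmostCommutativeRing using (fromCommutativeRing; _-Raw-AlmostCommutative⟶_)
  open import Data.Nat as ℕ using (ℕ; zero; suc)
  import Data.Nat.Properties as ℕₚ
  open import Data.Integer as ℤ using (ℤ; +_; -[1+_]; +[1+_]; _⊖_)
  import Data.Integer.Properties as ℤₚ
  open import Data.Maybe as Maybe using (Maybe)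
  open import Relation.Nullary.Decidable using (dec⇒maybe)
  import Relation.Binary.PropositionalEquality as ≡
  open ≡ using (_≡_)
  open CommutativeRing R
  open import Relation.Binary.Reasoning.Setoid setoid
  open import Algebra.Properties.Semiring.Mult semiring using (_×_; ×-homo-+; ×1-homo-*)
  open import Algebra.Properties.Ring ring
  open import Algebra.Properties.AbelianGroup +-abelianGroup using (⁻¹-∙-comm)

  private
    ⟦_⟧ᶻ : ℤ → Carrier
    ⟦ + n ⟧ᶻ      = n × 1#
    ⟦ -[1+ n ] ⟧ᶻ = - (suc n × 1#)

    cancel-1 : ∀ x y → (1# + x) - (1# + y) ≈ x - y
    cancel-1 x y = begin
      (1# + x) + - (1# + y)     ≈⟨ +-congˡ (⁻¹-∙-comm 1# y) ⟨
      (1# + x) + (- 1# + - y)   ≈⟨ +-congʳ (+-comm 1# x) ⟩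
      (x + 1#) + (- 1# + - y)   ≈⟨ +-assoc x 1# _ ⟩
      x + (1# + (- 1# + - y))   ≈⟨ +-congˡ (+-assoc 1# (- 1#) (- y)) ⟨
      x + ((1# + - 1#) + - y)   ≈⟨ +-congˡ (+-congʳ (-‿inverseʳ 1#)) ⟩
      x + (0# + - y)            ≈⟨ +-congˡ (+-identityˡ _) ⟩
      x - y ∎

    ⊖-homo : ∀ m n → ⟦ m ⊖ n ⟧ᶻ ≈ m × 1# - n × 1#
    ⊖-homo zero    zero    = sym (-‿inverseʳ 0#)
    ⊖-homo zero    (suc n) = sym (+-identityˡ _)
    ⊖-homo (suc m) zero    = sym (trans (+-congˡ -0#≈0#) (+-identityʳ _))
    ⊖-homo (suc m) (suc n) = begin
      ⟦ suc m ⊖ suc n ⟧ᶻ  ≡⟨ ≡.cong ⟦_⟧ᶻ (ℤₚ.[1+m]⊖[1+n]≡m⊖n m n) ⟩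
      ⟦ m ⊖ n ⟧ᶻ          ≈⟨ ⊖-homo m n ⟩
      m × 1# - n × 1#     ≈⟨ cancel-1 _ _ ⟨
      suc m × 1# - suc n × 1# ∎

    neg-homo : ∀ i → ⟦ ℤ.- i ⟧ᶻ ≈ - ⟦ i ⟧ᶻ
    neg-homo (+ zero)   = sym -0#≈0#
    neg-homo +[1+ n ]   = refl
    neg-homo -[1+ n ]   = sym (-‿involutive _)

    +-homoᶻ : ∀ i j → ⟦ i ℤ.+ j ⟧ᶻ ≈ ⟦ i ⟧ᶻ + ⟦ j ⟧ᶻ
    +-homoᶻ (+ m)    (+ n)    = ×-homo-+ 1# m n
    +-homoᶻ (+ m)    -[1+ n ] = ⊖-homo m (suc n)
    +-homoᶻ -[1+ m ] (+ n)    = trans (⊖-homo n (suc m)) (+-comm _ _)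
    +-homoᶻ -[1+ m ] -[1+ n ] = begin
      - (suc (suc (m ℕ.+ n)) × 1#)      ≡⟨ ≡.cong (λ k → - (suc k × 1#)) (ℕₚ.+-suc m n) ⟨
      - ((suc m ℕ.+ suc n) × 1#)        ≈⟨ -‿cong (×-homo-+ 1# (suc m) (suc n)) ⟩
      - (suc m × 1# + suc n × 1#)       ≈⟨ ⁻¹-∙-comm _ _ ⟨
      - (suc m × 1#) + - (suc n × 1#)   ∎

    +*+ : ∀ m n → ⟦ + m ℤ.* + n ⟧ᶻ ≈ ⟦ + m ⟧ᶻ * ⟦ + n ⟧ᶻ
    +*+ m n = trans (reflexive (≡.cong ⟦_⟧ᶻ (≡.sym (ℤₚ.pos-* m n)))) (×1-homo-* m n)

    *-homo⁺ : ∀ m j → ⟦ + m ℤ.* j ⟧ᶻ ≈ ⟦ + m ⟧ᶻ * ⟦ j ⟧ᶻ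
    *-homo⁺ m (+ n)    = +*+ m n
    *-homo⁺ m -[1+ n ] = begin
      ⟦ + m ℤ.* ℤ.- (+ suc n) ⟧ᶻ     ≡⟨ ≡.cong ⟦_⟧ᶻ (ℤₚ.neg-distribʳ-* (+ m) (+ suc n)) ⟨
      ⟦ ℤ.- (+ m ℤ.* + suc n) ⟧ᶻ     ≈⟨ neg-homo (+ m ℤ.* + suc n) ⟩
      - ⟦ + m ℤ.* + suc n ⟧ᶻ         ≈⟨ -‿cong (+*+ m (suc n)) ⟩
      - (m × 1# * (suc n × 1#))      ≈⟨ -‿distribʳ-* _ _ ⟩
      m × 1# * - (suc n × 1#)        ∎

    *-homoᶻ : ∀ i j → ⟦ i ℤ.* j ⟧ᶻ ≈ ⟦ i ⟧ᶻ * ⟦ j ⟧ᶻ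
    *-homoᶻ (+ m)    j = *-homo⁺ m j
    *-homoᶻ -[1+ m ] j = begin
      ⟦ ℤ.- (+ suc m) ℤ.* j ⟧ᶻ     ≡⟨ ≡.cong ⟦_⟧ᶻ (ℤₚ.neg-distribˡ-* (+ suc m) j) ⟨
      ⟦ ℤ.- (+ suc m ℤ.* j) ⟧ᶻ     ≈⟨ neg-homo (+ suc m ℤ.* j) ⟩
      - ⟦ + suc m ℤ.* j ⟧ᶻ         ≈⟨ -‿cong (*-homo⁺ (suc m) j) ⟩
      - (suc m × 1# * ⟦ j ⟧ᶻ)      ≈⟨ -‿distribˡ-* _ _ ⟩
      - (suc m × 1#) * ⟦ j ⟧ᶻ      ∎

    ℤ-rawRing : RawRing _ _
    ℤ-rawRing = record
      { Carrier = ℤ ; _≈_ = _≡_ ; _+_ = ℤ._+_ ; _*_ = ℤ._*_ ; -_ = ℤ.-_ ; 0# = + 0 ; 1# = + 1 }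

    morphism : ℤ-rawRing -Raw-AlmostCommutative⟶ fromCommutativeRing R
    morphism = record
      { ⟦_⟧ = ⟦_⟧ᶻ ; +-homo = +-homoᶻ ; *-homo = *-homoᶻ ; -‿homo = neg-homo
      ; 0-homo = refl ; 1-homo = +-identityʳ 1# }

    -- Equality in the ring is not decidable. Comparing integer coefficients instead is what lets
    -- the solver recognise cancellations.
    _≟ᶻ_ : ∀ i j → Maybe (⟦ i ⟧ᶻ ≈ ⟦ j ⟧ᶻ)
    i ≟ᶻ j = Maybe.map (λ eq → reflexive (≡.cong ⟦_⟧ᶻ eq)) (dec⇒maybe (i ℤ.≟ j))

  open import Algebra.Solver.Ring ℤ-rawRing (fromCommutativeRing R) morphism _≟ᶻ_ public
    using (solve; _:=_; _:+_; _:*_; _:-_; :-_; con)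

-- Decomposition of an involution into pairs and fixed points.

module Pairing where
  open import Data.Empty using (⊥-elim)
  open import Data.List using (List; []; _∷_; _++_; concatMap; length)
  open import Data.List.Membership.Propositional using (_∈_)
  open import Data.List.Membership.Propositional.Properties using (∈-∃++)
  open import Data.List.Relation.Binary.Permutation.Propositional using (_↭_; ↭⇒↭ₛ; ↭-refl; prep; ↭-trans; ↭-sym)
  open import Data.List.Relation.Binary.Permutation.Propositional.Properties using (shift; ∈-resp-↭; ↭-length)
  import Data.List.Relation.Binary.Permutation.Setoid.Properties as PermutationSetoid
  open import Data.List.Relation.Unary.All as All using (All; []; _∷_)
  open import Data.List.Relation.Unary.AllPairs as AllPairs using (AllPairs; []; _∷_)
  open import Data.List.Relation.Unary.Any using (here; there)
  open import Data.List.Relation.Unary.Unique.Propositional using (Unique)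
  open import Data.Nat using (ℕ; suc; _≤_; s≤s)
  import Data.Nat.Properties as ℕ
  open import Data.Product using (_×_; _,_; ∃-syntax)
  open import Relation.Binary.Core using (Rel)
  open import Relation.Binary.Definitions using (Symmetric)
  open import Relation.Binary.PropositionalEquality as ≡ using (_≡_; refl)

  flatten : ∀ {b} {B : Set b} → List (B × B) → List B
  flatten = concatMap (λ (p , q) → p ∷ q ∷ [])

  module _ {a} {A : Set a} where

    AllPairs-resp-↭ : ∀ {ℓ} {R : Rel A ℓ} → Symmetric R → ∀ {xs ys} → xs ↭ ys → AllPairs R xs → AllPairs R ys
    AllPairs-resp-↭ {R = R} R-sym p = PermutationSetoid.AllPairs-resp-↭ (≡.setoid A) R-sym (≡.resp₂ R) (↭⇒↭ₛ p)

    Unique-resp-↭ : ∀ {xs ys : List A} → xs ↭ ys → Unique xs → Unique ys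
    Unique-resp-↭ = AllPairs-resp-↭ (λ x≢y y≡x → x≢y (≡.sym y≡x))

    -- The 2-cycles and the fixed points of an involution given as a relation. `perm` uses each
    -- entry exactly once, so that entries can be counted.
    record Matching {m} (M : Rel A m) (xs : List A) : Set (a Level.⊔ m) where
      field
        pairs   : List (A × A)
        fixed   : List A
        perm    : xs ↭ flatten pairs ++ fixed
        matched : All (λ (p , q) → p ∈ xs × q ∈ xs × M p q) pairs
        loops   : All (λ f → f ∈ xs × M f f) fixed
        unique  : Unique fixed

    module _ {m} {M : Rel A m} (M-sym : Symmetric M) where

      -- Removes an entry together with its partner. Symmetry and functionality keep the rest closed
      -- under partners, since nothing else can be related to a removed entry. The bound `k` drives
      -- the recursion because deleting a partner from the middle of the list is not a structural
      -- descent.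
      matching : ∀ k (xs : List A) → length xs ≤ k → Unique xs →
                 (∀ {x} → x ∈ xs → ∃[ y ] y ∈ xs × M x y) →
                 (∀ {x y z} → x ∈ xs → y ∈ xs → z ∈ xs → M x y → M x z → y ≡ z) →
                 Matching M xs
      matching k [] _ _ _ _ =
        record { pairs = [] ; fixed = [] ; perm = ↭-refl ; matched = [] ; loops = [] ; unique = [] }
      matching (suc k) (x ∷ xs) (s≤s len) (x∉ ∷ xs!) partner functional with partner (here refl)
      ... | _ , here refl , Mxx = record
        { pairs   = pairs
        ; fixed   = x ∷ fixed
        ; perm    = ↭-trans (prep x perm) (↭-sym (shift x (flatten pairs) fixed))
        ; matched = All.map (λ (p∈ , q∈ , Mpq) → there p∈ , there q∈ , Mpq) matched
        ; loops   = (here refl , Mxx) ∷ All.map (λ (f∈ , Mff) → there f∈ , Mff) loops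
        ; unique  = All.map (λ (f∈ , _) → All.lookup x∉ f∈) loops ∷ unique
        }
        where
        partner′ : ∀ {z} → z ∈ xs → ∃[ y ] y ∈ xs × M z y
        partner′ z∈ with partner (there z∈)
        ... | _ , here refl , Mzx =
          ⊥-elim (All.lookup x∉ z∈ (functional (here refl) (here refl) (there z∈) Mxx (M-sym Mzx)))
        ... | y , there y∈  , Mzy = y , y∈ , Mzy
        open Matching (matching k xs len xs! partner′
          (λ x∈ y∈ z∈ → functional (there x∈) (there y∈) (there z∈)))
      ... | y , there y∈ , Mxy with ∈-∃++ y∈
      ... | us , vs , refl = record
        { pairs   = (x , y) ∷ pairs
        ; fixed   = fixed
        ; perm    = ↭-trans front (prep x (prep y perm))
        ; matched = (here refl , there y∈ , Mxy) ∷ All.map (λ (p∈ , q∈ , Mpq) → old p∈ , old q∈ , Mpq) matched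
        ; loops   = All.map (λ (f∈ , Mff) → old f∈ , Mff) loops
        ; unique  = unique
        }
        where
        rest = us ++ vs
        front : x ∷ us ++ y ∷ vs ↭ x ∷ y ∷ rest
        front = prep x (shift y us vs)
        old : ∀ {z} → z ∈ rest → z ∈ x ∷ us ++ y ∷ vs
        old z∈ = ∈-resp-↭ (↭-sym front) (there (there z∈))
        front! : Unique (x ∷ y ∷ rest)
        front! = Unique-resp-↭ front (x∉ ∷ xs!)
        partner′ : ∀ {z} → z ∈ rest → ∃[ w ] w ∈ rest × M z w
        partner′ z∈ with partner (old z∈)
        ... | w , w∈ , Mzw with ∈-resp-↭ front w∈
        ... | here refl = ⊥-elim (All.lookup (AllPairs.head (AllPairs.tail front!)) z∈
                (functional (here refl) (there y∈) (old z∈) Mxy (M-sym Mzw)))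
        ... | there (here refl) = ⊥-elim (All.lookup (AllPairs.head front!) (there z∈)
                (functional (there y∈) (here refl) (old z∈) (M-sym Mxy) (M-sym Mzw)))
        ... | there (there w∈′) = w , w∈′ , Mzw
        open Matching (matching k rest
          (ℕ.≤-pred (ℕ.≤-trans (ℕ.≤-reflexive (≡.sym (↭-length (shift y us vs)))) (ℕ.m≤n⇒m≤1+n len)))
          (AllPairs.tail (AllPairs.tail front!)) partner′
          (λ x∈ y∈ z∈ → functional (old x∈) (old y∈) (old z∈)))

-- Determinants by cofactor expansion, over lists of rows and columns.

module Determinant {a ℓ} (R : CommutativeRing a ℓ) where
  open import Data.Integer using (+_)
  open import Data.List using (List; []; _∷_; _++_; map; foldr; length)
  open import Data.List.Membership.Propositional using (_∈_)
  open import Data.List.Membership.Propositional.Properties using (∈-∃++)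
  open import Data.List.Relation.Unary.All using (All; []; _∷_)
  open import Data.List.Relation.Binary.Permutation.Propositional using (_↭_; refl; prep; swap; trans)
  open import Data.List.Relation.Binary.Permutation.Propositional.Properties using (shift)
  open import Data.Nat using (ℕ; zero; suc)
  open import Data.Product using (_×_; _,_; ∃-syntax)
  import Data.Product as Product
  open import Function using (_∘_; const)
  open import Relation.Binary.PropositionalEquality as ≡ using (_≡_)
  open CommutativeRing R renaming (refl to ≈-refl; sym to ≈-sym; trans to ≈-trans)
  open import Relation.Binary.Reasoning.Setoid setoid
  open import Algebra.Properties.Ring ring
  open IntegerSolver R
  open Pairing using (flatten)

  -- Cofactor expansion along a row φ, where D is the determinant of the
  -- remaining rows: the sign comes from moving φ past the columns on its left.
  expand : ∀ {b} {B : Set b} → (B → Carrier) → (List B → Carrier) → List B → Carrier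
  expand φ D []       = 0#
  expand φ D (c ∷ cs) = φ c * D cs - expand φ (D ∘ (c ∷_)) cs

  -- Columns are labels of any type: exponents for the beta numbers, functions of the point in the
  -- proof of the bialternant formula. Lists of different lengths give 0.
  det : ∀ {b} {B : Set b} → List (B → Carrier) → List B → Carrier
  det []       []      = 1#
  det []       (_ ∷ _) = 0#
  det (φ ∷ φs) cs      = expand φ (det φs) cs

  prod : List Carrier → Carrier
  prod = foldr _*_ 1#

  module _ {b} {B : Set b} where

    -- Agreement is asked only at columns satisfying `P`, because a cleared row has its intended
    -- entries on `β` alone.
    expand-cong : ∀ {p} {P : B → Set p} {φ ψ D E} → (∀ {c} → P c → φ c ≈ ψ c) →
                  (∀ {ds} → All P ds → D ds ≈ E ds) → ∀ {cs} → All P cs → expand φ D cs ≈ expand ψ E cs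
    expand-cong φ≈ψ D≈E []         = ≈-refl
    expand-cong φ≈ψ D≈E (pc ∷ pcs) =
      +-cong (*-cong (φ≈ψ pc) (D≈E pcs)) (-‿cong (expand-cong φ≈ψ (D≈E ∘ (pc ∷_)) pcs))

    expand-congʳ : ∀ {φ D E} → (∀ ds → D ds ≈ E ds) → ∀ cs → expand {B = B} φ D cs ≈ expand φ E cs
    expand-congʳ D≈E []       = ≈-refl
    expand-congʳ D≈E (c ∷ cs) = +-cong (*-congˡ (D≈E cs)) (-‿cong (expand-congʳ (D≈E ∘ (c ∷_)) cs))

    expand-linearˡ : ∀ {φ ψ χ D} α β → (∀ c → χ c ≈ α * φ c + β * ψ c) →
                     ∀ cs → expand {B = B} χ D cs ≈ α * expand φ D cs + β * expand ψ D cs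
    expand-linearˡ α β eq []       = solve 2 (λ α β → con (+ 0) := α :* con (+ 0) :+ β :* con (+ 0)) ≈-refl α β
    expand-linearˡ {φ} {ψ} {χ} {D} α β eq (c ∷ cs) = begin
      χ c * D cs - expand χ (D ∘ (c ∷_)) cs
        ≈⟨ +-cong (*-congʳ (eq c)) (-‿cong (expand-linearˡ α β eq cs)) ⟩
      (α * φ c + β * ψ c) * D cs - (α * expand φ (D ∘ (c ∷_)) cs + β * expand ψ (D ∘ (c ∷_)) cs)
        ≈⟨ solve 7 (λ α β u v d p q → (α :* u :+ β :* v) :* d :- (α :* p :+ β :* q)
                                    := α :* (u :* d :- p) :+ β :* (v :* d :- q)) ≈-refl α β _ _ _ _ _ ⟩
      α * expand φ D (c ∷ cs) + β * expand ψ D (c ∷ cs) ∎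

    expand-linearʳ : ∀ {φ D E F} α β → (∀ ds → F ds ≈ α * D ds + β * E ds) →
                     ∀ cs → expand {B = B} φ F cs ≈ α * expand φ D cs + β * expand φ E cs
    expand-linearʳ α β eq []       = solve 2 (λ α β → con (+ 0) := α :* con (+ 0) :+ β :* con (+ 0)) ≈-refl α β
    expand-linearʳ {φ} {D} {E} {F} α β eq (c ∷ cs) = begin
      φ c * F cs - expand φ (F ∘ (c ∷_)) cs
        ≈⟨ +-cong (*-congˡ (eq cs)) (-‿cong (expand-linearʳ α β (eq ∘ (c ∷_)) cs)) ⟩
      φ c * (α * D cs + β * E cs) - (α * expand φ (D ∘ (c ∷_)) cs + β * expand φ (E ∘ (c ∷_)) cs)
        ≈⟨ solve 7 (λ α β u d e p q → u :* (α :* d :+ β :* e) :- (α :* p :+ β :* q)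
                                    := α :* (u :* d :- p) :+ β :* (u :* e :- q)) ≈-refl α β _ _ _ _ _ ⟩
      α * expand φ D (c ∷ cs) + β * expand φ E (c ∷ cs) ∎

    -- The first column can be taken by either copy of `φ`, and these two terms cancel; the rest is
    -- the same expansion over the remaining columns. Deducing this from `expand-swap` would mean
    -- dividing by 2 in a general ring.
    expand-twice : ∀ φ D cs → expand {B = B} φ (expand φ D) cs ≈ 0#
    expand-twice φ D []       = ≈-refl
    expand-twice φ D (c ∷ cs) = begin
      φ c * expand φ D cs - expand φ (λ ds → φ c * D ds - expand φ (D ∘ (c ∷_)) ds) cs
        ≈⟨ +-congˡ (-‿cong (expand-linearʳ (φ c) (- 1#) (λ ds → +-congˡ (≈-sym (-1*x≈-x _))) cs)) ⟩
      φ c * expand φ D cs - (φ c * expand φ D cs + - 1# * expand φ (expand φ (D ∘ (c ∷_))) cs)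
        ≈⟨ +-congˡ (-‿cong (+-congˡ (*-congˡ (expand-twice φ (D ∘ (c ∷_)) cs)))) ⟩
      φ c * expand φ D cs - (φ c * expand φ D cs + - 1# * 0#)
        ≈⟨ solve 2 (λ x o → x :- (x :+ :- o :* con (+ 0)) := con (+ 0)) ≈-refl _ 1# ⟩
      0# ∎

    expand-swap : ∀ φ ψ D cs → expand {B = B} φ (expand ψ D) cs ≈ - expand ψ (expand φ D) cs
    expand-swap φ ψ D []       = ≈-sym -0#≈0#
    expand-swap φ ψ D (c ∷ cs) = begin
      φ c * expand ψ D cs - expand φ (λ ds → ψ c * D ds - expand ψ (D ∘ (c ∷_)) ds) cs
        ≈⟨ +-congˡ (-‿cong (expand-linearʳ (ψ c) (- 1#) (λ ds → +-congˡ (≈-sym (-1*x≈-x _))) cs)) ⟩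
      φ c * expand ψ D cs - (ψ c * expand φ D cs + - 1# * expand φ (expand ψ (D ∘ (c ∷_))) cs)
        ≈⟨ +-congˡ (-‿cong (+-congˡ (*-congˡ (expand-swap φ ψ (D ∘ (c ∷_)) cs)))) ⟩
      φ c * expand ψ D cs - (ψ c * expand φ D cs + - 1# * - expand ψ (expand φ (D ∘ (c ∷_))) cs)
        ≈⟨ solve 4 (λ x y o z → x :- (y :+ :- o :* :- z) := :- (y :- (x :+ :- o :* z))) ≈-refl _ _ 1# _ ⟩
      - (ψ c * expand φ D cs - (φ c * expand ψ D cs + - 1# * expand ψ (expand φ (D ∘ (c ∷_))) cs))
        ≈⟨ -‿cong (+-congˡ (-‿cong (expand-linearʳ (φ c) (- 1#) (λ ds → +-congˡ (≈-sym (-1*x≈-x _))) cs))) ⟨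
      - (ψ c * expand φ D cs - expand ψ (λ ds → φ c * D ds - expand φ (D ∘ (c ∷_)) ds) cs) ∎

    expand-scale : ∀ {φ ψ : B → Carrier} {D E} s t → (∀ c → φ c ≈ s * ψ c) → (∀ ds → D ds ≈ t * E ds) →
                   ∀ cs → expand φ D cs ≈ s * t * expand ψ E cs
    expand-scale s t φ≈ D≈ [] = ≈-sym (zeroʳ _)
    expand-scale {φ} {ψ} {D} {E} s t φ≈ D≈ (c ∷ cs) = begin
      φ c * D cs - expand φ (D ∘ (c ∷_)) cs
        ≈⟨ +-cong (*-cong (φ≈ c) (D≈ cs)) (-‿cong (expand-scale s t φ≈ (D≈ ∘ (c ∷_)) cs)) ⟩
      s * ψ c * (t * E cs) - s * t * expand ψ (E ∘ (c ∷_)) cs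
        ≈⟨ solve 5 (λ s t u v w → s :* u :* (t :* v) :- s :* t :* w := s :* t :* (u :* v :- w)) ≈-refl s t _ _ _ ⟩
      s * t * expand ψ E (c ∷ cs) ∎

    expand-scaleʳ : ∀ {φ D E} t → (∀ ds → D ds ≈ t * E ds) → ∀ cs → expand {B = B} φ D cs ≈ t * expand φ E cs
    expand-scaleʳ t D≈ cs =
      ≈-trans (expand-scale 1# t (λ c → ≈-sym (*-identityˡ _)) D≈ cs) (*-congʳ (*-identityˡ t))

    expand-neg : ∀ {φ D E} → (∀ ds → D ds ≈ - E ds) → ∀ cs → expand {B = B} φ D cs ≈ - expand φ E cs
    expand-neg D≈ cs = ≈-trans (expand-scaleʳ (- 1#) (λ ds → ≈-trans (D≈ ds) (≈-sym (-1*x≈-x _))) cs) (-1*x≈-x _)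

    expand-zero : ∀ {φ D} → (∀ ds → D ds ≈ 0#) → ∀ cs → expand {B = B} φ D cs ≈ 0#
    expand-zero {D = D} D≈0 cs =
      ≈-trans (expand-scaleʳ 0# (λ ds → ≈-trans (D≈0 ds) (≈-sym (zeroˡ (D ds)))) cs) (zeroˡ _)

    det-cong : ∀ {p x} {X : Set x} {P : B → Set p} {f g : X → B → Carrier} {xs} →
               All (λ x → ∀ {c} → P c → f x c ≈ g x c) xs →
               ∀ {cs} → All P cs → det (map f xs) cs ≈ det (map g xs) cs
    det-cong []          []      = ≈-refl
    det-cong []          (_ ∷ _) = ≈-refl
    det-cong (f≈g ∷ eqs) pcs     = expand-cong f≈g (det-cong eqs) pcs

    det-scale : ∀ {x} {X : Set x} (s : X → Carrier) (f g : X → B → Carrier) → (∀ x c → f x c ≈ s x * g x c) →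
                ∀ xs cs → det (map f xs) cs ≈ prod (map s xs) * det (map g xs) cs
    det-scale s f g f≈ []       []      = ≈-sym (*-identityˡ 1#)
    det-scale s f g f≈ []       (_ ∷ _) = ≈-sym (zeroʳ 1#)
    det-scale s f g f≈ (x ∷ xs) cs      = expand-scale (s x) _ (f≈ x) (det-scale s f g f≈ xs) cs

    -- The scalar is a sign whose value is not kept, because reordering only has to carry vanishing
    -- over. The parity on which the theorem rests is tracked by `det-flatten` and
    -- `alternating-flatten`.
    det-↭ : ∀ {φs ψs} → φs ↭ ψs → ∃[ ε ] ∀ cs → det {B = B} φs cs ≈ ε * det ψs cs
    det-↭ refl = 1# , λ cs → ≈-sym (*-identityˡ _)
    det-↭ (prep φ p) = Product.map₂ (λ eq cs → expand-scaleʳ _ eq cs) (det-↭ p)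
    det-↭ {φs = φ ∷ ψ ∷ φs} {ψs = _ ∷ _ ∷ ψs} (swap φ ψ p) with det-↭ p
    ... | ε , eq = - ε , λ cs → begin
      expand φ (expand ψ (det φs)) cs       ≈⟨ expand-swap φ ψ (det φs) cs ⟩
      - expand ψ (expand φ (det φs)) cs     ≈⟨ -‿cong (expand-scaleʳ ε (expand-scaleʳ ε eq) cs) ⟩
      - (ε * expand ψ (expand φ (det ψs)) cs) ≈⟨ -‿distribˡ-* ε _ ⟩
      - ε * expand ψ (expand φ (det ψs)) cs ∎
    det-↭ (trans p q) with det-↭ p | det-↭ q
    ... | ε , eq | δ , eq′ = ε * δ , λ cs →
      ≈-trans (eq cs) (≈-trans (*-congˡ (eq′ cs)) (≈-sym (*-assoc ε δ _)))

    det-↭-zero : ∀ {φs ψs cs} → φs ↭ ψs → det ψs cs ≈ 0# → det {B = B} φs cs ≈ 0#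
    det-↭-zero p eq with det-↭ p
    ... | ε , scaled = ≈-trans (scaled _) (≈-trans (*-congˡ eq) (zeroʳ ε))

    det-repeat : ∀ {φ φs} → φ ∈ φs → ∀ cs → det {B = B} (φ ∷ φs) cs ≈ 0#
    det-repeat {φ} {φs} φ∈φs cs with ∈-∃++ φ∈φs
    ... | us , vs , ≡.refl =
      det-↭-zero {cs = cs} (prep φ (shift φ us vs)) (expand-twice φ (det (us ++ vs)) cs)

    combination : List (Carrier × (B → Carrier)) → B → Carrier
    combination ts c = foldr _+_ 0# (map (λ (α , φ) → α * φ c) ts)

    det-combination : ∀ {φs} ts → All (λ (α , φ) → φ ∈ φs) ts → ∀ cs → det (combination ts ∷ φs) cs ≈ 0#
    det-combination {φs} [] [] cs = begin
      expand (λ _ → 0#) (det φs) cs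
        ≈⟨ expand-linearˡ {φ = const 0#} {ψ = const 0#} 0# 0# (λ c → solve 0 (con (+ 0) := con (+ 0) :* con (+ 0) :+ con (+ 0) :* con (+ 0)) ≈-refl) cs ⟩
      0# * expand (const 0#) (det φs) cs + 0# * expand (const 0#) (det φs) cs
        ≈⟨ solve 1 (λ x → con (+ 0) :* x :+ con (+ 0) :* x := con (+ 0)) ≈-refl _ ⟩
      0# ∎
    det-combination {φs} ((α , φ) ∷ ts) (φ∈ ∷ ts∈) cs = begin
      expand (combination ((α , φ) ∷ ts)) (det φs) cs
        ≈⟨ expand-linearˡ α 1# (λ c → +-congˡ (≈-sym (*-identityˡ _))) cs ⟩
      α * det (φ ∷ φs) cs + 1# * det (combination ts ∷ φs) cs
        ≈⟨ +-cong (*-congˡ (det-repeat φ∈ cs)) (*-congˡ (det-combination ts ts∈ cs)) ⟩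
      α * 0# + 1# * 0#
        ≈⟨ solve 2 (λ x y → x :* con (+ 0) :+ y :* con (+ 0) := con (+ 0)) ≈-refl α 1# ⟩
      0# ∎

    det-sub-combination : ∀ {φ φs} ts → All (λ (α , φ) → φ ∈ φs) ts → ∀ cs →
                          det ((λ c → φ c - combination ts c) ∷ φs) cs ≈ det (φ ∷ φs) cs
    det-sub-combination {φ} {φs} ts ts∈ cs = begin
      expand (λ c → φ c - combination ts c) (det φs) cs
        ≈⟨ expand-linearˡ 1# (- 1#) (λ c → +-cong (≈-sym (*-identityˡ _)) (≈-sym (-1*x≈-x _))) cs ⟩
      1# * det (φ ∷ φs) cs + - 1# * det (combination ts ∷ φs) cs
        ≈⟨ +-cong (*-identityˡ _) (*-congˡ (det-combination ts ts∈ cs)) ⟩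
      det (φ ∷ φs) cs + - 1# * 0#
        ≈⟨ solve 2 (λ x o → x :+ :- o :* con (+ 0) := x) ≈-refl _ 1# ⟩
      det (φ ∷ φs) cs ∎

    -- A property of arbitrary functions of the column list, so that it survives fixing the leading
    -- columns, as inductions on the columns require.
    Alternating : (List B → Carrier) → Set _
    Alternating D = ∀ us a b cs → D (us ++ a ∷ b ∷ cs) ≈ - D (us ++ b ∷ a ∷ cs)

    expand-alternating : ∀ φ {D} → Alternating D → Alternating (expand φ D)
    expand-alternating φ {D} alt [] a b cs = begin
      φ a * D (b ∷ cs) - (φ b * D (a ∷ cs) - expand φ (D ∘ (a ∷_) ∘ (b ∷_)) cs)
        ≈⟨ +-congˡ (-‿cong (+-congˡ (-‿cong (expand-neg (alt [] a b) cs)))) ⟩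
      φ a * D (b ∷ cs) - (φ b * D (a ∷ cs) - - expand φ (D ∘ (b ∷_) ∘ (a ∷_)) cs)
        ≈⟨ solve 3 (λ x y z → x :- (y :- :- z) := :- (y :- (x :- z))) ≈-refl _ _ _ ⟩
      - (φ b * D (a ∷ cs) - (φ a * D (b ∷ cs) - expand φ (D ∘ (b ∷_) ∘ (a ∷_)) cs)) ∎
    expand-alternating φ {D} alt (u ∷ us) a b cs = begin
      φ u * D (us ++ a ∷ b ∷ cs) - expand φ (D ∘ (u ∷_)) (us ++ a ∷ b ∷ cs)
        ≈⟨ +-cong (*-congˡ (alt us a b cs)) (-‿cong (expand-alternating φ (alt ∘ (u ∷_)) us a b cs)) ⟩
      φ u * - D (us ++ b ∷ a ∷ cs) - - expand φ (D ∘ (u ∷_)) (us ++ b ∷ a ∷ cs)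
        ≈⟨ solve 3 (λ x y z → x :* :- y :- :- z := :- (x :* y :- z)) ≈-refl _ _ _ ⟩
      - (φ u * D (us ++ b ∷ a ∷ cs) - expand φ (D ∘ (u ∷_)) (us ++ b ∷ a ∷ cs)) ∎

    det-alternating : ∀ φs → Alternating (det φs)
    det-alternating []       []      a b cs = ≈-sym -0#≈0#
    det-alternating []       (_ ∷ _) a b cs = ≈-sym -0#≈0#
    det-alternating (φ ∷ φs) = expand-alternating φ (det-alternating φs)

    alternating-↭ : ∀ {D} → Alternating D → ∀ {cs ds} → cs ↭ ds → ∃[ ε ] D cs ≈ ε * D ds
    alternating-↭ alt refl = 1# , ≈-sym (*-identityˡ _)
    alternating-↭ alt (prep c p) = alternating-↭ (alt ∘ (c ∷_)) p
    alternating-↭ {D} alt {cs = _ ∷ _ ∷ cs} {ds = _ ∷ _ ∷ ds} (swap a b p)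
      with alternating-↭ (alt ∘ (a ∷_) ∘ (b ∷_)) p
    ... | ε , eq = - ε , (begin
      D (a ∷ b ∷ cs)       ≈⟨ eq ⟩
      ε * D (a ∷ b ∷ ds)   ≈⟨ *-congˡ (alt [] a b ds) ⟩
      ε * - D (b ∷ a ∷ ds) ≈⟨ solve 2 (λ x y → x :* :- y := :- x :* y) ≈-refl _ _ ⟩
      - ε * D (b ∷ a ∷ ds) ∎)
    alternating-↭ alt (trans p q) with alternating-↭ alt p | alternating-↭ alt q
    ... | ε , eq | δ , eq′ = ε * δ , ≈-trans eq (≈-trans (*-congˡ eq′) (≈-sym (*-assoc ε δ _)))

    det-↭ᶜ-zero : ∀ {φs cs ds} → cs ↭ ds → det φs ds ≈ 0# → det φs cs ≈ 0#
    det-↭ᶜ-zero {φs} p eq with alternating-↭ (det-alternating φs) p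
    ... | ε , scaled = ≈-trans scaled (≈-trans (*-congˡ eq) (zeroʳ ε))

  sign : ℕ → Carrier
  sign zero    = 1#
  sign (suc n) = - sign n

  module _ {b} {B : Set b} where

    -- Each pair costs one adjacent transposition, so the sign is known exactly.
    alternating-flatten : ∀ {D} → Alternating {B = B} D →
                          ∀ ps → D (flatten ps) ≈ sign (length ps) * D (flatten (map Product.swap ps))
    alternating-flatten alt [] = ≈-sym (*-identityˡ _)
    alternating-flatten {D} alt ((p , q) ∷ ps) = begin
      D (p ∷ q ∷ flatten ps)
        ≈⟨ alt [] p q _ ⟩
      - D (q ∷ p ∷ flatten ps)
        ≈⟨ -‿cong (alternating-flatten {D = D ∘ (q ∷_) ∘ (p ∷_)} (alt ∘ (q ∷_) ∘ (p ∷_)) ps) ⟩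
      - (sign (length ps) * D (q ∷ p ∷ flatten (map Product.swap ps)))
        ≈⟨ -‿distribˡ-* _ _ ⟩
      - sign (length ps) * D (q ∷ p ∷ flatten (map Product.swap ps)) ∎

    det-flatten : ∀ ps {φs} cs → det {B = B} (flatten ps ++ φs) cs ≈
                                 sign (length ps) * det (flatten (map Product.swap ps) ++ φs) cs
    det-flatten [] cs = ≈-sym (*-identityˡ _)
    det-flatten ((φ , ψ) ∷ ps) {φs} cs = begin
      expand φ (expand ψ (det (flatten ps ++ φs))) cs
        ≈⟨ expand-swap φ ψ _ cs ⟩
      - expand ψ (expand φ (det (flatten ps ++ φs))) cs
        ≈⟨ -‿cong (expand-scaleʳ _ (expand-scaleʳ _ (det-flatten ps)) cs) ⟩
      - (sign (length ps) * expand ψ (expand φ (det (flatten (map Product.swap ps) ++ φs))) cs)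
        ≈⟨ -‿distribˡ-* _ _ ⟩
      - sign (length ps) * expand ψ (expand φ (det (flatten (map Product.swap ps) ++ φs))) cs ∎

  module _ {x} {X : Set x} where

    -- The bialternant formula is proved by column operations, for which columns have to be
    -- functions of the point that can be combined linearly.
    record AlternatingMultilinear (D : List (X → Carrier) → Carrier) : Set (x Level.⊔ a Level.⊔ ℓ) where
      field
        repeat : ∀ us f cs → D (us ++ f ∷ f ∷ cs) ≈ 0#
        linear : ∀ us {f g h} cs α β → (∀ x → h x ≈ α * f x + β * g x) →
                 D (us ++ h ∷ cs) ≈ α * D (us ++ f ∷ cs) + β * D (us ++ g ∷ cs)
    open AlternatingMultilinear

    fix-column : ∀ {D} → AlternatingMultilinear D → ∀ f → AlternatingMultilinear (D ∘ (f ∷_))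
    fix-column D-am f .repeat us = D-am .repeat (f ∷ us)
    fix-column D-am f .linear us = D-am .linear (f ∷ us)

    expand-alternatingMultilinear : ∀ x {D} → AlternatingMultilinear D →
                                    AlternatingMultilinear (expand (λ f → f x) D)
    expand-alternatingMultilinear x {D} D-am .repeat [] f cs = begin
      f x * D (f ∷ cs) - (f x * D (f ∷ cs) - expand (λ f → f x) (D ∘ (f ∷_) ∘ (f ∷_)) cs)
        ≈⟨ +-congˡ (-‿cong (+-congˡ (-‿cong (expand-zero (D-am .repeat [] f) cs)))) ⟩
      f x * D (f ∷ cs) - (f x * D (f ∷ cs) - 0#)
        ≈⟨ solve 1 (λ y → y :- (y :- con (+ 0)) := con (+ 0)) ≈-refl _ ⟩
      0# ∎
    expand-alternatingMultilinear x {D} D-am .repeat (u ∷ us) f cs = begin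
      u x * D (us ++ f ∷ f ∷ cs) - expand (λ f → f x) (D ∘ (u ∷_)) (us ++ f ∷ f ∷ cs)
        ≈⟨ +-cong (*-congˡ (D-am .repeat us f cs))
                  (-‿cong (expand-alternatingMultilinear x (fix-column D-am u) .repeat us f cs)) ⟩
      u x * 0# - 0#
        ≈⟨ solve 1 (λ y → y :* con (+ 0) :- con (+ 0) := con (+ 0)) ≈-refl _ ⟩
      0# ∎
    expand-alternatingMultilinear x {D} D-am .linear [] {f} {g} {h} cs α β eq = begin
      h x * D cs - expand (λ f → f x) (D ∘ (h ∷_)) cs
        ≈⟨ +-cong (*-congʳ (eq x)) (-‿cong (expand-linearʳ α β (λ ds → D-am .linear [] ds α β eq) cs)) ⟩
      (α * f x + β * g x) * D cs - (α * expand (λ f → f x) (D ∘ (f ∷_)) cs + β * expand (λ f → f x) (D ∘ (g ∷_)) cs)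
        ≈⟨ solve 7 (λ α β u v d p q → (α :* u :+ β :* v) :* d :- (α :* p :+ β :* q)
                                    := α :* (u :* d :- p) :+ β :* (v :* d :- q)) ≈-refl α β _ _ _ _ _ ⟩
      _ ∎
    expand-alternatingMultilinear x {D} D-am .linear (u ∷ us) {f} {g} {h} cs α β eq = begin
      u x * D (us ++ h ∷ cs) - expand (λ f → f x) (D ∘ (u ∷_)) (us ++ h ∷ cs)
        ≈⟨ +-cong (*-congˡ (D-am .linear us cs α β eq))
                  (-‿cong (expand-alternatingMultilinear x (fix-column D-am u) .linear us cs α β eq)) ⟩
      u x * (α * D (us ++ f ∷ cs) + β * D (us ++ g ∷ cs)) - (α * _ + β * _)
        ≈⟨ solve 7 (λ α β u d e p q → u :* (α :* d :+ β :* e) :- (α :* p :+ β :* q)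
                                    := α :* (u :* d :- p) :+ β :* (u :* e :- q)) ≈-refl α β _ _ _ _ _ ⟩
      _ ∎

    evaluations : List X → List ((X → Carrier) → Carrier)
    evaluations = map (λ x f → f x)

    det-alternatingMultilinear : ∀ xs → AlternatingMultilinear (det (evaluations xs))
    det-alternatingMultilinear [] .repeat []      f cs = ≈-refl
    det-alternatingMultilinear [] .repeat (_ ∷ _) f cs = ≈-refl
    det-alternatingMultilinear [] .linear []      cs α β eq =
      solve 2 (λ α β → con (+ 0) := α :* con (+ 0) :+ β :* con (+ 0)) ≈-refl α β
    det-alternatingMultilinear [] .linear (_ ∷ _) cs α β eq =
      solve 2 (λ α β → con (+ 0) := α :* con (+ 0) :+ β :* con (+ 0)) ≈-refl α β
    det-alternatingMultilinear (x ∷ xs) = expand-alternatingMultilinear x (det-alternatingMultilinear xs)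

  expand-map : ∀ {b c} {B : Set b} {C : Set c} (h : B → C) {φ} {D : List C → Carrier} {E : List B → Carrier} →
               (∀ bs → D (map h bs) ≈ E bs) → ∀ bs → expand φ D (map h bs) ≈ expand (φ ∘ h) E bs
  expand-map h D≈E []       = ≈-refl
  expand-map h D≈E (b ∷ bs) = +-cong (*-congˡ (D≈E bs)) (-‿cong (expand-map h (D≈E ∘ (b ∷_)) bs))

  -- Passes between columns that are functions and columns that merely label them.
  det-map : ∀ {b c} {B : Set b} {C : Set c} (h : B → C) φs bs → det φs (map h bs) ≈ det (map (_∘ h) φs) bs
  det-map h []       []      = ≈-refl
  det-map h []       (_ ∷ _) = ≈-refl
  det-map h (φ ∷ φs) bs      = expand-map h (det-map h φs) bs

-- Finite sums in a commutative ring.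

module Summation {a ℓ} (R : CommutativeRing a ℓ) where
  open import Data.Integer using (+_)
  open import Data.List using (List; []; _∷_; _++_; map; foldr; concatMap; cartesianProductWith; applyUpTo)
  open import Data.List.Relation.Unary.All as All using (All; []; _∷_)
  open import Data.Nat using (ℕ; zero; suc)
  open import Function using (_∘_)
  open CommutativeRing R
  open import Relation.Binary.Reasoning.Setoid setoid
  open IntegerSolver R

  sum : ∀ {b} {B : Set b} → (B → Carrier) → List B → Carrier
  sum f xs = foldr _+_ 0# (map f xs)

  module _ {b} {B : Set b} where

    sum-cong : ∀ {f g : B → Carrier} {xs} → All (λ x → f x ≈ g x) xs → sum f xs ≈ sum g xs
    sum-cong []         = refl
    sum-cong (eq ∷ eqs) = +-cong eq (sum-cong eqs)

    sum-cong-≗ : ∀ {f g : B → Carrier} → (∀ x → f x ≈ g x) → ∀ xs → sum f xs ≈ sum g xs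
    sum-cong-≗ eq xs = sum-cong (All.universal eq xs)

    sum-zero : ∀ {f : B → Carrier} → (∀ x → f x ≈ 0#) → ∀ xs → sum f xs ≈ 0#
    sum-zero eq []       = refl
    sum-zero eq (x ∷ xs) = trans (+-cong (eq x) (sum-zero eq xs)) (+-identityˡ 0#)

    sum-*ˡ : ∀ α (f : B → Carrier) xs → sum (λ x → α * f x) xs ≈ α * sum f xs
    sum-*ˡ α f []       = sym (zeroʳ α)
    sum-*ˡ α f (x ∷ xs) = trans (+-congˡ (sum-*ˡ α f xs)) (sym (distribˡ α _ _))

    sum-+ : ∀ (f g : B → Carrier) xs → sum (λ x → f x + g x) xs ≈ sum f xs + sum g xs
    sum-+ f g []       = sym (+-identityˡ 0#)
    sum-+ f g (x ∷ xs) = trans (+-congˡ (sum-+ f g xs))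
      (solve 4 (λ u v p q → (u :+ v) :+ (p :+ q) := (u :+ p) :+ (v :+ q)) refl _ _ _ _)

    sum-++ : ∀ (f : B → Carrier) xs ys → sum f (xs ++ ys) ≈ sum f xs + sum f ys
    sum-++ f []       ys = sym (+-identityˡ _)
    sum-++ f (x ∷ xs) ys = trans (+-congˡ (sum-++ f xs ys)) (sym (+-assoc _ _ _))

    sum-map : ∀ {c} {C : Set c} (f : B → Carrier) (g : C → B) xs → sum f (map g xs) ≈ sum (f ∘ g) xs
    sum-map f g []       = refl
    sum-map f g (x ∷ xs) = +-congˡ (sum-map f g xs)

  sum-swap : ∀ {b c} {B : Set b} {C : Set c} (f : B → C → Carrier) xs ys →
             sum (λ x → sum (f x) ys) xs ≈ sum (λ y → sum (λ x → f x y) xs) ys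
  sum-swap f []       ys = sym (sum-zero (λ _ → refl) ys)
  sum-swap f (x ∷ xs) ys = trans (+-congˡ (sum-swap f xs ys)) (sym (sum-+ (f x) _ ys))

  sum-concatMap : ∀ {b c} {B : Set b} {C : Set c} (f : C → Carrier) (g : B → List C) xs →
                  sum f (concatMap g xs) ≈ sum (λ x → sum f (g x)) xs
  sum-concatMap f g []       = refl
  sum-concatMap f g (x ∷ xs) = trans (sum-++ f (g x) _) (+-congˡ (sum-concatMap f g xs))

  sum-cartesianProductWith : ∀ {b c d} {B : Set b} {C : Set c} {D : Set d} (f : D → Carrier) (g : B → C → D) xs ys →
                             sum f (cartesianProductWith g xs ys) ≈ sum (λ x → sum (λ y → f (g x y)) ys) xs
  sum-cartesianProductWith f g []       ys = refl
  sum-cartesianProductWith f g (x ∷ xs) ys =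
    trans (sum-++ f (map (g x) ys) _) (+-cong (sum-map f (g x) ys) (sum-cartesianProductWith f g xs ys))

  sumBelow : ℕ → (ℕ → Carrier) → Carrier
  sumBelow zero    f = 0#
  sumBelow (suc n) f = f 0 + sumBelow n (f ∘ suc)

  sum-applyUpTo : ∀ {b} {B : Set b} (f : B → Carrier) g n → sum f (applyUpTo g n) ≈ sumBelow n (f ∘ g)
  sum-applyUpTo f g zero    = refl
  sum-applyUpTo f g (suc n) = +-congˡ (sum-applyUpTo f (g ∘ suc) n)

  sumBelow-cong : ∀ n {f g : ℕ → Carrier} → (∀ i → f i ≈ g i) → sumBelow n f ≈ sumBelow n g
  sumBelow-cong zero    eq = refl
  sumBelow-cong (suc n) eq = +-cong (eq 0) (sumBelow-cong n (eq ∘ suc))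

-- Beta numbers by recursion on the shape.

module BetaNumbers where
  open import Data.List using (List; []; _∷_)
  open import Data.List.Relation.Unary.All as All using (All; []; _∷_)
  open import Data.List.Relation.Unary.AllPairs using (AllPairs; []; _∷_)
  open import Data.Nat using (ℕ; suc; NonZero; _+_; _≥_; _>_)
  import Data.Nat.Properties as ℕ
  open import Data.Vec using (Vec; []; _∷_)
  open import Data.Vec.Relation.Unary.Linked using (Linked; []; _∷_)
  open import Relation.Binary.PropositionalEquality as ≡ using (_≡_; refl)

  -- Recursive form of `β`: the offset of a part is the number of parts after it, so the tail is
  -- again the list of beta numbers of a shape.
  betas : ∀ {n} → Vec ℕ n → List ℕ
  betas []              = []
  betas {suc n} (m ∷ κ) = (m + n) ∷ betas κ

  betas-bounded : ∀ {n m} (κ : Vec ℕ n) → Linked _≥_ (m ∷ κ) → All (m + n >_) (betas κ)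
  betas-bounded []                        _           = []
  betas-bounded {suc n} {m} (k ∷ κ) (m≥k ∷ k∷κ) = m+n>k+n ∷ All.map (λ k+n> → ℕ.<-trans k+n> m+n>k+n) (betas-bounded κ k∷κ)
    where
    m+n>k+n : m + suc n > k + n
    m+n>k+n = ℕ.≤-trans (ℕ.≤-reflexive (≡.sym (ℕ.+-suc k n))) (ℕ.+-monoˡ-≤ (suc n) m≥k)

  betas-decreasing : ∀ {n} (κ : Vec ℕ n) → Linked _≥_ κ → AllPairs _>_ (betas κ)
  betas-decreasing []          _           = []
  betas-decreasing (m ∷ [])    _           = [] ∷ []
  betas-decreasing (m ∷ k ∷ κ) (m≥k ∷ k∷κ) =
    betas-bounded (k ∷ κ) (m≥k ∷ k∷κ) ∷ betas-decreasing (k ∷ κ) k∷κ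

  β≡betas : ∀ t .{{_ : NonZero t}} {n} (κ : Vec ℕ n) → BetaSet.β t κ ≡ betas κ
  β≡betas t []      = refl
  β≡betas t (m ∷ κ) = ≡.cong (_ ∷_) (β≡betas t κ)

-- The bialternant formula for the tableau definition of Schur polynomials.

module Bialternant {a ℓ} (R : CommutativeRing a ℓ) where
  open import Data.Integer using (+_)
  open import Data.List as List using (List; []; _∷_; _++_; map; applyUpTo)
  import Data.List.Properties as List
  open import Data.List.Relation.Unary.All as All using (All; []; _∷_)
  import Data.List.Relation.Unary.All.Properties as All
  open import Data.Nat as ℕ using (ℕ; zero; suc; _∸_; _≤_; _≥_)
  import Data.Nat.Properties as ℕ
  open import Data.Product using (_×_; _,_)
  open import Data.Vec as Vec using (Vec; []; _∷_)
  open import Data.Vec.Functional using (Vector; init; last)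
  open import Data.Vec.Relation.Unary.Linked using (Linked; []; [-]; _∷_)
  open import Function using (_∘_)
  open import Relation.Binary.PropositionalEquality as ≡ using (_≡_)
  open CommutativeRing R
  open import Relation.Binary.Reasoning.Setoid setoid
  open import Algebra.Properties.Ring ring
  open import Algebra.Properties.Semiring.Exp semiring using (_^_; ^-homo-*; ^-congʳ)
  open IntegerSolver R
  open Determinant R
  open AlternatingMultilinear
  open Summation R
  open Schur R
  open BetaNumbers using (betas)

  -- Starts with the last coordinate, the letter that `monomial` removes first.
  rows : ∀ {n} → Vector Carrier n → List Carrier
  rows {zero}  x = []
  rows {suc n} x = last x ∷ rows (init x)

  vandermonde : List Carrier → Carrier
  vandermonde []       = 1#
  vandermonde (y ∷ xs) = prod (map (λ x → y - x) xs) * vandermonde xs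

  interval-+ : ∀ lo d → interval lo (lo ℕ.+ d) ≡ applyUpTo (lo ℕ.+_) (suc d)
  interval-+ lo d = ≡.trans (List.map-applyUpTo (λ i → i) (lo ℕ.+_) (suc (lo ℕ.+ d) ∸ lo))
    (≡.cong (applyUpTo (lo ℕ.+_)) (≡.trans (≡.cong (_∸ lo) (≡.sym (ℕ.+-suc lo d))) (ℕ.m+n∸m≡n lo (suc d))))

  interval-bounds : ∀ {lo hi} → lo ≤ hi → All (λ m → lo ≤ m × m ≤ hi) (interval lo hi)
  interval-bounds {lo} lo≤hi with ℕ.m≤n⇒∃[o]m+o≡n lo≤hi
  ... | d , ≡.refl rewrite interval-+ lo d =
    All.applyUpTo⁺₁ _ (suc d) (λ i≤d → ℕ.m≤m+n lo _ , ℕ.+-monoʳ-≤ lo (ℕ.≤-pred i≤d))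

  -- The recursion has to know that the first part of the strip is at most `m`, hence the list
  -- `m ∷ μ`. The bound on the sum makes the truncated subtractions in exponents genuine.
  strips-spec : ∀ {n} m (κ : Vec ℕ n) → Linked _≥_ (m ∷ κ) →
                All (λ μ → Linked _≥_ (m ∷ μ) × Vec.sum μ ≤ Vec.sum (m ∷ κ)) (strips (m ∷ κ))
  strips-spec m []      _            = ([-] , ℕ.z≤n) ∷ []
  strips-spec m (b ∷ κ) (m≥b ∷ b∷κ) =
    All.cartesianProductWith⁺ (≡.setoid _) (≡.setoid _) _∷_ _ _ λ k∈ μ∈ →
      let (b≤k , k≤m) = All.lookup (interval-bounds m≥b) k∈
          (b∷μ , μ≤)  = All.lookup (strips-spec b κ b∷κ) μ∈
      in (k≤m ∷ raise b≤k b∷μ) , ℕ.+-mono-≤ k≤m μ≤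
    where
    raise : ∀ {n b k} {μ : Vec ℕ n} → b ≤ k → Linked _≥_ (b ∷ μ) → Linked _≥_ (k ∷ μ)
    raise b≤k [-]        = [-]
    raise b≤k (b≥ ∷ μ↘) = ℕ.≤-trans b≥ b≤k ∷ μ↘

  -- The lowest exponent `c` of x is a parameter because splitting off the first term of the
  -- geometric sum raises it by one.
  telescope : ∀ y x c n → (y - x) * sumBelow n (λ i → y ^ (n ∸ suc i) * x ^ (c ℕ.+ i)) ≈ y ^ n * x ^ c - x ^ (c ℕ.+ n)
  telescope y x c zero    = begin
    (y - x) * 0#                  ≈⟨ zeroʳ _ ⟩
    0#                            ≈⟨ -‿inverseʳ _ ⟨
    x ^ c - x ^ c                 ≈⟨ +-cong (*-identityˡ _) (-‿cong (^-congʳ x (ℕ.+-identityʳ c))) ⟨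
    1# * x ^ c - x ^ (c ℕ.+ 0)    ∎
  telescope y x c (suc n) = begin
    (y - x) * (y ^ n * x ^ (c ℕ.+ 0) + sumBelow n (λ i → y ^ (n ∸ suc i) * x ^ (c ℕ.+ suc i)))
      ≈⟨ *-congˡ (+-cong (*-congˡ (^-congʳ x (ℕ.+-identityʳ c))) (sumBelow-cong n λ i → *-congˡ (^-congʳ x (ℕ.+-suc c i)))) ⟩
    (y - x) * (y ^ n * x ^ c + sumBelow n (λ i → y ^ (n ∸ suc i) * x ^ (suc c ℕ.+ i)))
      ≈⟨ distribˡ _ _ _ ⟩
    (y - x) * (y ^ n * x ^ c) + (y - x) * sumBelow n (λ i → y ^ (n ∸ suc i) * x ^ (suc c ℕ.+ i))
      ≈⟨ +-congˡ (telescope y x (suc c) n) ⟩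
    (y - x) * (y ^ n * x ^ c) + (y ^ n * (x * x ^ c) - x ^ (suc c ℕ.+ n))
      ≈⟨ solve 5 (λ y x p q r → (y :- x) :* (p :* q) :+ (p :* (x :* q) :- r) := y :* p :* q :- r) refl _ _ _ _ _ ⟩
    y ^ suc n * x ^ c - x ^ (suc c ℕ.+ n)
      ≈⟨ +-congˡ (-‿cong (^-congʳ x (≡.sym (ℕ.+-suc c n)))) ⟩
    y ^ suc n * x ^ c - x ^ (c ℕ.+ suc n) ∎

  private
    -- The columns left after the row of y has been cleared and one factor
    -- y − x has been taken out of the row of each remaining x.
    cleared : Carrier → ℕ → Carrier → Carrier
    cleared y m x = (y - x) * x ^ m

    power : ℕ → Carrier → Carrier
    power m x = x ^ m

    -- Writes the first column through the next one, whose beta number is b + n, and cleared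
    -- columns. The sum is `telescope` with d + 1 terms; its range b ≤ m ≤ b + d is exactly what a
    -- horizontal strip allows for its first part.
    split-power : ∀ y n b d x →
      x ^ (b ℕ.+ d ℕ.+ suc n) ≈
      y ^ suc d * x ^ (b ℕ.+ n) + - 1# * sum (λ m → y ^ (b ℕ.+ d ∸ m) * cleared y (m ℕ.+ n) x) (interval b (b ℕ.+ d))
    split-power y n b d x = begin
      x ^ (b ℕ.+ d ℕ.+ suc n)
        ≈⟨ ^-congʳ x (≡.trans (ℕ.+-assoc b d (suc n)) (≡.trans (≡.cong (b ℕ.+_) (ℕ.+-comm d (suc n)))
             (≡.trans (≡.cong (b ℕ.+_) (≡.sym (ℕ.+-suc n d))) (≡.sym (ℕ.+-assoc b n (suc d)))))) ⟩
      x ^ (b ℕ.+ n ℕ.+ suc d)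
        ≈⟨ solve 2 (λ p q → q := p :- (p :- q)) refl _ _ ⟩
      y ^ suc d * x ^ (b ℕ.+ n) - (y ^ suc d * x ^ (b ℕ.+ n) - x ^ (b ℕ.+ n ℕ.+ suc d))
        ≈⟨ +-congˡ (-‿cong (telescope y x (b ℕ.+ n) (suc d))) ⟨
      y ^ suc d * x ^ (b ℕ.+ n) - (y - x) * sumBelow (suc d) (λ i → y ^ (d ∸ i) * x ^ (b ℕ.+ n ℕ.+ i))
        ≈⟨ +-congˡ (-‿cong (*-congˡ (sumBelow-cong (suc d) λ i → *-cong
             (^-congʳ y (≡.sym (ℕ.[m+n]∸[m+o]≡n∸o b d i))) (^-congʳ x (swap-last b n i))))) ⟩
      y ^ suc d * x ^ (b ℕ.+ n) - (y - x) * sumBelow (suc d) (λ i → term (b ℕ.+ i))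
        ≈⟨ +-congˡ (-‿cong (*-congˡ (sum-applyUpTo term (b ℕ.+_) (suc d)))) ⟨
      y ^ suc d * x ^ (b ℕ.+ n) - (y - x) * sum term (applyUpTo (b ℕ.+_) (suc d))
        ≡⟨ ≡.cong (λ ms → y ^ suc d * x ^ (b ℕ.+ n) - (y - x) * sum term ms) (interval-+ b d) ⟨
      y ^ suc d * x ^ (b ℕ.+ n) - (y - x) * sum term (interval b (b ℕ.+ d))
        ≈⟨ +-congˡ (-‿cong (sum-*ˡ (y - x) term (interval b (b ℕ.+ d)))) ⟨
      y ^ suc d * x ^ (b ℕ.+ n) - sum (λ m → (y - x) * term m) (interval b (b ℕ.+ d))
        ≈⟨ +-congˡ (trans (-‿cong (sum-cong-≗ (λ m → solve 3 (λ u v w → u :* (v :* w) := v :* (u :* w)) refl _ _ _)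
                                              (interval b (b ℕ.+ d))))
                          (sym (-1*x≈-x _))) ⟩
      _ ∎
      where
      term : ℕ → Carrier
      term m = y ^ (b ℕ.+ d ∸ m) * x ^ (m ℕ.+ n)
      swap-last : ∀ b n i → b ℕ.+ n ℕ.+ i ≡ b ℕ.+ i ℕ.+ n
      swap-last b n i = ≡.trans (ℕ.+-assoc b n i) (≡.trans (≡.cong (b ℕ.+_) (ℕ.+-comm n i)) (≡.sym (ℕ.+-assoc b i n)))

  sum-linear : ∀ {D : List (Carrier → Carrier) → Carrier} → AlternatingMultilinear D →
               ∀ {b} {B : Set b} (α : B → Carrier) (g : B → Carrier → Carrier) us cs ms →
               D (us ++ (λ x → sum (λ m → α m * g m x) ms) ∷ cs) ≈ sum (λ m → α m * D (us ++ g m ∷ cs)) ms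
  sum-linear {D} D-am α g us cs [] = begin
    D (us ++ (λ x → 0#) ∷ cs)
      ≈⟨ D-am .linear us {f = λ _ → 0#} {g = λ _ → 0#} cs 0# 0# (λ x → solve 0 (con (+ 0) := con (+ 0) :* con (+ 0) :+ con (+ 0) :* con (+ 0)) refl) ⟩
    0# * D (us ++ (λ x → 0#) ∷ cs) + 0# * D (us ++ (λ x → 0#) ∷ cs)
      ≈⟨ solve 1 (λ z → con (+ 0) :* z :+ con (+ 0) :* z := con (+ 0)) refl _ ⟩
    0# ∎
  sum-linear {D} D-am α g us cs (m ∷ ms) = begin
    D (us ++ (λ x → α m * g m x + sum (λ m → α m * g m x) ms) ∷ cs)
      ≈⟨ D-am .linear us cs (α m) 1# (λ x → +-congˡ (sym (*-identityˡ _))) ⟩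
    α m * D (us ++ g m ∷ cs) + 1# * D (us ++ (λ x → sum (λ m → α m * g m x) ms) ∷ cs)
      ≈⟨ +-congˡ (trans (*-identityˡ _) (sum-linear D-am α g us cs ms)) ⟩
    sum (λ m → α m * D (us ++ g m ∷ cs)) (m ∷ ms) ∎

  module _ (y : Carrier) where

    -- The branching rule for determinants. In `split-power` the multiple of the next column
    -- contributes a repeated column, and cleared columns vanish at `y`, so the expansion moves on
    -- past them. `D` is arbitrary in order to absorb the cleared columns met so far.
    expand-powers : ∀ {n} (κ : Vec ℕ (suc n)) → Linked _≥_ κ →
      ∀ {D : List (Carrier → Carrier) → Carrier} → AlternatingMultilinear D →
      expand (λ f → f y) D (map power (betas κ)) ≈
      sum (λ μ → y ^ (Vec.sum κ ∸ Vec.sum μ) * D (map (cleared y) (betas μ))) (strips κ)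
    expand-powers (m ∷ []) _ {D} D-am = +-congˡ -0#≈0#
    expand-powers {suc n} (_ ∷ b ∷ κ) (m≥b ∷ b∷κ) {D} D-am with ℕ.m≤n⇒∃[o]m+o≡n m≥b
    ... | d , ≡.refl = begin
      E (power (b ℕ.+ d ℕ.+ suc n) ∷ power (b ℕ.+ n) ∷ cs)
        ≈⟨ E-am .linear [] (power (b ℕ.+ n) ∷ cs) (y ^ suc d) (- 1#) (split-power y n b d) ⟩
      y ^ suc d * E (power (b ℕ.+ n) ∷ power (b ℕ.+ n) ∷ cs) + - 1# * E (_ ∷ rest)
        ≈⟨ +-cong (*-congˡ (E-am .repeat [] _ cs)) (*-congˡ (sum-linear E-am _ (λ m → cleared y (m ℕ.+ n)) [] rest ms)) ⟩
      y ^ suc d * 0# + - 1# * sum (λ m → y ^ (a₀ ∸ m) * E (cleared y (m ℕ.+ n) ∷ rest)) ms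
        ≈⟨ trans (+-cong (zeroʳ _) (sym (sum-*ˡ (- 1#) _ ms))) (+-identityˡ _) ⟩
      sum (λ m → - 1# * (y ^ (a₀ ∸ m) * E (cleared y (m ℕ.+ n) ∷ rest))) ms
        ≈⟨ sum-cong (All.map (λ (_ , m≤) → branch _ m≤) (interval-bounds (ℕ.m≤m+n b d))) ⟩
      sum (λ m → sum (λ μ → y ^ (a₀ ℕ.+ Vec.sum (b ∷ κ) ∸ (m ℕ.+ Vec.sum μ)) *
                            D (cleared y (m ℕ.+ n) ∷ map (cleared y) (betas μ))) (strips (b ∷ κ))) ms
        ≈⟨ sum-cartesianProductWith _ _∷_ ms (strips (b ∷ κ)) ⟨
      sum (λ μ → y ^ (Vec.sum (a₀ ∷ b ∷ κ) ∸ Vec.sum μ) * D (map (cleared y) (betas μ))) (strips (a₀ ∷ b ∷ κ)) ∎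
      where
      a₀ = b ℕ.+ d
      E  = expand (λ f → f y) D
      E-am = expand-alternatingMultilinear y D-am
      cs = map power (betas κ)
      rest = power (b ℕ.+ n) ∷ cs
      ms = interval b a₀
      branch : ∀ m → m ≤ a₀ →
        - 1# * (y ^ (a₀ ∸ m) * E (cleared y (m ℕ.+ n) ∷ rest)) ≈
        sum (λ μ → y ^ (a₀ ℕ.+ Vec.sum (b ∷ κ) ∸ (m ℕ.+ Vec.sum μ)) *
                   D (cleared y (m ℕ.+ n) ∷ map (cleared y) (betas μ))) (strips (b ∷ κ))
      -- The factor y - y removes the cofactor of the cleared column. The minus sign of
      -- `split-power` cancels the one from moving the row of `y` past that column.
      branch m m≤ = begin
        - 1# * (y ^ (a₀ ∸ m) * ((y - y) * y ^ (m ℕ.+ n) * D rest - expand (λ f → f y) D′ rest))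
          ≈⟨ solve 6 (λ o p y q r z → :- o :* (p :* ((y :- y) :* q :* r :- z)) := p :* (o :* z)) refl _ _ _ _ _ _ ⟩
        y ^ (a₀ ∸ m) * (1# * expand (λ f → f y) D′ rest)
          ≈⟨ *-congˡ (trans (*-identityˡ _) (expand-powers (b ∷ κ) b∷κ (fix-column D-am _))) ⟩
        y ^ (a₀ ∸ m) * sum (λ μ → y ^ (Vec.sum (b ∷ κ) ∸ Vec.sum μ) * D′ (map (cleared y) (betas μ))) (strips (b ∷ κ))
          ≈⟨ sum-*ˡ _ _ (strips (b ∷ κ)) ⟨
        sum (λ μ → y ^ (a₀ ∸ m) * (y ^ (Vec.sum (b ∷ κ) ∸ Vec.sum μ) * D′ (map (cleared y) (betas μ)))) (strips (b ∷ κ))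
          ≈⟨ sum-cong (All.map (λ {μ} (_ , μ≤) → trans (sym (*-assoc _ _ _)) (*-congʳ (join μ≤))) (strips-spec b κ b∷κ)) ⟩
        _ ∎
        where
        D′ = D ∘ (cleared y (m ℕ.+ n) ∷_)
        join : ∀ {s} → s ≤ Vec.sum (b ∷ κ) →
               y ^ (a₀ ∸ m) * y ^ (Vec.sum (b ∷ κ) ∸ s) ≈ y ^ (a₀ ℕ.+ Vec.sum (b ∷ κ) ∸ (m ℕ.+ s))
        join {s} s≤ = trans (sym (^-homo-* y (a₀ ∸ m) _)) (^-congʳ y (≡.sym eq))
          where
          σ = Vec.sum (b ∷ κ)
          eq : a₀ ℕ.+ σ ∸ (m ℕ.+ s) ≡ (a₀ ∸ m) ℕ.+ (σ ∸ s)
          eq = ≡.trans (≡.sym (ℕ.∸-+-assoc (a₀ ℕ.+ σ) m s))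
                 (≡.trans (≡.cong (_∸ s) (ℕ.+-∸-comm σ m≤)) (ℕ.+-∸-assoc (a₀ ∸ m) s≤))

  size-tableaux : ∀ {n} (κ : Vec ℕ n) → All (λ T → size T ≡ Vec.sum κ) (tableaux κ)
  size-tableaux {zero}  []  = ≡.refl ∷ []
  size-tableaux {suc n} κ = All.concat⁺ (All.map⁺ (All.universal (λ μ → All.map⁺ (All.universal (λ _ → ≡.refl) (tableaux μ))) (strips κ)))

  schur-branching : ∀ {n} (κ : Vec ℕ (suc n)) x →
    schur κ x ≈ sum (λ μ → last x ^ (Vec.sum κ ∸ Vec.sum μ) * schur μ (init x)) (strips κ)
  schur-branching κ x = begin
    sum (λ T → monomial T x) (tableaux κ)
      ≈⟨ sum-concatMap (λ T → monomial T x) (λ μ → map (κ ∷_) (tableaux μ)) (strips κ) ⟩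
    sum (λ μ → sum (λ T → monomial T x) (map (κ ∷_) (tableaux μ))) (strips κ)
      ≈⟨ sum-cong-≗ (λ μ → begin
           sum (λ T → monomial T x) (map (κ ∷_) (tableaux μ))
             ≈⟨ sum-map (λ T → monomial T x) (κ ∷_) (tableaux μ) ⟩
           sum (λ T → last x ^ (Vec.sum κ ∸ size T) * monomial T (init x)) (tableaux μ)
             ≈⟨ sum-cong (All.map (λ eq → *-congʳ (^-congʳ (last x) (≡.cong (Vec.sum κ ∸_) eq))) (size-tableaux μ)) ⟩
           sum (λ T → last x ^ (Vec.sum κ ∸ Vec.sum μ) * monomial T (init x)) (tableaux μ)
             ≈⟨ sum-*ˡ _ (λ T → monomial T (init x)) (tableaux μ) ⟩
           last x ^ (Vec.sum κ ∸ Vec.sum μ) * schur μ (init x) ∎) (strips κ) ⟩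
    sum (λ μ → last x ^ (Vec.sum κ ∸ Vec.sum μ) * schur μ (init x)) (strips κ) ∎

  -- Induction on the number of variables: `expand-powers` and the branching of tableaux over the
  -- last letter follow the same recursion. The factors y - x taken out of the remaining rows build
  -- up the Vandermonde product.
  bialternant : ∀ {n} (κ : Vec ℕ n) → Linked _≥_ κ → ∀ x →
                det (map _^_ (rows x)) (betas κ) ≈ vandermonde (rows x) * schur κ x
  bialternant {zero}  []      _  x = sym (trans (*-identityˡ _) (+-identityʳ 1#))
  bialternant {suc n} κ@(k ∷ κ′) κ↘ x = begin
    det (map _^_ (y ∷ xs)) (betas κ)
      ≈⟨ from-powers (y ∷ xs) (betas κ) ⟨
    expand (λ f → f y) (det (evaluations xs)) (map power (betas κ))
      ≈⟨ expand-powers y κ κ↘ (det-alternatingMultilinear xs) ⟩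
    sum (λ μ → y ^ (Vec.sum κ ∸ Vec.sum μ) * det (evaluations xs) (map (cleared y) (betas μ))) (strips κ)
      ≈⟨ sum-cong (All.map (λ {μ} (k∷μ , _) → branch μ (tail-linked k∷μ)) (strips-spec k κ′ κ↘)) ⟩
    sum (λ μ → (v * vandermonde xs) * (y ^ (Vec.sum κ ∸ Vec.sum μ) * schur μ (init x))) (strips κ)
      ≈⟨ sum-*ˡ _ _ (strips κ) ⟩
    v * vandermonde xs * sum (λ μ → y ^ (Vec.sum κ ∸ Vec.sum μ) * schur μ (init x)) (strips κ)
      ≈⟨ *-congˡ (schur-branching κ x) ⟨
    vandermonde (rows x) * schur κ x ∎
    where
    y  = last x
    xs = rows (init x)
    v  = prod (map (λ x → y - x) xs)
    tail-linked : ∀ {n m} {μ : Vec ℕ n} → Linked _≥_ (m ∷ μ) → Linked _≥_ μ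
    tail-linked [-]       = []
    tail-linked (_ ∷ μ↘) = μ↘
    from-powers : ∀ xs bs → det (evaluations xs) (map power bs) ≈ det (map _^_ xs) bs
    from-powers xs bs = trans (det-map power (evaluations xs) bs)
      (reflexive (≡.cong (λ φs → det φs bs) (≡.sym (List.map-∘ xs))))
    branch : ∀ μ → Linked _≥_ μ →
      y ^ (Vec.sum κ ∸ Vec.sum μ) * det (evaluations xs) (map (cleared y) (betas μ)) ≈
      (v * vandermonde xs) * (y ^ (Vec.sum κ ∸ Vec.sum μ) * schur μ (init x))
    branch μ μ↘ = begin
      p * det (evaluations xs) (map (cleared y) (betas μ))
        ≈⟨ *-congˡ (det-map (cleared y) (evaluations xs) (betas μ)) ⟩
      p * det (map (_∘ cleared y) (evaluations xs)) (betas μ)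
        ≡⟨ ≡.cong (λ φs → p * det φs (betas μ)) (≡.sym (List.map-∘ xs)) ⟩
      p * det (map (λ x m → (y - x) * x ^ m) xs) (betas μ)
        ≈⟨ *-congˡ (det-scale (λ x → y - x) _ _^_ (λ x m → refl) xs (betas μ)) ⟩
      p * (v * det (map _^_ xs) (betas μ))
        ≈⟨ *-congˡ (*-congˡ (bialternant μ μ↘ (init x))) ⟩
      p * (v * (vandermonde xs * schur μ (init x)))
        ≈⟨ solve 4 (λ p v w s → p :* (v :* (w :* s)) := (v :* w) :* (p :* s)) refl _ _ _ _ ⟩
      (v * vandermonde xs) * (p * schur μ (init x)) ∎
      where p = y ^ (Vec.sum κ ∸ Vec.sum μ)

-- Congruences modulo t and residues with equal doubles.

module Residues (t : ℕ) .{{_ : NonZero t}} where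
  open import Data.Fin as Fin using (Fin; toℕ)
  import Data.Fin.Properties as Fin
  open import Data.Empty using (⊥-elim)
  open import Data.Nat using (zero; suc; pred; _+_; _*_; _<_)
  open import Data.Nat.Divisibility using (_∣_; divides; ∣m+n∣m⇒∣n; n∣m*n)
  open import Data.Nat.DivMod
  import Data.Nat.Properties as ℕ
  open import Data.Nat.Solver using (module +-*-Solver)
  open import Data.Product using (_,_; ∃-syntax)
  open import Data.Sum using (_⊎_; inj₁; inj₂)
  open import Relation.Binary using (tri<; tri≈; tri>)
  open import Relation.Binary.PropositionalEquality using (_≡_; _≢_; refl; sym; trans; cong; cong₂; module ≡-Reasoning)
  open +-*-Solver

  infix 4 _≋_
  _≋_ : ℕ → ℕ → Set
  a ≋ b = a % t ≡ b % t

  toℕ-mod : ∀ a → toℕ (a mod t) ≡ a % t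
  toℕ-mod a = Fin.toℕ-fromℕ< (m%n<n a t)

  mod⇒≋ : ∀ {a b} → a mod t ≡ b mod t → a ≋ b
  mod⇒≋ {a} {b} eq = trans (sym (toℕ-mod a)) (trans (cong toℕ eq) (toℕ-mod b))

  ≋⇒mod : ∀ {a b} → a ≋ b → a mod t ≡ b mod t
  ≋⇒mod {a} {b} eq = Fin.toℕ-injective (trans (toℕ-mod a) (trans eq (sym (toℕ-mod b))))

  ≋-+ : ∀ {a a′ b b′} → a ≋ a′ → b ≋ b′ → a + b ≋ a′ + b′
  ≋-+ {a} {a′} {b} {b′} p q = begin
    (a + b) % t             ≡⟨ %-distribˡ-+ a b t ⟩
    (a % t + b % t) % t     ≡⟨ cong₂ (λ u v → (u + v) % t) p q ⟩
    (a′ % t + b′ % t) % t   ≡⟨ %-distribˡ-+ a′ b′ t ⟨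
    (a′ + b′) % t           ∎
    where open ≡-Reasoning

  ≋-+* : ∀ a c → a + c * t ≋ a
  ≋-+* a c = [m+kn]%n≡m%n a c t

  ≋-% : ∀ a → a % t ≋ a
  ≋-% a = m%n%n≡m%n a t

  -- −c modulo t
  negate : ℕ → ℕ
  negate c = c * pred t

  ≋-+-negate : ∀ a c → a + c + negate c ≋ a
  ≋-+-negate a c = trans (cong (_% t) (begin
    a + c + c * pred t       ≡⟨ solve 3 (λ a c p → a :+ c :+ c :* p := a :+ c :* (con 1 :+ p)) refl a c (pred t) ⟩
    a + c * suc (pred t)     ≡⟨ cong (λ u → a + c * u) (ℕ.suc-pred t) ⟩
    a + c * t ∎)) (≋-+* a c)
    where open ≡-Reasoning

  ≋-cancelʳ : ∀ {a b} c → a + c ≋ b + c → a ≋ b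
  ≋-cancelʳ {a} {b} c eq = trans (sym (≋-+-negate a c)) (trans (≋-+ {b = negate c} eq refl) (≋-+-negate b c))

  ≋-cancelˡ : ∀ {a b} c → c + a ≋ c + b → a ≋ b
  ≋-cancelˡ {a} {b} c eq =
    ≋-cancelʳ c (trans (cong (_% t) (ℕ.+-comm a c)) (trans eq (cong (_% t) (ℕ.+-comm c b))))

  ≋⇒∣ : ∀ a e → a + e ≋ a → t ∣ e
  ≋⇒∣ a e eq = ∣m+n∣m⇒∣n (divides ((a + e) / t) lem) (n∣m*n (a / t))
    where
    lem : a / t * t + e ≡ (a + e) / t * t
    lem = ℕ.+-cancelˡ-≡ (a % t) _ _ (begin
      a % t + (a / t * t + e)             ≡⟨ ℕ.+-assoc (a % t) _ e ⟨
      a % t + a / t * t + e               ≡⟨ cong (_+ e) (m≡m%n+[m/n]*n a t) ⟨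
      a + e                               ≡⟨ m≡m%n+[m/n]*n (a + e) t ⟩
      (a + e) % t + (a + e) / t * t       ≡⟨ cong (_+ (a + e) / t * t) eq ⟩
      a % t + (a + e) / t * t             ∎)
      where open ≡-Reasoning

  private
    double-injective : ∀ {u v} → u + u ≡ v + v → u ≡ v
    double-injective {u} {v} eq with ℕ.<-cmp u v
    ... | tri< u<v _ _ = ⊥-elim (ℕ.<-irrefl eq (ℕ.+-mono-< u<v u<v))
    ... | tri≈ _ u≡v _ = u≡v
    ... | tri> _ _ v<u = ⊥-elim (ℕ.<-irrefl (sym eq) (ℕ.+-mono-< v<u v<u))

    -- Twice u - w is a multiple of t, positive and less than 2 t, so it is t.
    double-gap : ∀ {w u} → w < u → u < t → u + u ≋ w + w → u + u ≡ w + w + t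
    double-gap {w} w<u u<t eq with ℕ.m≤n⇒∃[o]m+o≡n (ℕ.<⇒≤ w<u)
    ... | d , refl with ≋⇒∣ (w + w) (d + d) (trans (cong (_% t) (solve 2 (λ w d → w :+ w :+ (d :+ d) := w :+ d :+ (w :+ d)) refl w d)) eq)
    ... | divides zero d+d≡0 =
      ⊥-elim (ℕ.<-irrefl (sym (trans (cong (w +_) (ℕ.m+n≡0⇒m≡0 d d+d≡0)) (ℕ.+-identityʳ w))) w<u)
    ... | divides (suc zero) d+d≡t =
      trans (solve 2 (λ w d → w :+ d :+ (w :+ d) := w :+ w :+ (d :+ d)) refl w d)
            (cong (w + w +_) (trans d+d≡t (ℕ.+-identityʳ t)))
    ... | divides (suc (suc q)) d+d≡ = ⊥-elim (ℕ.<-irrefl d+d≡ (ℕ.<-≤-trans (ℕ.+-mono-< d<t d<t)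
            (ℕ.≤-trans (ℕ.m≤m+n (t + t) (q * t)) (ℕ.≤-reflexive (ℕ.+-assoc t t (q * t))))))
      where
      d<t : d < t
      d<t = ℕ.≤-<-trans (ℕ.m≤n+m d w) u<t

  -- Distinct residues with congruent doubles differ by half of t. Equations between doubles express
  -- this while t is not yet known to be even.
  half-turn : ∀ {w u} → w < t → u < t → u ≢ w → u + u ≋ w + w →
              u + u ≡ w + w + t ⊎ w + w ≡ u + u + t
  half-turn {w} {u} w<t u<t u≢w eq with ℕ.<-cmp u w
  ... | tri< u<w _ _ = inj₂ (double-gap u<w w<t (sym eq))
  ... | tri≈ _ u≡w _ = ⊥-elim (u≢w u≡w)
  ... | tri> _ _ w<u = inj₁ (double-gap w<u u<t eq)

  half-turn-even : ∀ {w u} → u + u ≡ w + w + t ⊎ w + w ≡ u + u + t → ∃[ h ] t ≡ h + h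
  half-turn-even {w} {u} (inj₁ eq) = even w u eq
    where
    -- Lowering w and u together preserves the equation; at w = 0 what remains of u is the half of
    -- t.
    even : ∀ w u → u + u ≡ w + w + t → ∃[ h ] t ≡ h + h
    even zero    u       eq = u , sym eq
    even (suc w) (suc u) eq = even w u (ℕ.suc-injective (ℕ.suc-injective (begin
      suc (suc (u + u))       ≡⟨ cong suc (ℕ.+-suc u u) ⟨
      suc u + suc u           ≡⟨ eq ⟩
      suc w + suc w + t       ≡⟨ cong (λ v → suc (v + t)) (ℕ.+-suc w w) ⟩
      suc (suc (w + w + t))   ∎)))
      where open ≡-Reasoning
  half-turn-even {w} {u} (inj₂ eq) = half-turn-even {u} {w} (inj₁ eq)

  -- If one of `u` and `v` lay above `w` and the other below, they would differ by t, which residues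
  -- below t cannot.
  half-turn-unique : ∀ {w u v} → u < t → v < t → u + u ≡ w + w + t ⊎ w + w ≡ u + u + t →
                     v + v ≡ w + w + t ⊎ w + w ≡ v + v + t → u ≡ v
  half-turn-unique u<t v<t (inj₁ p) (inj₁ q) = double-injective (trans p (sym q))
  half-turn-unique {w} {u} {v} u<t v<t (inj₁ p) (inj₂ q) = ⊥-elim (ℕ.<-irrefl eq
    (ℕ.<-≤-trans (ℕ.+-mono-< u<t u<t) (ℕ.m≤n+m (t + t) (v + v))))
    where
    eq : u + u ≡ v + v + (t + t)
    eq = trans p (trans (cong (_+ t) q) (ℕ.+-assoc (v + v) t t))
  half-turn-unique {w} {u} {v} u<t v<t (inj₂ p) (inj₁ q) = sym (half-turn-unique {w} v<t u<t (inj₁ q) (inj₂ p))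
  half-turn-unique {w} {u} {v} u<t v<t (inj₂ p) (inj₂ q) = double-injective (ℕ.+-cancelʳ-≡ t _ _ (trans (sym p) q))

-- The reflection of the beta set and its fixed columns.

module ExcessSymmetry
  (t : ℕ) .{{_ : NonZero t}} {N : ℕ} (shape : Vec ℕ N) (shape↘ : Linked Data.Nat._≥_ shape)
  (n≥1 : (i : Fin t) → 1 Data.Nat.≤ BetaSet.n t shape i)
  (C : ℕ) (𝓢≤C : All (Data.Nat._≤ C) (BetaSet.𝓢 t shape)) (symmetric : SymmetricAbout C (BetaSet.𝓢 t shape))
  (i₀ : Fin t) (i₀∈𝓔 : BetaSet.𝓔 t shape i₀) (C∈Δ : C ∈ BetaSet.Δ t shape i₀) where

  open import Data.Empty using (⊥-elim)
  import Data.Fin as Fin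
  import Data.Fin.Properties as Fin
  open import Data.List using (List; []; _∷_; _++_; map; zipWith; drop; filter; length)
  import Data.List.Properties as List
  open import Data.List.Membership.Propositional.Properties using (∈-filter⁺; ∈-filter⁻; ∈-map⁺)
  open import Data.List.Relation.Unary.All as All using ([]; _∷_)
  open import Data.List.Relation.Unary.AllPairs as AllPairs using (AllPairs; []; _∷_)
  import Data.List.Relation.Unary.AllPairs.Properties as AllPairs
  open import Data.List.Relation.Unary.Any using (here; there)
  open import Data.List.Relation.Unary.Unique.Propositional using (Unique)
  open import Data.List.Relation.Binary.Permutation.Propositional using (_↭_)
  open import Data.List.Relation.Binary.Permutation.Propositional.Properties using (↭-length)
  open import Data.Nat using (suc; _+_; _*_; _∸_; _≤_; _<_; _≥_; _>_; _≤?_; _≟_; s≤s; z≤n)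
  open import Data.Nat.DivMod
  import Data.Nat.Properties as ℕ
  open import Data.Product using (_×_; _,_; ∃-syntax; proj₁; proj₂)
  open import Data.Sum using (_⊎_; inj₁; inj₂)
  open import Function.Bundles using (Equivalence)
  open import Relation.Nullary using (¬_; Dec; yes; no)
  open import Relation.Binary using (tri<; tri≈; tri>)
  open import Relation.Binary.PropositionalEquality using (_≡_; _≢_; refl; sym; trans; cong; cong₂; subst; module ≡-Reasoning)
  open Residues t
  open Pairing
  open BetaNumbers
  open BetaSet t shape

  Excess : ℕ → Set
  Excess b = 𝓔 (b mod t)

  Excess? : ∀ b → Dec (Excess b)
  Excess? b = 2 ≤? n (b mod t)

  Excess-resp-≋ : ∀ {a b} → a ≋ b → Excess a → Excess b
  Excess-resp-≋ {a} {b} a≋b = subst 𝓔 (≋⇒mod {a} {b} a≋b)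

  -- The column b of the bialternant is carried to the column b′ by x ↦ x⁻¹,
  -- up to the factor x ^ C. A column outside the excess part matters only
  -- through its residue.
  Mirror : ℕ → ℕ → Set
  Mirror b b′ = (Excess b × Excess b′ × b + b′ ≡ C) ⊎ (¬ Excess b × ¬ Excess b′ × b + b′ ≋ C)

  Mirror-sym : ∀ {b b′} → Mirror b b′ → Mirror b′ b
  Mirror-sym {b} {b′} (inj₁ (eb , eb′ , eq)) = inj₁ (eb′ , eb , trans (ℕ.+-comm b′ b) eq)
  Mirror-sym {b} {b′} (inj₂ (eb , eb′ , eq)) = inj₂ (eb′ , eb , trans (cong (_% t) (ℕ.+-comm b′ b)) eq)

  Mirror⇒≋ : ∀ {b b′} → Mirror b b′ → b + b′ ≋ C
  Mirror⇒≋ (inj₁ (_ , _ , eq)) = cong (_% t) eq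
  Mirror⇒≋ (inj₂ (_ , _ , eq)) = eq

  β-decreasing : AllPairs _>_ β
  β-decreasing = subst (AllPairs _>_) (sym (β≡betas t shape)) (betas-decreasing shape shape↘)

  β-unique : Unique β
  β-unique = AllPairs.map ℕ.>⇒≢ β-decreasing

  private
    two-members : ∀ {x y : ℕ} {xs} → x ∈ xs → y ∈ xs → x ≢ y → 2 ≤ length xs
    two-members (here refl) (here refl) x≢y = ⊥-elim (x≢y refl)
    two-members {xs = _ ∷ _ ∷ _} (here _)  (there _) _ = s≤s (s≤s z≤n)
    two-members {xs = _ ∷ _ ∷ _} (there _) (here _)  _ = s≤s (s≤s z≤n)
    two-members (there x∈) (there y∈) x≢y = ℕ.m≤n⇒m≤1+n (two-members x∈ y∈ x≢y)

    some-member : ∀ {xs : List ℕ} → 1 ≤ length xs → ∃[ x ] x ∈ xs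
    some-member {x ∷ _} _ = x , here refl

  inhabited : ∀ a → ∃[ b ] b ∈ β × b ≋ a
  inhabited a with some-member (n≥1 (a mod t))
  ... | b , b∈ with ∈-filter⁻ (λ b → b mod t Fin.≟ a mod t) {xs = β} b∈
  ... | b∈β , eq = b , b∈β , mod⇒≋ {b} {a} eq

  nonexcess-unique : ∀ {x y} → x ∈ β → y ∈ β → ¬ Excess x → y ≋ x → x ≡ y
  nonexcess-unique {x} {y} x∈ y∈ ¬ex y≋x with x ≟ y
  ... | yes x≡y = x≡y
  ... | no x≢y = ⊥-elim (¬ex (two-members (member x∈ refl) (member y∈ (≋⇒mod {y} {x} y≋x)) x≢y))
    where
    member : ∀ {b} → b ∈ β → b mod t ≡ x mod t → b ∈ filter (λ b → b mod t Fin.≟ x mod t) β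
    member = ∈-filter⁺ (λ b → b mod t Fin.≟ x mod t)

  excess-reflect : ∀ {b} → b ∈ β → Excess b → b ≤ C × (C ∸ b) ∈ β × Excess (C ∸ b)
  excess-reflect {b} b∈ ex =
    All.lookup 𝓢≤C b∈𝓢 , ∈-filter⁻ Excess? (Equivalence.to symmetric (∈-map⁺ (C ∸_) b∈𝓢))
    where
    b∈𝓢 : b ∈ 𝓢
    b∈𝓢 = ∈-filter⁺ Excess? b∈ ex

  -- In the excess part the symmetry of `𝓢` gives C - b. For another column the class of C - b is
  -- inhabited because every residue occurs; an excess partner there would reflect back into the
  -- class of b and make that class excess as well.
  partner : ∀ {b} → b ∈ β → ∃[ b′ ] b′ ∈ β × Mirror b b′
  partner {b} b∈ with Excess? b
  ... | yes ex with excess-reflect b∈ ex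
  ...   | b≤C , b′∈ , ex′ = C ∸ b , b′∈ , inj₁ (ex , ex′ , ℕ.m+[n∸m]≡n b≤C)
  partner {b} b∈ | no ¬ex with inhabited (C + negate b)
  ...   | b′ , b′∈ , b′≋ = b′ , b′∈ , inj₂ (¬ex , ¬ex′ , sum≋)
    where
    sum≋ : b + b′ ≋ C
    sum≋ = trans (cong (_% t) (ℕ.+-comm b b′)) (trans (≋-+ {b = b} b′≋ refl) (trans (cong (_% t) (begin
      C + negate b + b     ≡⟨ ℕ.+-assoc C _ b ⟩
      C + (negate b + b)   ≡⟨ cong (C +_) (ℕ.+-comm _ b) ⟩
      C + (b + negate b)   ≡⟨ ℕ.+-assoc C b _ ⟨
      C + b + negate b     ∎)) (≋-+-negate C b)))
      where open ≡-Reasoning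
    ¬ex′ : ¬ Excess b′
    ¬ex′ ex′ with excess-reflect b′∈ ex′
    ... | b′≤C , _ , ex″ = ¬ex (Excess-resp-≋ {C ∸ b′} {b}
      (≋-cancelʳ b′ (trans (cong (_% t) (ℕ.m∸n+n≡m b′≤C)) (sym sum≋))) ex″)

  partner-unique : ∀ {x y z} → x ∈ β → y ∈ β → z ∈ β → Mirror x y → Mirror x z → y ≡ z
  partner-unique {x} _ _ _ (inj₁ (_ , _ , p)) (inj₁ (_ , _ , q)) = ℕ.+-cancelˡ-≡ x _ _ (trans p (sym q))
  partner-unique _ _ _ (inj₁ (ex , _)) (inj₂ (¬ex , _)) = ⊥-elim (¬ex ex)
  partner-unique _ _ _ (inj₂ (¬ex , _)) (inj₁ (ex , _)) = ⊥-elim (¬ex ex)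
  partner-unique {x} {y} {z} _ y∈ z∈ (inj₂ (_ , ¬ey , p)) (inj₂ (_ , _ , q)) =
    nonexcess-unique y∈ z∈ ¬ey (≋-cancelˡ x (trans q (sym p)))

  private
    adjacent-sum-bounds : ∀ {m s} xs → All (m >_) xs → s ∈ zipWith _+_ xs (drop 1 xs) → s < m + m
    adjacent-sum-bounds (x ∷ y ∷ xs) (m>x ∷ m>y ∷ _) (here refl) = ℕ.+-mono-< m>x m>y
    adjacent-sum-bounds (x ∷ y ∷ xs) (_ ∷ m>) (there s∈) = adjacent-sum-bounds (y ∷ xs) m> s∈

    -- Half of an adjacent sum lies strictly between two neighbours of a decreasing list, where the
    -- list has no entry.
    no-midpoint : ∀ {s m} xs → AllPairs _>_ xs → s ∈ zipWith _+_ xs (drop 1 xs) → m ∈ xs → m + m ≢ s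
    no-midpoint (x ∷ y ∷ xs) ((x>y ∷ _) ∷ _) (here refl) (here refl) eq = ℕ.<-irrefl (ℕ.+-cancelˡ-≡ x _ _ (sym eq)) x>y
    no-midpoint (x ∷ y ∷ xs) ((x>y ∷ _) ∷ _) (here refl) (there (here refl)) eq = ℕ.<-irrefl (ℕ.+-cancelʳ-≡ y _ _ eq) x>y
    no-midpoint (x ∷ y ∷ xs) ((x>y ∷ _) ∷ y> ∷ _) (here refl) (there (there m∈)) eq =
      ℕ.<-irrefl eq (ℕ.+-mono-< (ℕ.<-trans (All.lookup y> m∈) x>y) (All.lookup y> m∈))
    no-midpoint (x ∷ y ∷ xs) (x> ∷ _) (there s∈) (here refl) eq =
      ℕ.<-irrefl (sym eq) (adjacent-sum-bounds (y ∷ xs) x> s∈)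
    no-midpoint (x ∷ y ∷ xs) (_ ∷ xs↘) (there s∈) (there m∈) eq = no-midpoint (y ∷ xs) xs↘ s∈ m∈ eq

    adjacent-summands : ∀ {s} xs → s ∈ zipWith _+_ xs (drop 1 xs) → ∃[ p ] ∃[ q ] p ∈ xs × q ∈ xs × s ≡ p + q
    adjacent-summands (x ∷ y ∷ xs) (here eq) = x , y , here refl , there (here refl) , eq
    adjacent-summands (x ∷ y ∷ xs) (there s∈) with adjacent-summands (y ∷ xs) s∈
    ... | p , q , p∈ , q∈ , eq = p , q , there p∈ , there q∈ , eq

  c-decreasing : AllPairs _>_ (c i₀)
  c-decreasing = AllPairs.filter⁺ (λ b → b mod t Fin.≟ i₀) (AllPairs.filter⁺ Excess? β-decreasing)

  -- Both summands of the adjacent sum lie in the class `i₀`. This ties `i₀` to the classes of fixed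
  -- columns, and later removes the factor (-1) ^ C.
  C≋2i₀ : Fin.toℕ i₀ + Fin.toℕ i₀ ≋ C
  C≋2i₀ with adjacent-summands (c i₀) C∈Δ
  ... | p , q , p∈ , q∈ , refl = ≋-+ (residue p p∈) (residue q q∈)
    where
    residue : ∀ b → b ∈ c i₀ → Fin.toℕ i₀ ≋ b
    residue b b∈ = trans (cong (_% t) (trans (cong Fin.toℕ (sym (proj₂ (∈-filter⁻ (λ b → b mod t Fin.≟ i₀) {xs = 𝓢} b∈)))) (toℕ-mod b)))
      (≋-% b)

  loop-residue≢i₀ : ∀ {b} → b ∈ β → Mirror b b → b mod t ≢ i₀
  loop-residue≢i₀ b∈ (inj₂ (¬ex , _)) eq = ¬ex (subst 𝓔 (sym eq) i₀∈𝓔)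
  loop-residue≢i₀ b∈ (inj₁ (ex , _ , eq)) b≡i₀ =
    no-midpoint (c i₀) c-decreasing C∈Δ
      (∈-filter⁺ (λ b → b mod t Fin.≟ i₀) (∈-filter⁺ Excess? b∈ ex) b≡i₀) eq

  -- A fixed column has the same double modulo t as `i₀` but not the same residue.
  loop-half-turn : ∀ {b} → b ∈ β → Mirror b b →
    let w = Fin.toℕ i₀ ; u = b % t in u + u ≡ w + w + t ⊎ w + w ≡ u + u + t
  loop-half-turn {b} b∈ loop = half-turn (Fin.toℕ<n i₀) (m%n<n b t)
    (λ eq → loop-residue≢i₀ b∈ loop (Fin.toℕ-injective (trans (toℕ-mod b) eq)))
    (trans (≋-+ (≋-% b) (≋-% b)) (trans (Mirror⇒≋ loop) (sym C≋2i₀)))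

  -- Both columns lie in the class opposite to `i₀`. Outside the excess part a class has a single
  -- column, and within it both columns are half of C.
  loop-unique : ∀ {x y} → x ∈ β → y ∈ β → Mirror x x → Mirror y y → x ≡ y
  loop-unique {x} {y} x∈ y∈ Mx My = compare Mx My
    where
    x≋y : x ≋ y
    x≋y = half-turn-unique {Fin.toℕ i₀} (m%n<n x t) (m%n<n y t) (loop-half-turn x∈ Mx) (loop-half-turn y∈ My)
    compare : Mirror x x → Mirror y y → x ≡ y
    compare (inj₂ (¬ex , _)) _ = nonexcess-unique x∈ y∈ ¬ex (sym x≋y)
    compare _ (inj₂ (¬ey , _)) = sym (nonexcess-unique y∈ x∈ ¬ey x≋y)
    compare (inj₁ (ex , _ , p)) (inj₁ (ey , _ , q)) with ℕ.<-cmp x y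
    ... | tri< x<y _ _ = ⊥-elim (ℕ.<-irrefl (trans p (sym q)) (ℕ.+-mono-< x<y x<y))
    ... | tri≈ _ x≡y _ = x≡y
    ... | tri> _ _ y<x = ⊥-elim (ℕ.<-irrefl (trans q (sym p)) (ℕ.+-mono-< y<x y<x))

  length-flatten : ∀ (ps : List (ℕ × ℕ)) fs → length (flatten ps ++ fs) ≡ 2 * length ps + length fs
  length-flatten []       fs = refl
  length-flatten (p ∷ ps) fs = cong suc (trans (cong suc (length-flatten ps fs))
    (cong (_+ length fs) (sym (ℕ.+-suc (length ps) _))))

  -- Two self-mirrored columns would coincide, and a single one would make t
  -- even and N odd.
  perfect-matching : ∀ r → N ≡ t + r * 2 →
    ∃[ ps ] ∃[ h ] t ≡ h + h × length ps ≡ h + r × β ↭ flatten ps ×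
                   All (λ (b , b′) → b ∈ β × b′ ∈ β × Mirror b b′) ps
  perfect-matching r N≡ = conclude fixed refl loops unique
    where
    open Matching (matching (λ {x} {y} → Mirror-sym {x} {y}) (length β) β ℕ.≤-refl β-unique partner partner-unique)
    count : ∀ {fs} → fixed ≡ fs → t + r * 2 ≡ 2 * length pairs + length fs
    count refl = trans (sym N≡) (trans (sym (List.length-tabulate {n = N} _))
      (trans (↭-length perm) (length-flatten pairs fixed)))
    double : ∀ h → 2 * h ≡ h + h
    double h = cong (h +_) (ℕ.+-identityʳ h)
    conclude : ∀ fs → fixed ≡ fs → All (λ f → f ∈ β × Mirror f f) fs → Unique fs →
      ∃[ ps ] ∃[ h ] t ≡ h + h × length ps ≡ h + r × β ↭ flatten ps ×
                     All (λ (b , b′) → b ∈ β × b′ ∈ β × Mirror b b′) ps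
    conclude (x ∷ y ∷ _) _ ((x∈ , Mx) ∷ (y∈ , My) ∷ _) ((x≢y ∷ _) ∷ _) = ⊥-elim (x≢y (loop-unique x∈ y∈ Mx My))
    conclude (x ∷ []) eq ((x∈ , Mx) ∷ []) _ with half-turn-even {Fin.toℕ i₀} {x % t} (loop-half-turn x∈ Mx)
    ... | h , t≡ = ⊥-elim (ℕ.even≢odd (h + r) (length pairs) (begin
      2 * (h + r)                 ≡⟨ ℕ.*-distribˡ-+ 2 h r ⟩
      2 * h + 2 * r               ≡⟨ cong₂ _+_ (trans (double h) (sym t≡)) (ℕ.*-comm 2 r) ⟩
      t + r * 2                   ≡⟨ count eq ⟩
      2 * length pairs + 1        ≡⟨ ℕ.+-comm _ 1 ⟩
      suc (2 * length pairs)      ∎))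
      where open ≡-Reasoning
    conclude [] eq _ _ = pairs , h , t≡ , length≡ ,
      subst (β ↭_) (trans (cong (flatten pairs ++_) eq) (List.++-identityʳ _)) perm , matched
      where
      open ≡-Reasoning
      -- With no fixed column, t + 2 r is twice the number of pairs. So the evenness of t comes from
      -- counting here, and h is half of t.
      h = length pairs ∸ r
      2t : t + 2 * r ≡ 2 * length pairs
      2t = trans (cong (t +_) (ℕ.*-comm 2 r)) (trans (count eq) (ℕ.+-identityʳ _))
      r≤ : r ≤ length pairs
      r≤ = ℕ.*-cancelˡ-≤ 2 (ℕ.≤-trans (ℕ.m≤n+m (2 * r) t) (ℕ.≤-reflexive 2t))
      length≡ : length pairs ≡ h + r
      length≡ = sym (ℕ.m∸n+n≡m r≤)
      t≡ : t ≡ h + h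
      t≡ = ℕ.+-cancelʳ-≡ (2 * r) t (h + h) (begin
        t + 2 * r             ≡⟨ 2t ⟩
        2 * length pairs      ≡⟨ cong (2 *_) length≡ ⟩
        2 * (h + r)           ≡⟨ ℕ.*-distribˡ-+ 2 h r ⟩
        2 * h + 2 * r         ≡⟨ cong (_+ 2 * r) (double h) ⟩
        h + h + 2 * r         ∎)

-- Determinants that a reflection of rows and columns negates.

module MirroredDeterminant {a ℓ} (R : CommutativeRing a ℓ) where
  open import Data.List using (List; []; _∷_; _++_; map; length)
  import Data.List.Properties as List
  open import Data.List.Relation.Unary.All as All using (All; []; _∷_)
  import Data.List.Relation.Unary.All.Properties as All
  open import Data.Nat using (zero; suc)
  open import Data.Product as Product using (_×_; _,_; proj₁; proj₂; uncurry)
  open import Function using (_∘_)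
  open import Relation.Binary.Core using (Rel)
  open import Relation.Binary.Definitions using (Symmetric)
  open import Relation.Binary.PropositionalEquality as ≡ using (_≡_)
  open CommutativeRing R
  open import Relation.Binary.Reasoning.Setoid setoid
  open IntegerSolver R
  open Determinant R
  open Pairing using (flatten)

  sign² : ∀ n → sign n * sign n ≈ 1#
  sign² zero    = *-identityˡ 1#
  sign² (suc n) = trans (solve 1 (λ s → :- s :* :- s := s :* s) refl (sign n)) (sign² n)

  prod-++ : ∀ xs ys → prod (xs ++ ys) ≈ prod xs * prod ys
  prod-++ []       ys = sym (*-identityˡ _)
  prod-++ (x ∷ xs) ys = trans (*-congˡ (prod-++ xs ys)) (sym (*-assoc x _ _))

  All-flatten : ∀ {b p} {B : Set b} {P : B → Set p} {ps} → All (λ (p , q) → P p × P q) ps → All P (flatten ps)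
  All-flatten []              = []
  All-flatten ((p , q) ∷ pqs) = p ∷ q ∷ All-flatten pqs

  module _ {b} {B : Set b} where

    map-flatten : ∀ {c} {C : Set c} (f : B → C) ps → map f (flatten ps) ≡ flatten (map (Product.map f f) ps)
    map-flatten f []             = ≡.refl
    map-flatten f ((p , q) ∷ ps) = ≡.cong (λ xs → f p ∷ f q ∷ xs) (map-flatten f ps)

    -- Each entry next to its mate, in both directions: the first components are the original list,
    -- the second components the list with every pair exchanged.
    mates : List (B × B) → List (B × B)
    mates = flatten ∘ map (λ p → p , Product.swap p)

    map-proj₁-mates : ∀ ps → map proj₁ (mates ps) ≡ flatten ps
    map-proj₁-mates []       = ≡.refl
    map-proj₁-mates (p ∷ ps) = ≡.cong (λ xs → _ ∷ _ ∷ xs) (map-proj₁-mates ps)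

    map-proj₂-mates : ∀ ps → map proj₂ (mates ps) ≡ flatten (map Product.swap ps)
    map-proj₂-mates []       = ≡.refl
    map-proj₂-mates (p ∷ ps) = ≡.cong (λ xs → _ ∷ _ ∷ xs) (map-proj₂-mates ps)

    All-mates : ∀ {ℓ} {_~_ : Rel B ℓ} → Symmetric _~_ → ∀ {ps} → All (uncurry _~_) ps → All (uncurry _~_) (mates ps)
    All-mates ~-sym p~q = All-flatten (All.map⁺ (All.map (λ p~q → p~q , ~-sym p~q) p~q))

  module _ {b x} {B : Set b} {X : Set x} (e : X → B → Carrier) (s : X → Carrier) where

    -- Both determinants are rewritten over the same lists of pairs, where `law` compares them entry
    -- by entry and the factors `s` come out of the rows.
    det-mirror : ∀ {p q} {_~_ : Rel X p} {_≎_ : Rel B q} →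
      (∀ {x x′ b b′} → x ~ x′ → b ≎ b′ → e x b ≈ s x * e x′ b′) →
      ∀ {rs cs} → All (uncurry _~_) rs → All (uncurry _≎_) cs →
      det (map e (map proj₁ rs)) (map proj₁ cs) ≈ prod (map s (map proj₁ rs)) * det (map e (map proj₂ rs)) (map proj₂ cs)
    det-mirror {_≎_ = _≎_} law {rs} {cs} x~x′ b≎b′ = begin
      det (map e (map proj₁ rs)) (map proj₁ cs)
        ≈⟨ relabel proj₁ proj₁ ⟩
      det (map (λ r c → e (proj₁ r) (proj₁ c)) rs) cs
        ≈⟨ det-cong {P = uncurry _≎_} {xs = rs} laws b≎b′ ⟩
      det (map (λ r c → s (proj₁ r) * e (proj₂ r) (proj₂ c)) rs) cs
        ≈⟨ det-scale (s ∘ proj₁) _ _ (λ r c → refl) rs cs ⟩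
      prod (map (s ∘ proj₁) rs) * det (map (λ r c → e (proj₂ r) (proj₂ c)) rs) cs
        ≈⟨ *-cong (reflexive (≡.cong prod (List.map-∘ rs))) (sym (relabel proj₂ proj₂)) ⟩
      prod (map s (map proj₁ rs)) * det (map e (map proj₂ rs)) (map proj₂ cs) ∎
      where
      laws : All (λ r → ∀ {c} → uncurry _≎_ c → e (proj₁ r) (proj₁ c) ≈ s (proj₁ r) * e (proj₂ r) (proj₂ c)) rs
      laws = All.map (λ x~x′ {c} → law x~x′) x~x′
      relabel : ∀ (π : X × X → X) (ρ : B × B → B) →
                det (map e (map π rs)) (map ρ cs) ≈ det (map (λ r c → e (π r) (ρ c)) rs) cs
      relabel π ρ = trans (det-map ρ (map e (map π rs)) cs)
        (reflexive (≡.cong (λ φs → det φs cs) (≡.trans (≡.sym (List.map-∘ (map π rs))) (≡.sym (List.map-∘ rs)))))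

    det-swap-all : ∀ ps fs qs →
      det (map e (flatten ps ++ fs)) (flatten qs) ≈
      sign (length ps) * sign (length qs) * det (map e (flatten (map Product.swap ps) ++ fs)) (flatten (map Product.swap qs))
    det-swap-all ps fs qs = begin
      det (map e (flatten ps ++ fs)) (flatten qs)
        ≡⟨ ≡.cong (λ φs → det φs (flatten qs)) (split ps) ⟩
      det (flatten eps ++ map e fs) (flatten qs)
        ≈⟨ det-flatten eps (flatten qs) ⟩
      sign (length eps) * det (flatten (map Product.swap eps) ++ map e fs) (flatten qs)
        ≈⟨ *-cong (reflexive (≡.cong sign (List.length-map _ ps)))
                  (alternating-flatten {D = det (flatten (map Product.swap eps) ++ map e fs)} (det-alternating (flatten (map Product.swap eps) ++ map e fs)) qs) ⟩
      sign (length ps) * (sign (length qs) * det (flatten (map Product.swap eps) ++ map e fs) (flatten (map Product.swap qs)))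
        ≈⟨ *-assoc _ _ _ ⟨
      sign (length ps) * sign (length qs) * det (flatten (map Product.swap eps) ++ map e fs) (flatten (map Product.swap qs))
        ≡⟨ ≡.cong (λ φs → sign (length ps) * sign (length qs) * det φs (flatten (map Product.swap qs)))
             (≡.trans (≡.cong (λ es → flatten es ++ map e fs) (≡.trans (≡.sym (List.map-∘ ps)) (List.map-∘ ps)))
                      (≡.sym (split (map Product.swap ps)))) ⟩
      sign (length ps) * sign (length qs) * det (map e (flatten (map Product.swap ps) ++ fs)) (flatten (map Product.swap qs)) ∎
      where
      eps = map (Product.map e e) ps
      split : ∀ ps → map e (flatten ps ++ fs) ≡ flatten (map (Product.map e e) ps) ++ map e fs
      split ps = ≡.trans (List.map-++ e (flatten ps) fs) (≡.cong (_++ map e fs) (map-flatten e ps))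

    -- Exchanging all mates reproduces the determinant, but it consists of an
    -- odd number of transpositions.
    det-mirror-zero : (∀ x → x ≈ - x → x ≈ 0#) →
      ∀ {p q} {_~_ : Rel X p} {_≎_ : Rel B q} → Symmetric _~_ → Symmetric _≎_ →
      (∀ {x x′ b b′} → x ~ x′ → b ≎ b′ → e x b ≈ s x * e x′ b′) →
      ∀ {ps fs qs} → length qs ≡ suc (length ps) → prod (map s (flatten ps ++ fs)) ≈ 1# →
      All (uncurry _~_) ps → All (λ f → f ~ f) fs → All (uncurry _≎_) qs →
      det (map e (flatten ps ++ fs)) (flatten qs) ≈ 0#
    det-mirror-zero x≈-x⇒x≈0 {_~_ = _~_} {_≎_} ~-sym ≎-sym law {ps} {fs} {qs} q≡1+p Πs≈1 p~ f~f q≎ =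
      x≈-x⇒x≈0 _ (begin
        det (map e (flatten ps ++ fs)) (flatten qs)
          ≈⟨ det-swap-all ps fs qs ⟩
        sign (length ps) * sign (length qs) * d′
          ≡⟨ ≡.cong (λ n → sign (length ps) * sign n * d′) q≡1+p ⟩
        sign (length ps) * - sign (length ps) * d′
          ≈⟨ solve 2 (λ s d → s :* :- s :* d := :- (s :* s :* d)) refl _ _ ⟩
        - (sign (length ps) * sign (length ps) * d′)
          ≈⟨ -‿cong (*-congʳ (trans (sign² (length ps)) (sym Πs≈1))) ⟩
        - (prod (map s (flatten ps ++ fs)) * d′)
          ≈⟨ -‿cong (*-cong (reflexive (≡.cong (prod ∘ map s) rs₁))
                            (reflexive (≡.cong₂ (λ xs cs → det (map e xs) cs) rs₂ (map-proj₂-mates qs)))) ⟨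
        - (prod (map s (map proj₁ rs)) * det (map e (map proj₂ rs)) (map proj₂ (mates qs)))
          ≈⟨ -‿cong (det-mirror law (All.++⁺ (All-mates ~-sym p~) (All.map⁺ f~f)) (All-mates ≎-sym q≎)) ⟨
        - det (map e (map proj₁ rs)) (map proj₁ (mates qs))
          ≡⟨ ≡.cong₂ (λ xs cs → - det (map e xs) cs) rs₁ (map-proj₁-mates qs) ⟩
        - det (map e (flatten ps ++ fs)) (flatten qs) ∎)
      where
      d′ = det (map e (flatten (map Product.swap ps) ++ fs)) (flatten (map Product.swap qs))
      rs = mates ps ++ map (λ f → f , f) fs
      rs₁ : map proj₁ rs ≡ flatten ps ++ fs
      rs₁ = ≡.trans (List.map-++ proj₁ (mates ps) _)
        (≡.cong₂ _++_ (map-proj₁-mates ps) (≡.trans (≡.sym (List.map-∘ fs)) (List.map-id fs)))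
      rs₂ : map proj₂ rs ≡ flatten (map Product.swap ps) ++ fs
      rs₂ = ≡.trans (List.map-++ proj₂ (mates ps) _)
        (≡.cong₂ _++_ (map-proj₂-mates ps) (≡.trans (≡.sym (List.map-∘ fs)) (List.map-id fs)))

-- Units, power sums of roots of unity and their inverse pairs.

module RootsOfUnity {a ℓ} (R : CommutativeRing a ℓ) where
  open import Data.Integer using (+_)
  open import Data.List using (List; []; _∷_; _++_; map; length; applyUpTo; upTo)
  import Data.List.Properties as List
  open import Data.List.Relation.Binary.Permutation.Propositional using (_↭_; prep; ↭-refl; ↭-trans; ↭-sym; ↭-reflexive)
  open import Data.List.Relation.Binary.Permutation.Propositional.Properties using (∷↭∷ʳ)
  open import Data.List.Relation.Unary.All as All using ([]; _∷_)
  open import Data.List.Relation.Unary.AllPairs using ([]; _∷_)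
  open import Data.List.Relation.Unary.Any using (here; there)
  open import Data.List.Relation.Unary.Unique.Propositional using (Unique)
  open import Data.Nat as ℕ using (zero; suc; _<_)
  open import Data.Nat.DivMod using (_%_; _/_; m≡m%n+[m/n]*n; m%n<n)
  import Data.Nat.Properties as ℕ
  open import Data.Product using (_×_; _,_; ∃-syntax; proj₁; proj₂)
  open import Function using (_∘_)
  open import Relation.Nullary using (¬_)
  open import Relation.Binary.PropositionalEquality as ≡ using (_≡_; _≢_)
  open CommutativeRing R
  open import Relation.Binary.Reasoning.Setoid setoid
  open import Algebra.Properties.Ring ring
  open import Algebra.Properties.Semiring.Exp semiring
  open import Algebra.Properties.Semiring.Mult semiring using () renaming (_×_ to _·_)
  open IntegerSolver R
  open Summation R
  open Pairing using (flatten)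

  -- Stands in for being nonzero: a unit can be cancelled in any commutative ring without deciding
  -- whether an element is 0.
  Unit : Carrier → Set _
  Unit u = ∃[ v ] v * u ≈ 1#

  unit-cancel : ∀ {u x} → Unit u → u * x ≈ 0# → x ≈ 0#
  unit-cancel {u} {x} (v , vu≈1) ux≈0 = begin
    x             ≈⟨ *-identityˡ x ⟨
    1# * x        ≈⟨ *-congʳ vu≈1 ⟨
    v * u * x     ≈⟨ *-assoc v u x ⟩
    v * (u * x)   ≈⟨ *-congˡ ux≈0 ⟩
    v * 0#        ≈⟨ zeroʳ v ⟩
    0#            ∎

  1^n≈1 : ∀ n → 1# ^ n ≈ 1#
  1^n≈1 zero    = refl
  1^n≈1 (suc n) = trans (*-identityˡ _) (1^n≈1 n)

  ^-comm-exponents : ∀ x m n → (x ^ m) ^ n ≈ (x ^ n) ^ m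
  ^-comm-exponents x m n = begin
    (x ^ m) ^ n     ≈⟨ ^-assocʳ x m n ⟩
    x ^ (m ℕ.* n)   ≡⟨ ≡.cong (x ^_) (ℕ.*-comm m n) ⟩
    x ^ (n ℕ.* m)   ≈⟨ ^-assocʳ x n m ⟨
    (x ^ n) ^ m     ∎

  geometric : ∀ w n → (w - 1#) * sumBelow n (w ^_) ≈ w ^ n - 1#
  geometric w zero    = trans (zeroʳ _) (sym (-‿inverseʳ 1#))
  geometric w (suc n) = begin
    (w - 1#) * (1# + sumBelow n (λ i → w * w ^ i))
      ≈⟨ *-congˡ (+-congˡ (sumBelow-*ˡ n)) ⟩
    (w - 1#) * (1# + w * sumBelow n (w ^_))
      ≈⟨ solve 3 (λ w o s → (w :- o) :* (o :+ w :* s) := (w :- o) :* o :+ w :* ((w :- o) :* s)) refl w 1# _ ⟩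
    (w - 1#) * 1# + w * ((w - 1#) * sumBelow n (w ^_))
      ≈⟨ +-cong (*-identityʳ _) (*-congˡ (geometric w n)) ⟩
    (w - 1#) + w * (w ^ n - 1#)
      ≈⟨ +-congˡ (trans (x[y-z]≈xy-xz w _ 1#) (+-congˡ (-‿cong (*-identityʳ w)))) ⟩
    (w - 1#) + (w * w ^ n - w)
      ≈⟨ solve 3 (λ w o p → (w :- o) :+ (p :- w) := p :- o) refl w 1# _ ⟩
    w ^ suc n - 1# ∎
    where
    sumBelow-*ˡ : ∀ n {f : ℕ → Carrier} → sumBelow n (λ i → w * f i) ≈ w * sumBelow n f
    sumBelow-*ˡ zero    = sym (zeroʳ w)
    sumBelow-*ˡ (suc n) = trans (+-congˡ (sumBelow-*ˡ n)) (sym (distribˡ w _ _))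

  sum-single : ∀ {b} {B : Set b} {f : B → Carrier} {y xs} → Unique xs → y ∈ xs →
               (∀ {x} → x ∈ xs → x ≢ y → f x ≈ 0#) → sum f xs ≈ f y
  sum-single {f = f} {xs = x ∷ xs} (x∉ ∷ _) (here ≡.refl) f≈0 = trans (+-congˡ (trans
    (sum-cong (All.tabulate (λ z∈ → f≈0 (there z∈) (All.lookup x∉ z∈ ∘ ≡.sym)))) (sum-zero (λ _ → refl) xs))) (+-identityʳ _)
  sum-single (x∉ ∷ xs!) (there y∈) f≈0 = trans (+-cong (f≈0 (here ≡.refl) (All.lookup x∉ y∈)) (sum-single xs! y∈ (f≈0 ∘ there)))
    (+-identityˡ _)

  module _ (t : ℕ) .{{_ : NonZero t}} where
    open Residues t

    root-power : ∀ {x a b} → x ^ t ≈ 1# → a ≋ b → x ^ a ≈ x ^ b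
    root-power {x} {a} {b} x^t≈1 a≋b = trans (reduce a) (trans (^-congʳ x a≋b) (sym (reduce b)))
      where
      reduce : ∀ a → x ^ a ≈ x ^ (a % t)
      reduce a = begin
        x ^ a                             ≡⟨ ≡.cong (x ^_) (m≡m%n+[m/n]*n a t) ⟩
        x ^ (a % t ℕ.+ a / t ℕ.* t)       ≈⟨ ^-homo-* x (a % t) _ ⟩
        x ^ (a % t) * x ^ (a / t ℕ.* t)   ≡⟨ ≡.cong (λ n → x ^ (a % t) * x ^ n) (ℕ.*-comm (a / t) t) ⟩
        x ^ (a % t) * x ^ (t ℕ.* (a / t)) ≈⟨ *-congˡ (^-assocʳ x t (a / t)) ⟨
        x ^ (a % t) * (x ^ t) ^ (a / t)   ≈⟨ *-congˡ (trans (^-congˡ (a / t) x^t≈1) (1^n≈1 (a / t))) ⟩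
        x ^ (a % t) * 1#                  ≈⟨ *-identityʳ _ ⟩
        x ^ (a % t)                       ∎

    module _ {ζ : Carrier} (ζ^t≈1 : ζ ^ t ≈ 1#) where

      power-root : ∀ k → (ζ ^ k) ^ t ≈ 1#
      power-root k = trans (^-comm-exponents ζ k t) (trans (^-congˡ k ζ^t≈1) (1^n≈1 k))

      powerSum-≋0 : ∀ m → m ≋ 0 → sum (λ k → (ζ ^ k) ^ m) (upTo t) ≈ t · 1#
      powerSum-≋0 m m≋0 = begin
        sum (λ k → (ζ ^ k) ^ m) (upTo t) ≈⟨ sum-cong-≗ (λ k → root-power (power-root k) m≋0) (upTo t) ⟩
        sum (λ k → 1#) (upTo t)          ≈⟨ sum-applyUpTo (λ k → 1#) (λ i → i) t ⟩
        sumBelow t (λ k → 1#)            ≈⟨ count t ⟩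
        t · 1#                           ∎
        where
        count : ∀ n → sumBelow n (λ k → 1#) ≈ n · 1#
        count zero    = refl
        count (suc n) = +-congˡ (count n)

      -- Orthogonality of the characters of ℤ / t. The unit ζ ^ m - 1 turns the geometric sum into
      -- (ζ ^ m) ^ t - 1, which is 0.
      powerSum-≢0 : (∀ k → 0 < k → k < t → Unit (ζ ^ k - 1#)) →
                    ∀ m → ¬ m ≋ 0 → sum (λ k → (ζ ^ k) ^ m) (upTo t) ≈ 0#
      powerSum-≢0 isPrimitive m m≢0 = unit-cancel (proj₁ unit , trans (*-congˡ (+-congʳ reduce)) (proj₂ unit)) (begin
        (ζ ^ m - 1#) * sum (λ k → (ζ ^ k) ^ m) (upTo t)
          ≈⟨ *-congˡ (trans (sum-cong-≗ (λ k → ^-comm-exponents ζ k m) (upTo t)) (sum-applyUpTo ((ζ ^ m) ^_) (λ i → i) t)) ⟩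
        (ζ ^ m - 1#) * sumBelow t ((ζ ^ m) ^_)
          ≈⟨ geometric (ζ ^ m) t ⟩
        (ζ ^ m) ^ t - 1#
          ≈⟨ +-congʳ (power-root m) ⟩
        1# - 1#
          ≈⟨ -‿inverseʳ 1# ⟩
        0# ∎)
        where
        reduce : ζ ^ m ≈ ζ ^ (m % t)
        reduce = root-power ζ^t≈1 (≡.sym (≋-% m))
        0%t : 0 % t ≡ 0
        0%t = ℕ.n≤0⇒n≡0 (Data.Nat.DivMod.m%n≤m 0 t)
        unit = isPrimitive (m % t) (ℕ.n≢0⇒n>0 (λ eq → m≢0 (≡.trans eq (≡.sym 0%t)))) (m%n<n m t)

  -- Pairs the index i with 2 m - i and leaves the midpoint. Applied to the powers of ζ with
  -- exponents 1 to t - 1, it gives pairs whose exponents add up to t, that is, inverse pairs.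
  fold-applyUpTo : ∀ {b} {B : Set b} (f : ℕ → B) m →
    ∃[ ps ] length ps ≡ m × applyUpTo f (suc (m ℕ.+ m)) ↭ flatten ps ++ f m ∷ [] ×
            All (λ (x , x′) → ∃[ i ] ∃[ j ] x ≡ f i × x′ ≡ f j × i ℕ.+ j ≡ m ℕ.+ m) ps
  fold-applyUpTo f zero    = [] , ≡.refl , ↭-refl , []
  fold-applyUpTo f (suc m) with fold-applyUpTo (f ∘ suc) m
  ... | ps , len , perm , sums =
    (f 0 , f (suc (suc (m ℕ.+ m)))) ∷ ps , ≡.cong suc len , ↭-trans (↭-reflexive lastTerm)
      (prep (f 0) (↭-trans (↭-sym (∷↭∷ʳ _ _)) (prep _ perm))) ,
    (0 , suc (suc (m ℕ.+ m)) , ≡.refl , ≡.refl , ≡.cong suc (≡.sym (ℕ.+-suc m m))) ∷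
    All.map (λ (i , j , p , q , eq) → suc i , suc j , p , q ,
      ≡.cong suc (≡.trans (ℕ.+-suc i j) (≡.trans (≡.cong suc eq) (≡.sym (ℕ.+-suc m m))))) sums
    where
    lastTerm : applyUpTo f (suc (suc m ℕ.+ suc m)) ≡
               f 0 ∷ (applyUpTo (f ∘ suc) (suc (m ℕ.+ m)) ++ f (suc (suc (m ℕ.+ m))) ∷ [])
    lastTerm = ≡.trans (≡.cong (λ n → applyUpTo f (suc (suc n))) (ℕ.+-suc m m))
      (≡.cong (f 0 ∷_) (≡.sym (List.applyUpTo-∷ʳ (f ∘ suc) (suc (m ℕ.+ m)))))

-- Vanishing of the determinant of powers when the points come in inverse pairs.

module InversePairs {a ℓ} (R : CommutativeRing a ℓ)
  (t : ℕ) .{{_ : NonZero t}} {N : ℕ} (shape : Vec ℕ N) (shape↘ : Linked Data.Nat._≥_ shape)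
  (n≥1 : (i : Fin t) → 1 Data.Nat.≤ BetaSet.n t shape i)
  (C : ℕ) (𝓢≤C : All (Data.Nat._≤ C) (BetaSet.𝓢 t shape)) (symmetric : SymmetricAbout C (BetaSet.𝓢 t shape))
  (i₀ : Fin t) (i₀∈𝓔 : BetaSet.𝓔 t shape i₀) (C∈Δ : C ∈ BetaSet.Δ t shape i₀) where

  open import Data.Bool using (Bool; true; false)
  import Data.Fin as Fin
  open import Data.Integer using (+_)
  open import Data.List using (List; []; _∷_; _++_; map; filter; length; applyUpTo; upTo)
  import Data.List.Properties as List
  open import Data.List.Membership.Propositional.Properties using (∈-filter⁺; ∈-filter⁻; ∈-map⁺; ∈-++⁺ʳ)
  open import Data.List.Relation.Binary.Permutation.Propositional using (_↭_; prep; ↭-trans; ↭-reflexive)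
  import Data.List.Relation.Binary.Permutation.Propositional.Properties as Perm
  open import Data.List.Relation.Unary.All as All using ([]; _∷_)
  import Data.List.Relation.Unary.All.Properties as All
  import Data.List.Relation.Unary.Unique.Propositional.Properties as Unique
  open import Data.List.Relation.Unary.Unique.Propositional using (Unique)
  open import Data.Nat as ℕ using (zero; suc; _<_)
  open import Data.Nat.DivMod using (_%_)
  import Data.Nat.Properties as ℕ
  open import Data.Product as Product using (_×_; _,_; ∃-syntax; proj₁; proj₂; uncurry)
  open import Data.Sum using (inj₁; inj₂)
  open import Function using (_∘_)
  open import Relation.Nullary using (¬_; Dec; yes; no)
  open import Relation.Nullary.Negation using (contradiction)
  open import Relation.Nullary.Decidable using (¬?)
  open import Relation.Binary.Definitions using (Symmetric)
  open import Relation.Binary.PropositionalEquality as ≡ using (_≡_; _≢_)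
  open CommutativeRing R
  open import Relation.Binary.Reasoning.Setoid setoid
  open import Algebra.Properties.Ring ring
  open import Algebra.Properties.Semiring.Exp semiring
  open import Algebra.Properties.CommutativeSemiring.Exp commutativeSemiring using (^-distrib-*)
  open import Algebra.Properties.Semiring.Mult semiring using () renaming (_×_ to _·_)
  open IntegerSolver R
  open Summation R
  open Determinant R
  open RootsOfUnity R
  open MirroredDeterminant R
  open Pairing using (flatten)
  open BetaSet t shape
  open Residues t
  open ExcessSymmetry t shape shape↘ n≥1 C 𝓢≤C symmetric i₀ i₀∈𝓔 C∈Δ

  singles : List ℕ
  singles = filter (¬? ∘ Excess?) β

  -- A row is a point tagged with whether it is a root of unity; the other
  -- rows have been cleared outside the excess part.
  Row : Set a
  Row = Carrier × Bool

  keepIf : ∀ {p} {P : Set p} → Dec P → Carrier → Carrier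
  keepIf (yes _) v = v
  keepIf (no _)  v = 0#

  entry : Row → ℕ → Carrier
  entry (x , true)  b = x ^ b
  entry (x , false) b = keepIf (Excess? b) (x ^ b)

  entry-excess : ∀ {x b} → Excess b → entry (x , false) b ≡ x ^ b
  entry-excess {x} {b} ex = keep (Excess? b)
    where
    keep : ∀ {v} (e? : Dec (Excess b)) → keepIf e? v ≡ v
    keep (yes _)  = ≡.refl
    keep (no ¬ex) = contradiction ex ¬ex

  entry-single : ∀ {x b} → ¬ Excess b → entry (x , false) b ≡ 0#
  entry-single {x} {b} ¬ex = discard (Excess? b)
    where
    discard : ∀ {v} (e? : Dec (Excess b)) → keepIf e? v ≡ 0#
    discard (yes ex) = contradiction ex ¬ex
    discard (no _)   = ≡.refl

  module _ {ζ : Carrier} (ζ^t≈1 : ζ ^ t ≈ 1#) (isPrimitive : ∀ k → 0 < k → k < t → Unit (ζ ^ k - 1#))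
           (t-unit : Unit (t · 1#)) where

    private
      t⁻¹ = proj₁ t-unit

      -- Combined with the rows of the roots of unity, these coefficients give
      -- x ^ b in the column b of a class with one element, and 0 in the others:
      -- the discrete Fourier transform singles out a residue class.
      coefficient : Carrier → ℕ → Carrier
      coefficient x k = sum (λ c → t⁻¹ * (x ^ c * (ζ ^ k) ^ negate c)) singles

      terms : Carrier → List (Carrier × (ℕ → Carrier))
      terms x = map (λ k → coefficient x k , (ζ ^ k) ^_) (upTo t)

      -- The indicator of m ≡ 0 modulo t, as a mean over the roots of unity.
      detector : ℕ → Carrier
      detector m = t⁻¹ * sum (λ k → (ζ ^ k) ^ m) (upTo t)

      detector-≋0 : ∀ m → m ≋ 0 → detector m ≈ 1#
      detector-≋0 m m≋0 = trans (*-congˡ (powerSum-≋0 t ζ^t≈1 m m≋0)) (proj₂ t-unit)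

      detector-≢0 : ∀ m → ¬ m ≋ 0 → detector m ≈ 0#
      detector-≢0 m m≢0 = trans (*-congˡ (powerSum-≢0 t ζ^t≈1 isPrimitive m m≢0)) (zeroʳ t⁻¹)

      combination-terms : ∀ x b → combination (terms x) b ≈ sum (λ c → x ^ c * detector (b ℕ.+ negate c)) singles
      combination-terms x b = begin
        sum (λ (α , φ) → α * φ b) (terms x)
          ≈⟨ sum-map _ (λ k → coefficient x k , (ζ ^ k) ^_) (upTo t) ⟩
        sum (λ k → coefficient x k * (ζ ^ k) ^ b) (upTo t)
          ≈⟨ sum-cong-≗ (λ k → trans (*-comm _ _) (sym (sum-*ˡ _ _ singles))) (upTo t) ⟩
        sum (λ k → sum (λ c → (ζ ^ k) ^ b * (t⁻¹ * (x ^ c * (ζ ^ k) ^ negate c))) singles) (upTo t)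
          ≈⟨ sum-swap _ (upTo t) singles ⟩
        sum (λ c → sum (λ k → (ζ ^ k) ^ b * (t⁻¹ * (x ^ c * (ζ ^ k) ^ negate c))) (upTo t)) singles
          ≈⟨ sum-cong-≗ (λ c → trans (sum-cong-≗ (collect c) (upTo t))
               (trans (sum-*ˡ _ _ (upTo t)) (*-congˡ (sum-*ˡ _ _ (upTo t))))) singles ⟩
        sum (λ c → x ^ c * detector (b ℕ.+ negate c)) singles ∎
        where
        collect : ∀ c k → (ζ ^ k) ^ b * (t⁻¹ * (x ^ c * (ζ ^ k) ^ negate c)) ≈
                          x ^ c * (t⁻¹ * (ζ ^ k) ^ (b ℕ.+ negate c))
        collect c k = trans (solve 4 (λ u v w s → u :* (v :* (w :* s)) := w :* (v :* (u :* s))) refl _ _ _ _)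
          (*-congˡ (*-congˡ (sym (^-homo-* (ζ ^ k) b (negate c)))))

      detects : ∀ {b c} → b ℕ.+ negate c ≋ 0 → b ≋ c
      detects {b} {c} eq = ≡.trans (≡.sym (≋-+-negate b c))
        (≡.trans (≡.cong (_% t) (swap-last b c)) (≋-+ {b = c} eq ≡.refl))
        where
        swap-last : ∀ b c → b ℕ.+ c ℕ.+ negate c ≡ b ℕ.+ negate c ℕ.+ c
        swap-last b c = ≡.trans (ℕ.+-assoc b c _) (≡.trans (≡.cong (b ℕ.+_) (ℕ.+-comm c _)) (≡.sym (ℕ.+-assoc b _ c)))

    -- An excess column is congruent to no entry of `singles`, so nothing is subtracted from it. Any
    -- other column of `β` is congruent there to itself alone, so exactly its own entry is
    -- subtracted.
    cleared-entry : ∀ x {b} → b ∈ β → x ^ b - combination (terms x) b ≈ entry (x , false) b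
    cleared-entry x {b} b∈ = trans (+-congˡ (-‿cong (combination-terms x b))) (subtract (Excess? b))
      where
      is-single : ∀ {c} → c ∈ singles → c ∈ β × ¬ Excess c
      is-single = ∈-filter⁻ (¬? ∘ Excess?)
      subtract : Dec (Excess b) → x ^ b - sum (λ c → x ^ c * detector (b ℕ.+ negate c)) singles ≈ entry (x , false) b
      subtract (yes ex) = begin
        x ^ b - sum (λ c → x ^ c * detector (b ℕ.+ negate c)) singles
          ≈⟨ +-congˡ (-‿cong (trans (sum-cong (All.tabulate vanish)) (sum-zero (λ _ → refl) singles))) ⟩
        x ^ b - 0#
          ≈⟨ trans (+-congˡ -0#≈0#) (+-identityʳ _) ⟩
        x ^ b
          ≡⟨ entry-excess ex ⟨
        entry (x , false) b ∎
        where
        vanish : ∀ {c} → c ∈ singles → x ^ c * detector (b ℕ.+ negate c) ≈ 0#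
        vanish {c} c∈ = trans (*-congˡ (detector-≢0 _ λ eq → proj₂ (is-single c∈) (Excess-resp-≋ {b} {c} (detects eq) ex))) (zeroʳ _)
      subtract (no ¬ex) = begin
        x ^ b - sum (λ c → x ^ c * detector (b ℕ.+ negate c)) singles
          ≈⟨ +-congˡ (-‿cong (sum-single (Unique.filter⁺ (¬? ∘ Excess?) β-unique) (∈-filter⁺ (¬? ∘ Excess?) b∈ ¬ex) vanish)) ⟩
        x ^ b - x ^ b * detector (b ℕ.+ negate b)
          ≈⟨ +-congˡ (-‿cong (trans (*-congˡ (detector-≋0 _ (≋-+-negate 0 b))) (*-identityʳ _))) ⟩
        x ^ b - x ^ b
          ≈⟨ -‿inverseʳ _ ⟩
        0#
          ≡⟨ entry-single ¬ex ⟨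
        entry (x , false) b ∎
        where
        vanish : ∀ {c} → c ∈ singles → c ≢ b → x ^ c * detector (b ℕ.+ negate c) ≈ 0#
        vanish {c} c∈ c≢b = trans (*-congˡ (detector-≢0 _ λ eq →
          c≢b (nonexcess-unique (proj₁ (is-single c∈)) b∈ (proj₂ (is-single c∈)) (detects eq)))) (zeroʳ _)

    unityRows : List Carrier
    unityRows = map (ζ ^_) (upTo t)

    private
      clear : Carrier → ℕ → Carrier
      clear x b = x ^ b - combination (terms x) b

      -- The rows of the roots of unity stay untouched below, available for clearing each of the
      -- other rows.
      det-clear : ∀ xs cs → det (map clear xs ++ map _^_ unityRows) cs ≈ det (map _^_ xs ++ map _^_ unityRows) cs
      det-clear []       cs = refl
      det-clear (x ∷ xs) cs = trans
        (det-sub-combination (terms x) (All.map⁺ (All.tabulate λ k∈ → ∈-++⁺ʳ (map clear xs) (∈-map⁺ _^_ (∈-map⁺ (ζ ^_) k∈)))) cs)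
        (expand-congʳ (det-clear xs) cs)

    taggedRows : List Carrier → List Row
    taggedRows xs = map (_, false) xs ++ map (_, true) unityRows

    det-taggedRows : ∀ xs → det (map _^_ (xs ++ unityRows)) β ≈ det (map entry (taggedRows xs)) β
    det-taggedRows xs = begin
      det (map _^_ (xs ++ unityRows)) β
        ≡⟨ ≡.cong (λ φs → det φs β) (List.map-++ _^_ xs unityRows) ⟩
      det (map _^_ xs ++ map _^_ unityRows) β
        ≈⟨ det-clear xs β ⟨
      det (map clear xs ++ map _^_ unityRows) β
        ≡⟨ ≡.cong (λ φs → det φs β) (≡.sym (≡.trans (List.map-++ cleared (map (_, false) xs) _)
             (≡.cong₂ _++_ (≡.sym (List.map-∘ xs)) (≡.sym (List.map-∘ unityRows))))) ⟩
      det (map cleared (taggedRows xs)) β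
        ≈⟨ det-cong {P = _∈ β} (All.universal cleared≈entry (taggedRows xs)) (All.tabulate λ b∈ → b∈) ⟩
      det (map entry (taggedRows xs)) β ∎
      where
      cleared : Row → ℕ → Carrier
      cleared (x , true)  = x ^_
      cleared (x , false) = clear x
      cleared≈entry : ∀ ρ {b} → b ∈ β → cleared ρ b ≈ entry ρ b
      cleared≈entry (x , true)  b∈ = refl
      cleared≈entry (x , false) b∈ = cleared-entry x b∈

    infix 4 _~_
    _~_ : Row → Row → Set ℓ
    (x , u) ~ (x′ , u′) = u ≡ u′ × x * x′ ≈ 1# × (u ≡ true → x ^ t ≈ 1# × x′ ^ t ≈ 1#)

    ~-sym : Symmetric _~_
    ~-sym (≡.refl , xx′≈1 , roots) = ≡.refl , trans (*-comm _ _) xx′≈1 , Product.swap ∘ roots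

    scale : Row → Carrier
    scale (x , _) = x ^ C

    inverse-power : ∀ {x x′} b b′ → x * x′ ≈ 1# → x ^ b ≈ x ^ (b ℕ.+ b′) * x′ ^ b′
    inverse-power {x} {x′} b b′ xx′≈1 = begin
      x ^ b                         ≈⟨ *-identityʳ _ ⟨
      x ^ b * 1#                    ≈⟨ *-congˡ (trans (^-congˡ b′ xx′≈1) (1^n≈1 b′)) ⟨
      x ^ b * (x * x′) ^ b′         ≈⟨ *-congˡ (^-distrib-* x x′ b′) ⟩
      x ^ b * (x ^ b′ * x′ ^ b′)    ≈⟨ *-assoc _ _ _ ⟨
      x ^ b * x ^ b′ * x′ ^ b′      ≈⟨ *-congʳ (^-homo-* x b b′) ⟨
      x ^ (b ℕ.+ b′) * x′ ^ b′      ∎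

    -- Everything rests on x ^ b = x ^ (b + b′) * x′ ^ b′. For a root of unity x ^ (b + b′) = x ^ C
    -- follows from the congruence. For another row the excess part provides b + b′ = C, and
    -- elsewhere both entries have been cleared to 0.
    mirror-law : ∀ {ρ ρ′ b b′} → ρ ~ ρ′ → Mirror b b′ → entry ρ b ≈ scale ρ * entry ρ′ b′
    mirror-law {x , true} {x′ , .true} {b} {b′} (≡.refl , xx′≈1 , roots) M =
      trans (inverse-power b b′ xx′≈1) (*-congʳ (root-power t (proj₁ (roots ≡.refl)) (Mirror⇒≋ M)))
    mirror-law {x , false} {x′ , .false} {b} {b′} (≡.refl , xx′≈1 , _) (inj₁ (ex , ex′ , ≡.refl)) = begin
      entry (x , false) b                              ≡⟨ entry-excess ex ⟩
      x ^ b                                            ≈⟨ inverse-power b b′ xx′≈1 ⟩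
      x ^ (b ℕ.+ b′) * x′ ^ b′                         ≡⟨ ≡.cong (x ^ (b ℕ.+ b′) *_) (entry-excess ex′) ⟨
      x ^ (b ℕ.+ b′) * entry (x′ , false) b′           ∎
    mirror-law {x , false} {x′ , .false} {b} {b′} (≡.refl , _ , _) (inj₂ (¬ex , ¬ex′ , _)) = begin
      entry (x , false) b                              ≡⟨ entry-single ¬ex ⟩
      0#                                               ≈⟨ zeroʳ _ ⟨
      x ^ C * 0#                                       ≡⟨ ≡.cong (x ^ C *_) (entry-single {x′} ¬ex′) ⟨
      x ^ C * entry (x′ , false) b′                    ∎

    scale-flatten : ∀ {ps} → All (uncurry _~_) ps → prod (map scale (flatten ps)) ≈ 1#
    scale-flatten [] = refl
    scale-flatten {((x , _) , (x′ , _)) ∷ ps} ((_ , xx′≈1 , _) ∷ p~) = begin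
      x ^ C * (x′ ^ C * prod (map scale (flatten ps)))   ≈⟨ *-congˡ (*-congˡ (scale-flatten p~)) ⟩
      x ^ C * (x′ ^ C * 1#)                              ≈⟨ *-congˡ (*-identityʳ _) ⟩
      x ^ C * x′ ^ C                                     ≈⟨ ^-distrib-* x x′ C ⟨
      (x * x′) ^ C                                       ≈⟨ trans (^-congˡ C xx′≈1) (1^n≈1 C) ⟩
      1#                                                 ∎

    module _ (x≈-x⇒x≈0 : ∀ x → x ≈ - x → x ≈ 0#) where

      det-inversePairs : ∀ r → 2 ℕ.≤ t → N ≡ t ℕ.+ r ℕ.* 2 → ∀ zs → length zs ≡ r → All (λ (x , x′) → x * x′ ≈ 1#) zs →
                         det (map _^_ (flatten zs ++ unityRows)) β ≈ 0#
      det-inversePairs r 2≤t N≡ zs len zs-inv with perfect-matching r N≡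
      ... | qs , zero , ≡.refl , _ = contradiction 2≤t λ ()
      ... | qs , suc m , t≡ , length-qs , β↭ , matched = trans (det-taggedRows (flatten zs))
        (det-↭-zero {cs = β} (Perm.map⁺ entry rows↭) (det-↭ᶜ-zero {φs = map entry (flatten ps ++ fs)} β↭
          (det-mirror-zero entry scale x≈-x⇒x≈0 {_~_ = _~_} {_≎_ = Mirror} ~-sym (λ {b} {b′} → Mirror-sym {b} {b′}) mirror-law
            {ps} {fs} {qs} counts Πscale p~ f~f (All.map (proj₂ ∘ proj₂) matched))))
        where
        rootRow : ℕ → Row
        rootRow i = ζ ^ i , true
        t≡2+2m : t ≡ suc (suc (m ℕ.+ m))
        t≡2+2m = ≡.trans t≡ (≡.cong suc (ℕ.+-suc m m))
        inverse : ∀ i j → i ℕ.+ j ≡ t → ζ ^ i * ζ ^ j ≈ 1#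
        inverse i j i+j≡t = trans (sym (^-homo-* ζ i j)) (trans (^-congʳ ζ i+j≡t) ζ^t≈1)
        half : ζ ^ suc m * ζ ^ suc m ≈ 1#
        half = inverse (suc m) (suc m) (≡.sym t≡)

        -- The exponent 0 stays out: it is its own mate, and the exponents 1 to 2 m + 1 that remain
        -- are symmetric about m + 1.
        fold = fold-applyUpTo (rootRow ∘ suc) m
        ups : List (Row × Row)
        ups = proj₁ fold
        ps : List (Row × Row)
        ps = map (Product.map (_, false) (_, false)) zs ++ ups
        fs : List Row
        fs = rootRow (suc m) ∷ rootRow 0 ∷ []

        rows↭ : taggedRows (flatten zs) ↭ flatten ps ++ fs
        rows↭ = ↭-trans (Perm.++⁺ (↭-reflexive (map-flatten (_, false) zs)) unity↭) (↭-reflexive regroup)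
          where
          tagged = map (Product.map (_, false) (_, false)) zs
          unity≡ : map (_, true) unityRows ≡ rootRow 0 ∷ applyUpTo (rootRow ∘ suc) (suc (m ℕ.+ m))
          unity≡ = ≡.trans (≡.cong (map (_, true)) (List.map-applyUpTo (λ i → i) (ζ ^_) t))
            (≡.trans (List.map-applyUpTo (ζ ^_) (_, true) t) (≡.cong (applyUpTo rootRow) t≡2+2m))
          unity↭ : map (_, true) unityRows ↭ flatten ups ++ fs
          unity↭ = ↭-trans (↭-reflexive unity≡) (↭-trans (prep _ (proj₁ (proj₂ (proj₂ fold))))
            (↭-trans (Perm.∷↭∷ʳ _ _) (↭-reflexive (List.++-assoc (flatten ups) _ _))))
          regroup : flatten tagged ++ (flatten ups ++ fs) ≡ flatten ps ++ fs
          regroup = ≡.trans (≡.sym (List.++-assoc (flatten tagged) _ fs))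
            (≡.cong (_++ fs) (≡.sym (List.concatMap-++ _ tagged ups)))

        -- There are m + 1 + r pairs of columns, against r pairs of inverse coordinates and m pairs
        -- of roots of unity.
        counts : length qs ≡ suc (length ps)
        counts = ≡.trans length-qs (≡.cong suc (≡.trans (ℕ.+-comm m r) (≡.sym (≡.trans (List.length-++ (map _ zs))
          (≡.cong₂ ℕ._+_ (≡.trans (List.length-map _ zs) len) (proj₁ (proj₂ fold)))))))

        p~ : All (uncurry _~_) ps
        p~ = All.++⁺ (All.map⁺ (All.map (λ xx′≈1 → ≡.refl , xx′≈1 , λ ()) zs-inv))
          (All.map root~ (proj₂ (proj₂ (proj₂ fold))))
          where
          root~ : ∀ {ρs} → (let (ρ , ρ′) = ρs in ∃[ i ] ∃[ j ] ρ ≡ rootRow (suc i) × ρ′ ≡ rootRow (suc j) × i ℕ.+ j ≡ m ℕ.+ m) →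
                  uncurry _~_ ρs
          root~ (i , j , ≡.refl , ≡.refl , i+j≡) = ≡.refl ,
            inverse (suc i) (suc j) (≡.trans (≡.cong suc (≡.trans (ℕ.+-suc i j) (≡.cong suc i+j≡))) (≡.sym t≡2+2m)) ,
            λ _ → power-root t ζ^t≈1 (suc i) , power-root t ζ^t≈1 (suc j)

        f~f : All (λ f → f ~ f) fs
        f~f = (≡.refl , half , λ _ → power-root t ζ^t≈1 (suc m) , power-root t ζ^t≈1 (suc m)) ∷
              (≡.refl , *-identityˡ 1# , λ _ → 1^n≈1 t , 1^n≈1 t) ∷ []

        Πscale : prod (map scale (flatten ps ++ fs)) ≈ 1#
        Πscale = begin
          prod (map scale (flatten ps ++ fs))
            ≡⟨ ≡.cong prod (List.map-++ scale (flatten ps) fs) ⟩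
          prod (map scale (flatten ps) ++ map scale fs)
            ≈⟨ prod-++ (map scale (flatten ps)) _ ⟩
          prod (map scale (flatten ps)) * (h ^ C * (1# ^ C * 1#))
            ≈⟨ *-cong (scale-flatten p~) (*-cong h^C≈1 (trans (*-identityʳ _) (1^n≈1 C))) ⟩
          1# * (1# * 1#)
            ≈⟨ trans (*-identityˡ _) (*-identityˡ 1#) ⟩
          1# ∎
          where
          h = ζ ^ suc m
          i = Fin.toℕ i₀
          -- Here h plays the part of -1: the congruence C ≡ 2 i₀ makes h ^ C a power of h * h,
          -- which is 1.
          h^C≈1 : h ^ C ≈ 1#
          h^C≈1 = begin
            h ^ C            ≈⟨ root-power t (power-root t ζ^t≈1 (suc m)) (≡.sym C≋2i₀) ⟩
            h ^ (i ℕ.+ i)    ≈⟨ ^-homo-* h i i ⟩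
            h ^ i * h ^ i    ≈⟨ ^-distrib-* h h i ⟨
            (h * h) ^ i      ≈⟨ trans (^-congˡ i half) (1^n≈1 i) ⟩
            1#               ∎

-- Laurent polynomials that vanish at infinitely many points.

module LaurentDensity {a ℓ} (R : CommutativeRing a ℓ) where
  open import Data.Fin as Fin using (Fin; zero; suc; splitAt; quotRem)
  open import Data.Integer using (+_)
  open import Data.List using (List; []; _∷_; length; map)
  open import Data.Nat as ℕ using (ℕ; zero; suc; _≤_; _∸_)
  import Data.Nat.Properties as ℕ
  open import Data.Product using (_×_; _,_; ∃-syntax)
  open import Data.Sum using (inj₁; inj₂)
  open import Data.Vec as Vec using (Vec)
  open import Data.Vec.Functional as Vector using (Vector; head; tail)
  open import Function using (_∘_)
  open import Relation.Binary.PropositionalEquality as ≡ using (_≡_; _≢_)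
  open CommutativeRing R hiding (zero)
  open import Relation.Binary.Reasoning.Setoid setoid
  open import Algebra.Properties.Semiring.Exp semiring
  open import Algebra.Properties.CommutativeSemiring.Exp commutativeSemiring using (^-distrib-*)
  open IntegerSolver R
  open Summation R
  open RootsOfUnity R
  open Schur R

  horner : List Carrier → Carrier → Carrier
  horner []       y = 0#
  horner (c ∷ cs) y = c + y * horner cs y

  -- The quotient of c + y * horner cs y by y − b, which does not depend on c.
  quotient : List Carrier → Carrier → List Carrier
  quotient []       b = []
  quotient (c ∷ cs) b = horner (c ∷ cs) b ∷ quotient cs b

  length-quotient : ∀ cs b → length (quotient cs b) ≡ length cs
  length-quotient []       b = ≡.refl
  length-quotient (c ∷ cs) b = ≡.cong suc (length-quotient cs b)

  division : ∀ c cs b y → horner (c ∷ cs) y ≈ (y - b) * horner (quotient cs b) y + horner (c ∷ cs) b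
  division c []       b y = solve 3 (λ c b y → c :+ y :* con (+ 0) := (y :- b) :* con (+ 0) :+ (c :+ b :* con (+ 0))) refl c b y
  division c (d ∷ cs) b y = begin
    c + y * horner (d ∷ cs) y
      ≈⟨ +-congˡ (*-congˡ (division d cs b y)) ⟩
    c + y * ((y - b) * q + p)
      ≈⟨ solve 5 (λ c y b q p → c :+ y :* ((y :- b) :* q :+ p) := (y :- b) :* (p :+ y :* q) :+ (c :+ b :* p)) refl c y b q p ⟩
    (y - b) * (p + y * q) + (c + b * p) ∎
    where
    q = horner (quotient cs b) y
    p = horner (d ∷ cs) b

  module _ {f : ℕ → Carrier} (separated : ∀ {i j} → i ≢ j → Unit (f i - f j)) where

    -- Divides by y - f k. The later points remain roots of the quotient because f m - f k is a unit
    -- and cancels. The number `n` of coefficients drives the recursion, as `quotient` is not a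
    -- sublist.
    infinitely-many-roots : ∀ k cs n → length cs ≡ n → (∀ m → k ≤ m → horner cs (f m) ≈ 0#) → ∀ y → horner cs y ≈ 0#
    infinitely-many-roots k []       n       _  _     y = refl
    infinitely-many-roots k (c ∷ cs) (suc n) eq roots y = begin
      horner (c ∷ cs) y                                              ≈⟨ division c cs (f k) y ⟩
      (y - f k) * horner (quotient cs (f k)) y + horner (c ∷ cs) (f k)
        ≈⟨ +-cong (*-congˡ (infinitely-many-roots (suc k) (quotient cs (f k)) n
             (≡.trans (length-quotient cs (f k)) (ℕ.suc-injective eq)) remaining y)) (roots k ℕ.≤-refl) ⟩
      (y - f k) * 0# + 0#                                            ≈⟨ trans (+-identityʳ _) (zeroʳ _) ⟩
      0#                                                             ∎
      where
      remaining : ∀ m → suc k ≤ m → horner (quotient cs (f k)) (f m) ≈ 0#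
      remaining m k<m = unit-cancel (separated (ℕ.>⇒≢ k<m)) (begin
        (f m - f k) * horner (quotient cs (f k)) (f m)
          ≈⟨ trans (+-congˡ (roots k ℕ.≤-refl)) (+-identityʳ _) ⟨
        (f m - f k) * horner (quotient cs (f k)) (f m) + horner (c ∷ cs) (f k)
          ≈⟨ division c cs (f k) (f m) ⟨
        horner (c ∷ cs) (f m)
          ≈⟨ roots m (ℕ.<⇒≤ k<m) ⟩
        0# ∎)

  add : List Carrier → List Carrier → List Carrier
  add []       ds       = ds
  add (c ∷ cs) []       = c ∷ cs
  add (c ∷ cs) (d ∷ ds) = (c + d) ∷ add cs ds

  horner-add : ∀ cs ds y → horner (add cs ds) y ≈ horner cs y + horner ds y
  horner-add []       ds       y = sym (+-identityˡ _)
  horner-add (c ∷ cs) []       y = sym (+-identityʳ _)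
  horner-add (c ∷ cs) (d ∷ ds) y = trans (+-congˡ (*-congˡ (horner-add cs ds y)))
    (solve 5 (λ c d y p q → c :+ d :+ y :* (p :+ q) := (c :+ y :* p) :+ (d :+ y :* q)) refl _ _ _ _ _)

  horner-scale : ∀ c ds y → horner (map (c *_) ds) y ≈ c * horner ds y
  horner-scale c []       y = sym (zeroʳ c)
  horner-scale c (d ∷ ds) y = trans (+-congˡ (*-congˡ (horner-scale c ds y)))
    (solve 4 (λ c d y p → c :* d :+ y :* (c :* p) := c :* (d :+ y :* p)) refl _ _ _ _)

  multiply : List Carrier → List Carrier → List Carrier
  multiply []       ds = []
  multiply (c ∷ cs) ds = add (map (c *_) ds) (0# ∷ multiply cs ds)

  horner-multiply : ∀ cs ds y → horner (multiply cs ds) y ≈ horner cs y * horner ds y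
  horner-multiply []       ds y = sym (zeroˡ _)
  horner-multiply (c ∷ cs) ds y = begin
    horner (add (map (c *_) ds) (0# ∷ multiply cs ds)) y
      ≈⟨ horner-add (map (c *_) ds) _ y ⟩
    horner (map (c *_) ds) y + (0# + y * horner (multiply cs ds) y)
      ≈⟨ +-cong (horner-scale c ds y) (+-congˡ (*-congˡ (horner-multiply cs ds y))) ⟩
    c * horner ds y + (0# + y * (horner cs y * horner ds y))
      ≈⟨ solve 4 (λ c d y p → c :* d :+ (con (+ 0) :+ y :* (p :* d)) := (c :+ y :* p) :* d) refl _ _ _ _ ⟩
    (c + y * horner cs y) * horner ds y ∎

  monomialList : ℕ → List Carrier
  monomialList zero    = 1# ∷ []
  monomialList (suc n) = 0# ∷ monomialList n

  horner-monomialList : ∀ n y → horner (monomialList n) y ≈ y ^ n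
  horner-monomialList zero    y = trans (+-congˡ (zeroʳ y)) (+-identityʳ 1#)
  horner-monomialList (suc n) y = trans (+-identityˡ _) (*-congˡ (horner-monomialList n y))

  -- Laurent polynomials in y, the second argument standing for y⁻¹.
  Laurent : (Carrier → Carrier → Carrier) → Set _
  Laurent G = ∃[ d ] ∃[ cs ] ∀ {y y′} → y * y′ ≈ 1# → y ^ d * G y y′ ≈ horner cs y

  laurent-const : ∀ c → Laurent (λ _ _ → c)
  laurent-const c = 0 , c ∷ [] , λ {y} _ → trans (*-identityˡ c) (sym (trans (+-congˡ (zeroʳ y)) (+-identityʳ c)))

  laurent-var : Laurent (λ y _ → y)
  laurent-var = 0 , monomialList 1 , λ {y} _ →
    trans (*-identityˡ y) (sym (trans (horner-monomialList 1 y) (*-identityʳ y)))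

  laurent-var⁻¹ : Laurent (λ _ y′ → y′)
  laurent-var⁻¹ = 1 , monomialList 0 , λ {y} yy′≈1 →
    trans (*-congʳ (*-identityʳ y)) (trans yy′≈1 (sym (horner-monomialList 0 y)))

  laurent-+ : ∀ {G H} → Laurent G → Laurent H → Laurent (λ y y′ → G y y′ + H y y′)
  laurent-+ {G} {H} (d , cs , p) (e , ds , q) =
    d ℕ.+ e , add (multiply (monomialList e) cs) (multiply (monomialList d) ds) , λ {y} {y′} eq → begin
      y ^ (d ℕ.+ e) * (G y y′ + H y y′)
        ≈⟨ *-congʳ (^-homo-* y d e) ⟩
      y ^ d * y ^ e * (G y y′ + H y y′)
        ≈⟨ solve 4 (λ u v g h → u :* v :* (g :+ h) := v :* (u :* g) :+ u :* (v :* h)) refl _ _ _ _ ⟩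
      y ^ e * (y ^ d * G y y′) + y ^ d * (y ^ e * H y y′)
        ≈⟨ +-cong (*-cong (horner-monomialList e y) (sym (p eq))) (*-cong (horner-monomialList d y) (sym (q eq))) ⟨
      horner (monomialList e) y * horner cs y + horner (monomialList d) y * horner ds y
        ≈⟨ trans (horner-add (multiply (monomialList e) cs) _ y)
                 (+-cong (horner-multiply (monomialList e) cs y) (horner-multiply (monomialList d) ds y)) ⟨
      _ ∎

  laurent-* : ∀ {G H} → Laurent G → Laurent H → Laurent (λ y y′ → G y y′ * H y y′)
  laurent-* {G} {H} (d , cs , p) (e , ds , q) = d ℕ.+ e , multiply cs ds , λ {y} {y′} eq → begin
    y ^ (d ℕ.+ e) * (G y y′ * H y y′)
      ≈⟨ *-congʳ (^-homo-* y d e) ⟩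
    y ^ d * y ^ e * (G y y′ * H y y′)
      ≈⟨ solve 4 (λ u v g h → u :* v :* (g :* h) := (u :* g) :* (v :* h)) refl _ _ _ _ ⟩
    (y ^ d * G y y′) * (y ^ e * H y y′)
      ≈⟨ *-cong (p eq) (q eq) ⟩
    horner cs y * horner ds y
      ≈⟨ horner-multiply cs ds y ⟨
    horner (multiply cs ds) y ∎

  laurent-^ : ∀ {G} → Laurent G → ∀ n → Laurent (λ y y′ → G y y′ ^ n)
  laurent-^ G-l zero    = laurent-const 1#
  laurent-^ G-l (suc n) = laurent-* G-l (laurent-^ G-l n)

  laurent-sum : ∀ {b} {B : Set b} {G : B → Carrier → Carrier → Carrier} → (∀ x → Laurent (G x)) →
                ∀ xs → Laurent (λ y y′ → sum (λ x → G x y y′) xs)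
  laurent-sum G-l []       = laurent-const 0#
  laurent-sum G-l (x ∷ xs) = laurent-+ (G-l x) (laurent-sum G-l xs)

  laurent-zero : ∀ {G} → Laurent G → ∀ {f f′ : ℕ → Carrier} → (∀ {i j} → i ≢ j → Unit (f i - f j)) →
                 (∀ m → f m * f′ m ≈ 1#) → (∀ m → G (f m) (f′ m) ≈ 0#) →
                 ∀ {y y′} → y * y′ ≈ 1# → G y y′ ≈ 0#
  laurent-zero (d , cs , p) separated f-inv vanish {y} {y′} yy′≈1 =
    unit-cancel (y′ ^ d , trans (*-comm _ _) (trans (sym (^-distrib-* y y′ d)) (trans (^-congˡ d yy′≈1) (1^n≈1 d))))
      (trans (p yy′≈1) (infinitely-many-roots separated 0 cs (length cs) ≡.refl
        (λ m _ → trans (sym (p (f-inv m))) (trans (*-congˡ (vanish m)) (zeroʳ _))) y))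

  -- Phrased by substitution, so that letting one coordinate vary and freezing the others at
  -- constants are both instances.
  LaurentMap : ∀ {r} → (Vector Carrier r → Vector Carrier r → Carrier) → Set _
  LaurentMap {r} F = ∀ {z w : Carrier → Carrier → Vector Carrier r} →
    (∀ i → Laurent (λ y y′ → z y y′ i)) → (∀ i → Laurent (λ y y′ → w y y′ i)) → Laurent (λ y y′ → F (z y y′) (w y y′))

  -- Vectors are functions, and pointwise equality does not identify them; splitting a vector into
  -- head and tail has to go through this.
  Congruent : ∀ {r} → (Vector Carrier r → Vector Carrier r → Carrier) → Set _
  Congruent F = ∀ {z z′ w w′} → (∀ i → z i ≈ z′ i) → (∀ i → w i ≈ w′ i) → F z w ≈ F z′ w′

  cons-cong : ∀ {r} {x y} {z z′ : Vector Carrier r} → x ≈ y → (∀ i → z i ≈ z′ i) → ∀ i → (x Vector.∷ z) i ≈ (y Vector.∷ z′) i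
  cons-cong x≈y z≈ zero    = x≈y
  cons-cong x≈y z≈ (suc i) = z≈ i

  cons-η : ∀ {r} (z : Vector Carrier (suc r)) i → z i ≈ (head z Vector.∷ tail z) i
  cons-η z zero    = refl
  cons-η z (suc i) = refl

  laurent-cons : ∀ {r} {G} {z : Carrier → Carrier → Vector Carrier r} → Laurent G → (∀ i → Laurent (λ y y′ → z y y′ i)) →
                 ∀ i → Laurent (λ y y′ → (G y y′ Vector.∷ z y y′) i)
  laurent-cons G-l z-l zero    = G-l
  laurent-cons G-l z-l (suc i) = z-l i

  -- Frees one coordinate at a time. For each sample value of the first coordinate the induction
  -- frees all the others; the first then runs through infinitely many separated points and
  -- `laurent-zero` applies.
  density : ∀ {r : ℕ} {F} → Congruent {r} F → LaurentMap F →
    ∀ {g g′ : Fin r → ℕ → Carrier} → (∀ j {m n} → m ≢ n → Unit (g j m - g j n)) → (∀ j m → g j m * g′ j m ≈ 1#) →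
    (∀ (μ : Fin r → ℕ) → F (λ j → g j (μ j)) (λ j → g′ j (μ j)) ≈ 0#) →
    ∀ {z w} → (∀ j → z j * w j ≈ 1#) → F z w ≈ 0#
  density {zero}  F-cong F-l sep inv vanish zw≈1 = trans (F-cong (λ ()) (λ ())) (vanish λ ())
  density {suc r} {F} F-cong F-l {g} {g′} sep inv vanish {z} {w} zw≈1 =
    trans (F-cong (cons-η z) (cons-η w))
      (laurent-zero (F-l (laurent-cons laurent-var (λ i → laurent-const (tail z i)))
                         (laurent-cons laurent-var⁻¹ (λ i → laurent-const (tail w i))))
        (sep zero) (inv zero) generic-head (zw≈1 zero))
    where
    generic-head : ∀ m → F (g zero m Vector.∷ tail z) (g′ zero m Vector.∷ tail w) ≈ 0#
    generic-head m = density
      {F = λ zs ws → F (g zero m Vector.∷ zs) (g′ zero m Vector.∷ ws)}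
      (λ z≈ w≈ → F-cong (cons-cong refl z≈) (cons-cong refl w≈))
      (λ z-l w-l → F-l (laurent-cons (laurent-const _) z-l) (laurent-cons (laurent-const _) w-l))
      (sep ∘ suc) (inv ∘ suc)
      (λ μ → trans (F-cong {z′ = λ j → g j ((m Vector.∷ μ) j)} {w′ = λ j → g′ j ((m Vector.∷ μ) j)}
                      (λ { zero → refl ; (suc i) → refl }) (λ { zero → refl ; (suc i) → refl }))
                   (vanish (m Vector.∷ μ)))
      (zw≈1 ∘ suc)

  monomial-cong : ∀ {n} (T : Chain n) {x x′ : Vector Carrier n} → (∀ i → x i ≈ x′ i) → monomial T x ≈ monomial T x′
  monomial-cong []      x≈ = refl
  monomial-cong (κ ∷ T) x≈ = *-cong (^-congˡ (Vec.sum κ ∸ size T) (x≈ _)) (monomial-cong T (x≈ ∘ Fin.inject₁))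

  schur-cong : ∀ {n} (κ : Vec ℕ n) {x x′} → (∀ i → x i ≈ x′ i) → schur κ x ≈ schur κ x′
  schur-cong κ x≈ = sum-cong-≗ (λ T → monomial-cong T x≈) (tableaux κ)

  laurent-monomial : ∀ {n} (T : Chain n) {x : Carrier → Carrier → Vector Carrier n} →
                     (∀ i → Laurent (λ y y′ → x y y′ i)) → Laurent (λ y y′ → monomial T (x y y′))
  laurent-monomial []      x-l = laurent-const 1#
  laurent-monomial (κ ∷ T) x-l = laurent-* (laurent-^ (x-l _) (Vec.sum κ ∸ size T)) (laurent-monomial T (x-l ∘ Fin.inject₁))

  laurent-schur : ∀ {n} (κ : Vec ℕ n) {x : Carrier → Carrier → Vector Carrier n} →
                  (∀ i → Laurent (λ y y′ → x y y′ i)) → Laurent (λ y y′ → schur κ (x y y′))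
  laurent-schur κ x-l = laurent-sum (λ T → laurent-monomial T x-l) (tableaux κ)

  module _ (t : ℕ) {r : ℕ} (ζ : Carrier) where

    point-cong : ∀ {z z′ w w′ : Vector Carrier r} → (∀ i → z i ≈ z′ i) → (∀ i → w i ≈ w′ i) →
                 ∀ i → point t ζ z w i ≈ point t ζ z′ w′ i
    point-cong {z} {z′} {w} {w′} z≈ w≈ i with splitAt t i
    ... | inj₁ k = refl
    ... | inj₂ k = mate (quotRem 2 k)
      where
      mate : ∀ ((b , j) : Fin 2 × Fin r) → (z j Vector.∷ w j Vector.∷ Vector.[]) b ≈ (z′ j Vector.∷ w′ j Vector.∷ Vector.[]) b
      mate (zero     , j) = z≈ j
      mate (suc zero , j) = w≈ j

    laurent-point : ∀ {z w : Carrier → Carrier → Vector Carrier r} →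
                    (∀ i → Laurent (λ y y′ → z y y′ i)) → (∀ i → Laurent (λ y y′ → w y y′ i)) →
                    ∀ i → Laurent (λ y y′ → point t ζ (z y y′) (w y y′) i)
    laurent-point {z} {w} z-l w-l i with splitAt t i
    ... | inj₁ k = laurent-const _
    ... | inj₂ k = mate (quotRem 2 k)
      where
      mate : ∀ ((b , j) : Fin 2 × Fin r) → Laurent (λ y y′ → (z y y′ j Vector.∷ w y y′ j Vector.∷ Vector.[]) b)
      mate (zero     , j) = z-l j
      mate (suc zero , j) = w-l j

    schur-point-density : ∀ (κ : Vec ℕ (t ℕ.+ r ℕ.* 2)) {g g′ : Fin r → ℕ → Carrier} →
      (∀ j {m n} → m ≢ n → Unit (g j m - g j n)) → (∀ j m → g j m * g′ j m ≈ 1#) →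
      (∀ (μ : Fin r → ℕ) → schur κ (point t ζ (λ j → g j (μ j)) (λ j → g′ j (μ j))) ≈ 0#) →
      ∀ {z w} → (∀ j → z j * w j ≈ 1#) → schur κ (point t ζ z w) ≈ 0#
    schur-point-density κ = density (λ z≈ w≈ → schur-cong κ (point-cong z≈ w≈))
                                    (λ z-l w-l → laurent-schur κ (laurent-point z-l w-l))

-- Sample points with an invertible Vandermonde determinant.

module GenericPoint {a ℓ} (R : CommutativeRing a ℓ) where
  open import Data.Empty using (⊥-elim)
  open import Data.Fin as Fin using (Fin; zero; suc; toℕ)
  import Data.Fin.Properties as Fin
  open import Data.Integer using (+_)
  open import Data.List using (List; []; _∷_; _++_; map; tabulate; applyUpTo; upTo; concat)
  import Data.List.Properties as List
  open import Data.List.Relation.Binary.Permutation.Propositional using (_↭_; prep; ↭-refl; ↭-trans; ↭-sym; ↭-reflexive)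
  open import Data.List.Relation.Binary.Permutation.Propositional.Properties using (∷↭∷ʳ; ++-comm)
  open import Data.List.Relation.Unary.All as All using (All; []; _∷_)
  import Data.List.Relation.Unary.All.Properties as All
  open import Data.List.Relation.Unary.AllPairs as AllPairs using (AllPairs; []; _∷_)
  import Data.List.Relation.Unary.AllPairs.Properties as AllPairs
  open import Data.Nat as ℕ using (zero; suc; _<_)
  open import Data.Nat.DivMod using (_%_; [m+kn]%n≡m%n; m<n⇒m%n≡m)
  import Data.Nat.Properties as ℕ
  open import Data.Product using (_,_; ∃-syntax; proj₁; proj₂)
  open import Data.Vec.Functional as Vector using (Vector; init; last; tail)
  import Data.Vec.Functional.Properties as Vector
  open import Data.Sum using (inj₁; inj₂)
  open import Function using (_∘_; id)
  open import Relation.Binary using (tri<; tri≈; tri>)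
  open import Relation.Binary.Definitions using (Symmetric)
  open import Relation.Binary.PropositionalEquality as ≡ using (_≡_; _≢_)
  open CommutativeRing R hiding (zero)
  open import Relation.Binary.Reasoning.Setoid setoid
  open import Algebra.Properties.Ring ring
  open import Algebra.Properties.Semiring.Exp semiring
  open import Algebra.Properties.Semiring.Mult semiring using (×-homo-+; ×1-homo-*) renaming (_×_ to _·_)
  open IntegerSolver R
  open Determinant R using (prod)
  open Bialternant R using (rows; vandermonde)
  open RootsOfUnity R
  open Pairing using (flatten; AllPairs-resp-↭)
  open Schur R

  tabulate-∷ʳ : ∀ {n} (x : Vector Carrier (suc n)) → tabulate x ≡ tabulate (init x) ++ last x ∷ []
  tabulate-∷ʳ {zero}  x = ≡.refl
  tabulate-∷ʳ {suc n} x = ≡.cong (x zero ∷_) (tabulate-∷ʳ (tail x))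

  rows↭tabulate : ∀ {n} (x : Vector Carrier n) → rows x ↭ tabulate x
  rows↭tabulate {zero}  x = ↭-refl
  rows↭tabulate {suc n} x = ↭-trans (prep (last x) (rows↭tabulate (init x)))
    (↭-trans (∷↭∷ʳ (last x) _) (↭-reflexive (≡.sym (tabulate-∷ʳ x))))

  tabulate-↑ : ∀ m {n} (x : Vector Carrier (m ℕ.+ n)) → tabulate x ≡ tabulate (x ∘ (Fin._↑ˡ n)) ++ tabulate (x ∘ (m Fin.↑ʳ_))
  tabulate-↑ zero    x = ≡.refl
  tabulate-↑ (suc m) x = ≡.cong (x zero ∷_) (tabulate-↑ m (tail x))

  tabulate-toℕ : ∀ n (f : ℕ → Carrier) → tabulate {n = n} (f ∘ toℕ) ≡ applyUpTo f n
  tabulate-toℕ zero    f = ≡.refl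
  tabulate-toℕ (suc n) f = ≡.cong (f 0 ∷_) (tabulate-toℕ n (f ∘ suc))

  tabulate-concat : ∀ {r} (z w : Vector Carrier r) →
    tabulate (Vector.concat (λ i → z i Vector.∷ (w i Vector.∷ Vector.[]))) ≡ flatten (tabulate (λ j → z j , w j))
  tabulate-concat {zero}  z w = ≡.refl
  tabulate-concat {suc r} z w = ≡.cong (λ xs → z zero ∷ w zero ∷ xs) (tabulate-concat (tail z) (tail w))

  -- Places the inverse pairs before the roots of unity, the arrangement that `det-inversePairs`
  -- works with.
  rows-point : ∀ t {r} ζ (z w : Vector Carrier r) →
               rows (point t ζ z w) ↭ flatten (tabulate (λ j → z j , w j)) ++ map (ζ ^_) (upTo t)
  rows-point t {r} ζ z w = ↭-trans (rows↭tabulate (point t ζ z w)) (↭-trans (↭-reflexive split) (++-comm (map (ζ ^_) (upTo t)) _))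
    where
    us : Vector Carrier t
    us k = ζ ^ toℕ k
    zws : Vector Carrier (r ℕ.* 2)
    zws = Vector.concat (λ i → z i Vector.∷ (w i Vector.∷ Vector.[]))
    split : tabulate (point t ζ z w) ≡ map (ζ ^_) (upTo t) ++ flatten (tabulate (λ j → z j , w j))
    split = ≡.trans (tabulate-↑ t (point t ζ z w)) (≡.cong₂ _++_
      (≡.trans (List.tabulate-cong (Vector.lookup-++ˡ us zws))
        (≡.trans (tabulate-toℕ t (ζ ^_)) (≡.sym (List.map-applyUpTo id (ζ ^_) t))))
      (≡.trans (List.tabulate-cong (Vector.lookup-++ʳ us zws)) (tabulate-concat z w)))

  unit-resp : ∀ {x y} → x ≈ y → Unit x → Unit y
  unit-resp x≈y (v , vx≈1) = v , trans (*-congˡ (sym x≈y)) vx≈1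

  unit-* : ∀ {x y} → Unit x → Unit y → Unit (x * y)
  unit-* {x} {y} (u , ux≈1) (v , vy≈1) = u * v , (begin
    u * v * (x * y)     ≈⟨ solve 4 (λ u v x y → u :* v :* (x :* y) := (u :* x) :* (v :* y)) refl u v x y ⟩
    (u * x) * (v * y)   ≈⟨ *-cong ux≈1 vy≈1 ⟩
    1# * 1#             ≈⟨ *-identityˡ 1# ⟩
    1#                  ∎)

  unit-neg : ∀ {x} → Unit x → Unit (- x)
  unit-neg {x} (u , ux≈1) = - u , trans (solve 2 (λ u x → :- u :* :- x := u :* x) refl u x) ux≈1

  unit-factor : ∀ {x y} → Unit (x * y) → Unit x
  unit-factor {x} {y} (u , uxy≈1) = u * y , trans (solve 3 (λ u x y → u :* y :* x := u :* (x :* y)) refl u x y) uxy≈1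

  unit-^ : ∀ {x} → Unit x → ∀ n → Unit (x ^ n)
  unit-^ x-unit zero    = 1# , *-identityˡ 1#
  unit-^ x-unit (suc n) = unit-* x-unit (unit-^ x-unit n)

  infix 4 _⌿_
  _⌿_ : Carrier → Carrier → Set _
  x ⌿ y = Unit (x - y)

  ⌿-sym : Symmetric _⌿_
  ⌿-sym {x} {y} = unit-resp (⁻¹-anti-homo‿- x y) ∘ unit-neg

  vandermonde-unit : ∀ {xs} → AllPairs _⌿_ xs → Unit (vandermonde xs)
  vandermonde-unit []          = 1# , *-identityˡ 1#
  vandermonde-unit (y⌿ ∷ xs⌿) = unit-* (products y⌿) (vandermonde-unit xs⌿)
    where
    products : ∀ {y xs} → All (y ⌿_) xs → Unit (prod (map (λ x → y - x) xs))
    products []          = 1# , *-identityˡ 1#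
    products (y⌿x ∷ y⌿) = unit-* y⌿x (products y⌿)

  power-difference : ∀ x y n → ∃[ s ] (x - y) * s ≈ x ^ n - y ^ n
  power-difference x y zero    = 0# , trans (zeroʳ _) (sym (-‿inverseʳ 1#))
  power-difference x y (suc n) with power-difference x y n
  ... | s , eq = x * s + y ^ n , (begin
    (x - y) * (x * s + y ^ n)
      ≈⟨ solve 4 (λ x y s p → (x :- y) :* (x :* s :+ p) := x :* ((x :- y) :* s) :+ (x :- y) :* p) refl x y s _ ⟩
    x * ((x - y) * s) + (x - y) * y ^ n
      ≈⟨ +-congʳ (*-congˡ eq) ⟩
    x * (x ^ n - y ^ n) + (x - y) * y ^ n
      ≈⟨ solve 4 (λ x y p q → x :* (p :- q) :+ (x :- y) :* q := x :* p :- y :* q) refl x y _ _ ⟩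
    x ^ suc n - y ^ suc n ∎)

  -- The difference x - y divides x ^ n - y ^ n. For an integer x and a root of unity y the latter
  -- is a difference of integers.
  ⌿-power : ∀ {x y} n → x ^ n ⌿ y ^ n → x ⌿ y
  ⌿-power {x} {y} n x^n⌿y^n with power-difference x y n
  ... | s , eq = unit-factor (unit-resp (sym eq) x^n⌿y^n)

  module _ {t : ℕ} {ζ : Carrier} (ζ^t≈1 : ζ ^ suc t ≈ 1#) (isPrimitive : ∀ k → 0 < k → k < suc t → Unit (ζ ^ k - 1#)) where

    ζ-unit : Unit ζ
    ζ-unit = ζ ^ t , trans (*-comm _ _) ζ^t≈1

    powers-⌿ : AllPairs _⌿_ (map (ζ ^_) (upTo (suc t)))
    powers-⌿ = ≡.subst (AllPairs _⌿_) (≡.sym (List.map-applyUpTo id (ζ ^_) (suc t)))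
      (AllPairs.applyUpTo⁺₁ (ζ ^_) (suc t) λ i<j j<t → ⌿-sym (later i<j j<t))
      where
      later : ∀ {i j} → i < j → j < suc t → ζ ^ j ⌿ ζ ^ i
      later {i} {j} i<j j<t = unit-resp factor
        (unit-* (unit-^ ζ-unit i) (isPrimitive (j ℕ.∸ i) (ℕ.m<n⇒0<n∸m i<j) (ℕ.≤-<-trans (ℕ.m∸n≤m j i) j<t)))
        where
        factor : ζ ^ i * (ζ ^ (j ℕ.∸ i) - 1#) ≈ ζ ^ j - ζ ^ i
        factor = begin
          ζ ^ i * (ζ ^ (j ℕ.∸ i) - 1#)          ≈⟨ x[y-z]≈xy-xz _ _ _ ⟩
          ζ ^ i * ζ ^ (j ℕ.∸ i) - ζ ^ i * 1#    ≈⟨ +-cong (sym (^-homo-* ζ i _)) (-‿cong (*-identityʳ _)) ⟩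
          ζ ^ (i ℕ.+ (j ℕ.∸ i)) - ζ ^ i         ≡⟨ ≡.cong (λ n → ζ ^ n - ζ ^ i) (ℕ.m+[n∸m]≡n (ℕ.<⇒≤ i<j)) ⟩
          ζ ^ j - ζ ^ i                         ∎

  -- Distinct coordinates use distinct residues modulo r, so that they never
  -- meet.
  index : ∀ {r} → Fin r → ℕ → ℕ
  index {r} j m = toℕ j ℕ.+ m ℕ.* r

  index-coordinate : ∀ {r} {i j : Fin r} {m n} → i ≢ j → index i m ≢ index j n
  index-coordinate {suc r} {i} {j} {m} {n} i≢j eq = i≢j (Fin.toℕ-injective (≡.trans (≡.sym (residue i m)) (≡.trans (≡.cong (_% suc r) eq) (residue j n))))
    where
    residue : ∀ (i : Fin (suc r)) m → index i m % suc r ≡ toℕ i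
    residue i m = ≡.trans ([m+kn]%n≡m%n (toℕ i) m (suc r)) (m<n⇒m%n≡m (Fin.toℕ<n i))

  index-value : ∀ {r} (j : Fin r) {m n} → m ≢ n → index j m ≢ index j n
  index-value {suc r} j {m} {n} m≢n eq = m≢n (ℕ.*-cancelʳ-≡ m n (suc r) (ℕ.+-cancelˡ-≡ (toℕ j) _ _ eq))

  module _ (positive-unit : ∀ k → Unit (suc k · 1#)) where

    nat : ℕ → Carrier
    nat k = k · 1#

    nat⁻¹ : ℕ → Carrier
    nat⁻¹ k = proj₁ (positive-unit k)

    nat-⌿-< : ∀ {m n} → m < n → nat n ⌿ nat m
    nat-⌿-< {m} m<n with ℕ.m≤n⇒∃[o]m+o≡n m<n
    ... | o , ≡.refl = unit-resp (begin
      nat (suc o)                      ≈⟨ solve 2 (λ u v → u := v :+ u :- v) refl _ (nat m) ⟩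
      nat m + nat (suc o) - nat m      ≈⟨ +-congʳ (×-homo-+ 1# m (suc o)) ⟨
      nat (m ℕ.+ suc o) - nat m        ≡⟨ ≡.cong (λ k → nat k - nat m) (ℕ.+-suc m o) ⟩
      nat (suc m ℕ.+ o) - nat m        ∎) (positive-unit o)

    nat-⌿ : ∀ {m n} → m ≢ n → nat m ⌿ nat n
    nat-⌿ {m} {n} m≢n with ℕ.<-cmp m n
    ... | tri< m<n _ _ = ⌿-sym (nat-⌿-< m<n)
    ... | tri≈ _ m≡n _ = ⊥-elim (m≢n m≡n)
    ... | tri> _ _ n<m = nat-⌿-< n<m

    nat-^ : ∀ m n → nat m ^ n ≈ nat (m ℕ.^ n)
    nat-^ m zero    = sym (+-identityʳ 1#)
    nat-^ m (suc n) = trans (*-congˡ (nat-^ m n)) (sym (×1-homo-* m (m ℕ.^ n)))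

    -- The values start at 2, so that no product of two of them and no positive power of one equals
    -- 1.
    record Generic (k : ℕ) (x w : Carrier) : Set ℓ where
      field
        x≈  : x ≈ nat (suc (suc k))
        inv : x * w ≈ 1#
    open Generic

    generic-unit : ∀ {k x w} → Generic k x w → Unit w
    generic-unit {x = x} g = x , g .inv

    generic-x⌿x : ∀ {k m x w y v} → Generic k x w → Generic m y v → k ≢ m → x ⌿ y
    generic-x⌿x g h k≢m = unit-resp (+-cong (sym (g .x≈)) (-‿cong (sym (h .x≈)))) (nat-⌿ (k≢m ∘ ℕ.suc-injective ∘ ℕ.suc-injective))

    -- Up to the unit v the difference is x y - 1, where x y is an integer at least 4. The case k =
    -- m separates a coordinate from its own inverse.
    generic-x⌿w : ∀ {k m x w y v} → Generic k x w → Generic m y v → x ⌿ v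
    generic-x⌿w {k} {m} {x} {w} {y} {v} g h = unit-resp factor (unit-* (generic-unit h) (nat-⌿ {suc (suc k) ℕ.* suc (suc m)} {1} λ ()))
      where
      factor : v * (nat (suc (suc k) ℕ.* suc (suc m)) - nat 1) ≈ x - v
      factor = begin
        v * (nat (suc (suc k) ℕ.* suc (suc m)) - nat 1)
          ≈⟨ *-congˡ (+-cong (trans (×1-homo-* (suc (suc k)) (suc (suc m))) (*-cong (sym (g .x≈)) (sym (h .x≈))))
                             (-‿cong (+-identityʳ 1#))) ⟩
        v * (x * y - 1#)
          ≈⟨ solve 4 (λ v x y o → v :* (x :* y :- o) := x :* (y :* v) :- v :* o) refl v x y 1# ⟩
        x * (y * v) - v * 1#
          ≈⟨ +-cong (trans (*-congˡ (h .inv)) (*-identityʳ x)) (-‿cong (*-identityʳ v)) ⟩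
        x - v ∎

    generic-w⌿w : ∀ {k m x w y v} → Generic k x w → Generic m y v → k ≢ m → w ⌿ v
    generic-w⌿w {k} {m} {x} {w} {y} {v} g h k≢m =
      unit-resp factor (unit-* (unit-* (generic-unit g) (generic-unit h)) (generic-x⌿x h g (k≢m ∘ ≡.sym)))
      where
      factor : w * v * (y - x) ≈ w - v
      factor = begin
        w * v * (y - x)              ≈⟨ solve 4 (λ w v y x → w :* v :* (y :- x) := w :* (y :* v) :- v :* (x :* w)) refl w v y x ⟩
        w * (y * v) - v * (x * w)    ≈⟨ +-cong (trans (*-congˡ (h .inv)) (*-identityʳ w)) (-‿cong (trans (*-congˡ (g .inv)) (*-identityʳ v))) ⟩
        w - v                        ∎

    generic-x⌿root : ∀ {k x w u} t → Generic k x w → u ^ suc t ≈ 1# → x ⌿ u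
    generic-x⌿root {k} {x} {w} {u} t g u^t≈1 = ⌿-power (suc t) (unit-resp
      (+-cong (trans (sym (nat-^ (suc (suc k)) (suc t))) (^-congˡ (suc t) (sym (g .x≈)))) (-‿cong (trans (+-identityʳ 1#) (sym u^t≈1))))
      (nat-⌿ {suc (suc k) ℕ.^ suc t} {1} power≢1))
      where
      power≢1 : suc (suc k) ℕ.^ suc t ≢ 1
      power≢1 eq with ℕ.m^n≡1⇒n≡0∨m≡1 (suc (suc k)) (suc t) eq
      ... | inj₁ ()
      ... | inj₂ ()

    -- Inversion reduces this to `generic-x⌿root`: up to units w - u is u ^ t - x, and u ^ t is the
    -- inverse of u, again a root of unity.
    generic-w⌿root : ∀ {k x w u} t → Generic k x w → u ^ suc t ≈ 1# → w ⌿ u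
    generic-w⌿root {k} {x} {w} {u} t g u^t≈1 = unit-resp factor
      (unit-* (unit-* (generic-unit g) (u ^ t , trans (*-comm _ u) u^t≈1)) (⌿-sym (generic-x⌿root t g inverse-root)))
      where
      inverse-root : (u ^ t) ^ suc t ≈ 1#
      inverse-root = trans (^-comm-exponents u t (suc t)) (trans (^-congˡ t u^t≈1) (1^n≈1 t))
      factor : w * u * (u ^ t - x) ≈ w - u
      factor = begin
        w * u * (u ^ t - x)              ≈⟨ solve 4 (λ w u v x → w :* u :* (v :- x) := w :* (u :* v) :- u :* (x :* w)) refl w u _ x ⟩
        w * (u * u ^ t) - u * (x * w)    ≈⟨ +-cong (trans (*-congˡ u^t≈1) (*-identityʳ w)) (-‿cong (trans (*-congˡ (g .inv)) (*-identityʳ u))) ⟩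
        w - u                            ∎

    generic-point-⌿ : ∀ {r} t {ζ} → ζ ^ suc t ≈ 1# → (∀ k → 0 < k → k < suc t → Unit (ζ ^ k - 1#)) →
      ∀ {k : Fin r → ℕ} {z w} → (∀ {i j} → i ≢ j → k i ≢ k j) → (∀ j → Generic (k j) (z j) (w j)) →
      AllPairs _⌿_ (rows (point (suc t) ζ z w))
    generic-point-⌿ t {ζ} ζ^t≈1 isPrimitive {k} {z} {w} k-injective g =
      AllPairs-resp-↭ ⌿-sym (↭-sym (rows-point (suc t) ζ z w))
        (AllPairs.++⁺ (AllPairs.concat⁺ within across) (powers-⌿ ζ^t≈1 isPrimitive) with-roots)
      where
      mates : List (List Carrier)
      mates = map (λ (x , y) → x ∷ y ∷ []) (tabulate (λ j → z j , w j))
      within : All (AllPairs _⌿_) mates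
      within = All.map⁺ (All.tabulate⁺ λ j → (generic-x⌿w (g j) (g j) ∷ []) ∷ [] ∷ [])
      across : AllPairs (λ xs ys → All (λ x → All (x ⌿_) ys) xs) mates
      across = AllPairs.map⁺ (AllPairs.tabulate⁺ λ {i} {j} i≢j →
        (generic-x⌿x (g i) (g j) (k-injective i≢j) ∷ generic-x⌿w (g i) (g j) ∷ []) ∷
        (⌿-sym (generic-x⌿w (g j) (g i)) ∷ generic-w⌿w (g i) (g j) (k-injective i≢j) ∷ []) ∷ [])
      with-roots : All (λ x → All (x ⌿_) (map (ζ ^_) (upTo (suc t)))) (concat mates)
      with-roots = All.concat⁺ (All.map⁺ (All.tabulate⁺ λ j →
        All.map⁺ (All.universal (λ i → generic-x⌿root t (g j) (power-root (suc t) ζ^t≈1 i)) (upTo (suc t))) ∷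
        All.map⁺ (All.universal (λ i → generic-w⌿root t (g j) (power-root (suc t) ζ^t≈1 i)) (upTo (suc t))) ∷ []))

    sample sample⁻¹ : ∀ {r} → Fin r → ℕ → Carrier
    sample   j m = nat (suc (suc (index j m)))
    sample⁻¹ j m = nat⁻¹ (suc (index j m))

    sample-generic : ∀ {r} (j : Fin r) m → Generic (index j m) (sample j m) (sample⁻¹ j m)
    sample-generic j m .x≈  = refl
    sample-generic j m .inv = trans (*-comm _ _) (proj₂ (positive-unit (suc (index j m))))

    sample-separated : ∀ {r} (j : Fin r) {m n} → m ≢ n → sample j m ⌿ sample j n
    sample-separated j {m} {n} m≢n = generic-x⌿x (sample-generic j m) (sample-generic j n) (index-value j m≢n)

-- From sample points to all points, in characteristic zero.

module Vanishing {a ℓ₁ ℓ₂} (K : HeytingField a ℓ₁ ℓ₂) (characteristicZero : Field.CharacteristicZero K) where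
  open import Algebra.Bundles using (CommutativeRing)
  import Data.List.Properties as List
  open import Data.List using (map; tabulate; _++_)
  open import Data.List.Relation.Binary.Permutation.Propositional.Properties using (map⁺)
  open import Data.List.Relation.Unary.All.Properties using (tabulate⁺)
  open import Data.Nat as ℕ using (zero; suc; _<_; _≤_; _≥_)
  open import Data.Product using (_,_; proj₁; proj₂)
  open import Data.Vec.Functional using (Vector)
  import Relation.Binary.PropositionalEquality as ≡
  open Field K using (ring; IsPrimitiveRoot)
  open HeytingField K using (#⇒invertible)
  open CommutativeRing ring hiding (zero; ring)
  open import Relation.Binary.Reasoning.Setoid setoid
  open import Algebra.Properties.Ring (CommutativeRing.ring ring) using (-0#≈0#)
  open import Algebra.Properties.Semiring.Exp semiring using (_^_)
  open import Algebra.Properties.Semiring.Mult semiring using () renaming (_×_ to _·_)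
  open Schur ring
  open BetaNumbers using (betas; β≡betas)
  open Determinant ring
  open Bialternant ring
  open RootsOfUnity ring
  open LaurentDensity ring
  open GenericPoint ring
  open Pairing using (flatten)

  positive-unit : ∀ k → Unit (suc k · 1#)
  positive-unit k with #⇒invertible (characteristicZero k)
  -- Apartness from 0 yields an inverse of the difference with 0, which has to be simplified.
  ... | u , u*k≈1 , _ = unit-resp (trans (+-congˡ -0#≈0#) (+-identityʳ _)) (u , u*k≈1)

  x≈-x⇒x≈0 : ∀ x → x ≈ - x → x ≈ 0#
  x≈-x⇒x≈0 x x≈-x = unit-cancel (positive-unit 1) (begin
    (1# + (1# + 0#)) * x   ≈⟨ trans (*-congʳ (+-congˡ (+-identityʳ 1#))) (distribʳ x 1# 1#) ⟩
    1# * x + 1# * x        ≈⟨ +-cong (*-identityˡ x) (*-identityˡ x) ⟩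
    x + x                  ≈⟨ +-congˡ x≈-x ⟩
    x - x                  ≈⟨ -‿inverseʳ x ⟩
    0#                     ∎)

  module _ (t r : ℕ) (2≤t : 2 ≤ suc t) (ζ : Carrier) (ζ-primitive : IsPrimitiveRoot (suc t) ζ)
           (shape : Vec ℕ (suc t ℕ.+ r ℕ.* 2)) (shape↘ : Linked _≥_ shape)
           (n≥1 : (i : Fin (suc t)) → 1 ≤ BetaSet.n (suc t) shape i)
           (C : ℕ) (𝓢≤C : All (_≤ C) (BetaSet.𝓢 (suc t) shape)) (symmetric : SymmetricAbout C (BetaSet.𝓢 (suc t) shape))
           (i₀ : Fin (suc t)) (i₀∈𝓔 : BetaSet.𝓔 (suc t) shape i₀) (C∈Δ : C ∈ BetaSet.Δ (suc t) shape i₀) where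

    open InversePairs ring (suc t) shape shape↘ n≥1 C 𝓢≤C symmetric i₀ i₀∈𝓔 C∈Δ

    ζ^t≈1 : ζ ^ suc t ≈ 1#
    ζ^t≈1 = proj₁ ζ-primitive

    ζ-unit-differences : ∀ k → 0 < k → k < suc t → Unit (ζ ^ k - 1#)
    ζ-unit-differences k 0<k k<t with #⇒invertible (proj₂ ζ-primitive k 0<k k<t)
    ... | u , u*≈1 , _ = u , u*≈1

    -- Distinct coordinates draw on disjoint sets of integers, so the Vandermonde factor is a unit
    -- for every choice of `μ` and can be cancelled from the bialternant formula.
    schur-sample : ∀ (μ : Fin r → ℕ) →
      schur shape (point (suc t) ζ (λ j → sample positive-unit j (μ j)) (λ j → sample⁻¹ positive-unit j (μ j))) ≈ 0#
    schur-sample μ = unit-cancel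
      (vandermonde-unit (generic-point-⌿ positive-unit t ζ^t≈1 ζ-unit-differences (λ {i} {j} → index-coordinate {m = μ i} {n = μ j})
        (λ j → sample-generic positive-unit j (μ j))))
      (begin
        vandermonde (rows x) * schur shape x
          ≈⟨ bialternant shape shape↘ x ⟨
        det (map _^_ (rows x)) (betas shape)
          ≈⟨ det-↭-zero (map⁺ _^_ (rows-point (suc t) ζ z w)) (≡.subst
               (λ bs → det (map _^_ (flatten (tabulate (λ j → z j , w j)) ++ _)) bs ≈ 0#) (β≡betas (suc t) shape)
               (det-inversePairs ζ^t≈1 ζ-unit-differences (positive-unit t) x≈-x⇒x≈0 r 2≤t ≡.refl _
                 (List.length-tabulate _) (tabulate⁺ λ j → Generic.inv (sample-generic positive-unit j (μ j))))) ⟩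
        0# ∎)
      where
      z w : Vector Carrier r
      z j = sample positive-unit j (μ j)
      w j = sample⁻¹ positive-unit j (μ j)
      x = point (suc t) ζ z w

    schur-zero : ∀ (z w : Vector Carrier r) → (∀ j → z j * w j ≈ 1#) → schur shape (point (suc t) ζ z w) ≈ 0#
    schur-zero z w = schur-point-density (suc t) ζ shape (sample-separated positive-unit)
      (λ j m → Generic.inv (sample-generic positive-unit j m)) schur-sample

open import Algebra.Apartness.Bundles using (HeytingField)
open import Data.Nat using (ℕ; _+_; _*_; _≤_; _≥_; NonZero)
open import Data.Fin using (Fin)
open import Data.Product using (_×_; ∃-syntax)
open import Data.Vec using (Vec)
open import Data.Vec.Relation.Unary.Linked using (Linked)
open import Data.Vec.Functional using (Vector)
open import Data.List.Membership.Propositional using (_∈_)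
open import Defs
import Data.Nat as ℕ
import Data.Nat.Properties as ℕ
import Data.List.Relation.Unary.All as All
open import Data.Product using (_,_)

theorem8p35 : ∀ {a ℓ₁ ℓ₂} (K : HeytingField a ℓ₁ ℓ₂) →
    let open Field K in
    CharacteristicZero →
    (t r : ℕ) .{{_ : NonZero t}} → 2 ≤ t → 1 ≤ r →
    (ζ : Carrier) → IsPrimitiveRoot t ζ →
    (shape : Vec ℕ (t + r * 2)) → Linked _≥_ shape →
    let open BetaSet t shape in
    ((i : Fin t) → 1 ≤ n i) →
    (min𝓢 max𝓢 : ℕ) → IsMinimum 𝓢 min𝓢 → IsMaximum 𝓢 max𝓢 →
    let C = min𝓢 + max𝓢 in
    SymmetricAbout C 𝓢 →
    ∃[ i ] (𝓔 i × C ∈ Δ i) →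
    (z z⁻¹ : Vector Carrier r) → (∀ j → z j *ᴷ z⁻¹ j ≈ 1#) →
    schur shape (point t ζ z z⁻¹) ≈ 0#
theorem8p35 K char0 ℕ.zero r () 1≤r
theorem8p35 K char0 (ℕ.suc t) r 2≤t 1≤r ζ ζ-primitive shape shape↘ n≥1 min𝓢 max𝓢 _ (_ , 𝓢≤max) symmetric (i , i∈𝓔 , C∈Δ) =
  Vanishing.schur-zero K char0 t r 2≤t ζ ζ-primitive shape shape↘ n≥1
    -- Every element of `𝓢` is at most max𝓢, hence at most C, so the truncated subtraction in
    -- `SymmetricAbout` is subtraction.
    (min𝓢 + max𝓢) (All.map (λ b≤max → ℕ.≤-trans b≤max (ℕ.m≤n+m max𝓢 min𝓢)) 𝓢≤max) symmetric i i∈𝓔 C∈Δ
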